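{- Let $d\ge 1$ be an integer and $\sigma$ a finite relational signature. For every order-invariant sentence $\varphi\in\mathrm{MSO}[\sigma\cup\{\le\}]$ (i.e. every ${<}\text{ -inv- }\mathrm{MSO}[\sigma]$-sentence) there is an $\mathrm{FO{+}MOD}[\sigma]$-sentence $\psi$ (not using $\le$) with $\operatorname{qad}(\psi)\le 3d$ which is equivalent to $\varphi$ on $\mathrm{Fin}_{\sigma,d}$, i.e. for every $\mathfrak A\in\mathrm{Fin}_{\sigma,d}$, $\mathfrak A\models_{\le}\varphi$ if and only if $\mathfrak A\models\psi$.
   Context: All structures are finite. $\mathrm{MSO}$ is monadic second-order logic. $\mathrm{FO{+}MOD}$ is first-order logic extended by the modulo-counting quantifiers $\exists^{i\,(\mathrm{mod}\,p)}$ for all $i\in\mathbb N$, $p\ge1$, where $\mathfrak A\models\exists^{i\,(\mathrm{mod}\,p)}x\,\varphi(x,\bar a)$ iff $|\{b\in A:\mathfrak A\models\varphi(b,\bar a)\}|\equiv i \pmod p$. Tree-depth: for a finite simple graph $G$, $\operatorname{td}(G)=1$ if $|V(G)|=1$; $\operatorname{td}(G)=1+\min_{r\in V(G)}\operatorname{td}(G\setminus r)$ if $G$ is connected and $|V(G)|>1$; $\operatorname{td}(G)=\max_i \operatorname{td}(K_i)$ if $G$ is disconnected with components $K_1,\dots,K_n$. The Gaifman graph of a $\sigma$-structure $\mathfrak A$ has the universe $A$ as vertex set, with an edge between distinct $x,y$ iff they occur together in a tuple of some relation of $\mathfrak A$. The tree-depth of $\mathfrak A$ is that of its Gaifman graph.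 $\mathrm{Fin}_{\sigma,d}$ is the class of finite $\sigma$-structures of tree-depth at most $d$. Order-invariance: $\le$ is a binary relation symbol not in $\sigma$. An ordered expansion $(\mathfrak A,\preceq)$ of a $\sigma$-structure interprets $\le$ by a linear order $\preceq$ on $A$. A sentence $\varphi\in \mathrm{MSO}[\sigma\cup\{\le\}]$ is order-invariant (on all finite structures) if for every finite $\sigma$-structure $\mathfrak A$ and any two ordered expansions, $(\mathfrak A,\preceq_1)\models\varphi$ iff $(\mathfrak A,\preceq_2)\models\varphi$. For such $\varphi$, $\mathfrak A\models_{\le}\varphi$ means $(\mathfrak A,\preceq)\models\varphi$ for some (equivalently every) ordered expansion. The quantifier alternation depth $\operatorname{qad}(\varphi)$ of a formula in negation normal form (negations only in front of atoms) is the maximum number of alternations between $\exists$- and $\forall$-quantifiers on directed paths of the syntax tree; for other formulae it is that of an equivalent formula in negation normal form obtained by a fixed conversion procedure. -}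

module Defs where

open import Data.Bool.Base using (Bool; true; false; T)
open import Data.Fin.Base using (Fin; zero; suc)
open import Data.Fin.Subset using (Subset; _∈_; ∣_∣; _-_; ⊤)
open import Data.List.Base using (List; []; _∷_; map; filter; foldr; upTo)
open import Data.Nat.Base using (ℕ; zero; suc; _+_; _⊔_; _≤_; _<_; NonZero)
open import Data.Nat.DivMod using (_%_)
open import Data.Nat.Properties using (_≟_)
open import Data.Product.Base using (Σ; ∃; ∃-syntax; _×_; _,_)
open import Data.Sum.Base using (_⊎_)
open import Data.Vec.Base as Vec using (Vec; []; _∷_; lookup)
import Data.Vec.Functional as Vector
open import Data.Vec.Functional using (Vector)
import Data.Vec.Membership.Propositional as VecMembership
open import Function.Bundles using (_⇔_)
open import Relation.Binary.Construct.Closure.ReflexiveTransitive using (Star)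
open import Relation.Binary.PropositionalEquality using (_≡_; _≢_; sym)
open import Relation.Binary.Structures using (IsTotalOrder)
open import Relation.Nullary.Decidable using (¬?)
open import Relation.Nullary.Negation using (¬_)

------------------------------------------------------------------------
-- Signatures and structures

record Signature : Set where
  field
    symbols : ℕ
    arity   : Vector ℕ symbols

  Symbol : Set
  Symbol = Fin symbols

open Signature public

-- Universes are nonempty.  Relations are Bool-valued so that, without
-- excluded middle, they range over exactly the classical relations.
record Structure (σ : Signature) : Set where
  field
    size-1 : ℕ

  Universe : Set
  Universe = Fin (suc size-1)

  field
    interp : (R : Symbol σ) → Vec Universe (arity σ R) → Bool

open Structure public

-- σ ∪ {≤}: the symbol zero is ≤, the symbols suc R are those of σ.
_∪≤ : Signature → Signature
(σ ∪≤) .symbols = suc (symbols σ)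
(σ ∪≤) .arity   = 2 Vector.∷ arity σ

record LinearOrder (A : Set) : Set where
  field
    _≼_          : A → A → Bool
    isTotalOrder : IsTotalOrder _≡_ (λ x y → T (x ≼ y))

expand : ∀ {σ} (𝔄 : Structure σ) → LinearOrder (Universe 𝔄) → Structure (σ ∪≤)
expand 𝔄 ≼ .size-1 = size-1 𝔄
expand 𝔄 ≼ .interp zero    (x ∷ y ∷ []) = LinearOrder._≼_ ≼ x y
expand 𝔄 ≼ .interp (suc R) xs           = interp 𝔄 R xs

------------------------------------------------------------------------
-- Monadic second-order logic

-- MSO σ m k: formulas with m free element variables and k free set
-- variables, both as de Bruijn indices.
data MSO (σ : Signature) (m k : ℕ) : Set where
  rel  : (R : Symbol σ) → Vec (Fin m) (arity σ R) → MSO σ m k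
  _≐_  : Fin m → Fin m → MSO σ m k
  _∈′_ : Fin m → Fin k → MSO σ m k
  ¬′_  : MSO σ m k → MSO σ m k
  _∧′_ : MSO σ m k → MSO σ m k → MSO σ m k
  _∨′_ : MSO σ m k → MSO σ m k → MSO σ m k
  ∃₁   : MSO σ (suc m) k → MSO σ m k
  ∀₁   : MSO σ (suc m) k → MSO σ m k
  ∃₂   : MSO σ m (suc k) → MSO σ m k
  ∀₂   : MSO σ m (suc k) → MSO σ m k

MSO-Sentence : Signature → Set
MSO-Sentence σ = MSO σ 0 0

MSO-Sat : ∀ {σ m k} (𝔄 : Structure σ) →
          Vec (Universe 𝔄) m → Vec (Subset (suc (size-1 𝔄))) k →
          MSO σ m k → Set
MSO-Sat 𝔄 ρ Θ (rel R xs) = T (interp 𝔄 R (Vec.map (lookup ρ) xs))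
MSO-Sat 𝔄 ρ Θ (x ≐ y)    = lookup ρ x ≡ lookup ρ y
MSO-Sat 𝔄 ρ Θ (x ∈′ X)   = lookup ρ x ∈ lookup Θ X
MSO-Sat 𝔄 ρ Θ (¬′ φ)     = ¬ MSO-Sat 𝔄 ρ Θ φ
MSO-Sat 𝔄 ρ Θ (φ ∧′ ψ)   = MSO-Sat 𝔄 ρ Θ φ × MSO-Sat 𝔄 ρ Θ ψ
MSO-Sat 𝔄 ρ Θ (φ ∨′ ψ)   = MSO-Sat 𝔄 ρ Θ φ ⊎ MSO-Sat 𝔄 ρ Θ ψ
MSO-Sat 𝔄 ρ Θ (∃₁ φ)     = ∃[ a ] MSO-Sat 𝔄 (a ∷ ρ) Θ φ
MSO-Sat 𝔄 ρ Θ (∀₁ φ)     = ∀ a → MSO-Sat 𝔄 (a ∷ ρ) Θ φ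
MSO-Sat 𝔄 ρ Θ (∃₂ φ)     = ∃[ A ] MSO-Sat 𝔄 ρ (A ∷ Θ) φ
MSO-Sat 𝔄 ρ Θ (∀₂ φ)     = ∀ A → MSO-Sat 𝔄 ρ (A ∷ Θ) φ

infix 4 _⊨MSO_ _⊨≤_ _⊨_

_⊨MSO_ : ∀ {σ} → Structure σ → MSO-Sentence σ → Set
𝔄 ⊨MSO φ = MSO-Sat 𝔄 [] [] φ

OrderInvariant : ∀ {σ} → MSO-Sentence (σ ∪≤) → Set
OrderInvariant {σ} φ =
  (𝔄 : Structure σ) (≼₁ ≼₂ : LinearOrder (Universe 𝔄)) →
  expand 𝔄 ≼₁ ⊨MSO φ ⇔ expand 𝔄 ≼₂ ⊨MSO φ

_⊨≤_ : ∀ {σ} → Structure σ → MSO-Sentence (σ ∪≤) → Set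
𝔄 ⊨≤ φ = ∃[ ≼ ] expand 𝔄 ≼ ⊨MSO φ

------------------------------------------------------------------------
-- First-order logic with modulo-counting quantifiers

data FO+MOD (σ : Signature) (m : ℕ) : Set where
  rel  : (R : Symbol σ) → Vec (Fin m) (arity σ R) → FO+MOD σ m
  _≐_  : Fin m → Fin m → FO+MOD σ m
  ¬′_  : FO+MOD σ m → FO+MOD σ m
  _∧′_ : FO+MOD σ m → FO+MOD σ m → FO+MOD σ m
  _∨′_ : FO+MOD σ m → FO+MOD σ m → FO+MOD σ m
  ∃₁   : FO+MOD σ (suc m) → FO+MOD σ m
  ∀₁   : FO+MOD σ (suc m) → FO+MOD σ m
  ∃mod : (i p : ℕ) .{{_ : NonZero p}} → FO+MOD σ (suc m) → FO+MOD σ m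

FO+MOD-Sentence : Signature → Set
FO+MOD-Sentence σ = FO+MOD σ 0

FO+MOD-Sat : ∀ {σ m} (𝔄 : Structure σ) → Vec (Universe 𝔄) m → FO+MOD σ m → Set
FO+MOD-Sat 𝔄 ρ (rel R xs)   = T (interp 𝔄 R (Vec.map (lookup ρ) xs))
FO+MOD-Sat 𝔄 ρ (x ≐ y)      = lookup ρ x ≡ lookup ρ y
FO+MOD-Sat 𝔄 ρ (¬′ φ)       = ¬ FO+MOD-Sat 𝔄 ρ φ
FO+MOD-Sat 𝔄 ρ (φ ∧′ ψ)     = FO+MOD-Sat 𝔄 ρ φ × FO+MOD-Sat 𝔄 ρ ψ
FO+MOD-Sat 𝔄 ρ (φ ∨′ ψ)     = FO+MOD-Sat 𝔄 ρ φ ⊎ FO+MOD-Sat 𝔄 ρ ψ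
FO+MOD-Sat 𝔄 ρ (∃₁ φ)       = ∃[ a ] FO+MOD-Sat 𝔄 (a ∷ ρ) φ
FO+MOD-Sat 𝔄 ρ (∀₁ φ)       = ∀ a → FO+MOD-Sat 𝔄 (a ∷ ρ) φ
-- B is the (unique) set of all elements satisfying φ.
FO+MOD-Sat 𝔄 ρ (∃mod i p φ) =
  Σ (Subset (suc (size-1 𝔄))) λ B →
    (∀ b → b ∈ B ⇔ FO+MOD-Sat 𝔄 (b ∷ ρ) φ) × ∣ B ∣ % p ≡ i % p

_⊨_ : ∀ {σ} → Structure σ → FO+MOD-Sentence σ → Set
𝔄 ⊨ ψ = FO+MOD-Sat 𝔄 [] ψ

------------------------------------------------------------------------
-- Quantifier alternation depth

-- FO+MOD formulas in negation normal form; a literal with polarity false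
-- is a negated atom, and ⊥′ is the empty disjunction.
data NNF (σ : Signature) (m : ℕ) : Set where
  rel  : (polarity : Bool) (R : Symbol σ) → Vec (Fin m) (arity σ R) → NNF σ m
  eq   : (polarity : Bool) → Fin m → Fin m → NNF σ m
  ⊥′   : NNF σ m
  _∧′_ : NNF σ m → NNF σ m → NNF σ m
  _∨′_ : NNF σ m → NNF σ m → NNF σ m
  ∃₁   : NNF σ (suc m) → NNF σ m
  ∀₁   : NNF σ (suc m) → NNF σ m
  ∃mod : (i p : ℕ) .{{_ : NonZero p}} → NNF σ (suc m) → NNF σ m

⋁ : ∀ {σ m} → List (NNF σ m) → NNF σ m
⋁ = foldr _∨′_ ⊥′

-- nnf true φ is equivalent to φ and nnf false φ to its negation.  A negated
-- ∃^{i (mod p)} becomes the disjunction over the other residues modulo p.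
nnf : ∀ {σ m} → Bool → FO+MOD σ m → NNF σ m
nnf b     (rel R xs)   = rel b R xs
nnf b     (x ≐ y)      = eq b x y
nnf true  (¬′ φ)       = nnf false φ
nnf false (¬′ φ)       = nnf true φ
nnf true  (φ ∧′ ψ)     = nnf true φ ∧′ nnf true ψ
nnf false (φ ∧′ ψ)     = nnf false φ ∨′ nnf false ψ
nnf true  (φ ∨′ ψ)     = nnf true φ ∨′ nnf true ψ
nnf false (φ ∨′ ψ)     = nnf false φ ∧′ nnf false ψ
nnf true  (∃₁ φ)       = ∃₁ (nnf true φ)
nnf false (∃₁ φ)       = ∀₁ (nnf false φ)
nnf true  (∀₁ φ)       = ∀₁ (nnf true φ)
nnf false (∀₁ φ)       = ∃₁ (nnf false φ)
nnf true  (∃mod i p φ) = ∃mod i p (nnf true φ)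
nnf false (∃mod i p φ) =
  ⋁ (map (λ j → ∃mod j p (nnf true φ)) (filter (λ j → ¬? (j ≟ i % p)) (upTo p)))

-- The last of the quantifiers ∃ and ∀ met on a path from the root.
data Last : Set where
  none ∃-last ∀-last : Last

-- Modulo-counting quantifiers are neither ∃- nor ∀-quantifiers, so they do
-- not take part in alternations.
alternations : ∀ {σ m} → Last → NNF σ m → ℕ
alternations l      (rel _ _ _)  = 0
alternations l      (eq _ _ _)   = 0
alternations l      ⊥′           = 0
alternations l      (φ ∧′ ψ)     = alternations l φ ⊔ alternations l ψ
alternations l      (φ ∨′ ψ)     = alternations l φ ⊔ alternations l ψ
alternations ∀-last (∃₁ φ)       = suc (alternations ∃-last φ)
alternations _      (∃₁ φ)       = alternations ∃-last φ
alternations ∃-last (∀₁ φ)       = suc (alternations ∀-last φ)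
alternations _      (∀₁ φ)       = alternations ∀-last φ
alternations l      (∃mod _ _ φ) = alternations l φ

qad : ∀ {σ m} → FO+MOD σ m → ℕ
qad φ = alternations none (nnf true φ)

------------------------------------------------------------------------
-- Tree-depth

record SimpleGraph (n : ℕ) : Set₁ where
  field
    Adj     : Fin n → Fin n → Set
    adj-sym : ∀ {x y} → Adj x y → Adj y x
    irrefl  : ∀ {x} → ¬ Adj x x

module _ {n : ℕ} (G : SimpleGraph n) where
  open SimpleGraph G

  -- A subset S of the vertices stands for the subgraph induced on S.
  Reachable : Subset n → Fin n → Fin n → Set
  Reachable S = Star (λ x y → x ∈ S × y ∈ S × Adj x y)

  Connected : Subset n → Set
  Connected S = ∀ x y → x ∈ S → y ∈ S → Reachable S x y

  Component : Subset n → Subset n → Set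
  Component S K = ∃[ x ] x ∈ S × (∀ y → y ∈ K ⇔ Reachable S x y)

  -- TreeDepth S k: the tree-depth of the subgraph induced on S is k.  In the
  -- last two cases, t assigns tree-depths to the smaller subgraphs and k is
  -- the minimum, respectively maximum, of its values.
  data TreeDepth (S : Subset n) : ℕ → Set where
    single       : ∣ S ∣ ≡ 1 → TreeDepth S 1
    connected    : ∀ {k} → 1 < ∣ S ∣ → Connected S →
                   (t : Fin n → ℕ) →
                   (∀ r → r ∈ S → TreeDepth (S - r) (t r)) →
                   (∀ r → r ∈ S → k ≤ t r) →
                   (∃[ r ] r ∈ S × t r ≡ k) →
                   TreeDepth S (1 + k)
    disconnected : ∀ {k} → ¬ Connected S →
                   (t : Subset n → ℕ) →
                   (∀ K → Component S K → TreeDepth K (t K)) →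
                   (∀ K → Component S K → t K ≤ k) →
                   (∃[ K ] Component S K × t K ≡ k) →
                   TreeDepth S k

gaifman : ∀ {σ} (𝔄 : Structure σ) → SimpleGraph (suc (size-1 𝔄))
gaifman {σ} 𝔄 = record
  { Adj     = λ x y → x ≢ y ×
                (∃[ R ] Σ (Vec (Universe 𝔄) (arity σ R)) λ xs →
                   T (interp 𝔄 R xs) × x ∈ᵛ xs × y ∈ᵛ xs)
  ; adj-sym = λ (x≢y , R , xs , h , x∈ , y∈) → (λ e → x≢y (sym e)) , R , xs , h , y∈ , x∈
  ; irrefl  = λ (x≢x , _) → x≢x _≡_.refl
  }
  where open VecMembership using () renaming (_∈_ to _∈ᵛ_)

-- 𝔄 ∈Fin d: 𝔄 belongs to the class Fin_{σ,d}.
_∈Fin_ : ∀ {σ} → Structure σ → ℕ → Set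
𝔄 ∈Fin d = ∃[ k ] TreeDepth (gaifman 𝔄) ⊤ k × k ≤ d

{-# OPTIONS --safe #-}

-- By order invariance, φ may be evaluated on any linear order.  Fix an elimination forest of height
-- at most d and order the universe by preorder: an MSO sentence is then recognized by a finite
-- algebra on ordered forests, whose letters describe the relations among the vertices of a root
-- path.  For each component, choose as root a vertex whose removal lowers the tree-depth and whose
-- tree has the least type among these vertices; sort the resulting trees by type.  The state of the
-- resulting forest depends only on the number of components of each type, up to a threshold and
-- modulo a period.  Components are counted through their roots: a component of bounded tree-depth
-- contains a bounded-size obstruction to smaller depth, which every root must hit, so the number of
-- roots of minimal type is bounded, and it is known modulo this bound.  Modulo quantifiers cost no
-- alternation, so each level of the forest adds two alternations (the definition of tree-depth at
-- most k by ∃ root ∀ vertex, and the threshold quantifiers), and the sentence has at most 2d + 1.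
module Submission where

open import Defs
open import Data.Bool.Base using (Bool; true; false; T; not; _∧_; _∨_)
open import Data.Bool.ListAction using (any)
open import Data.Bool.Properties using (T?; T-∧; T-∨; T-≡; T-not-≡)
import Data.Bool.Properties as Bool
open import Data.Bool.Solver using (module ∨-∧-Solver)
open import Data.Empty using (⊥)
open import Data.Fin.Base as Fin using (Fin; zero; suc; toℕ; fromℕ<; combine; remQuot; _↑ˡ_; _↑ʳ_)
open import Data.Fin.Properties using (⊎⇔∃; ∀-cons-⇔; toℕ-fromℕ<; toℕ<n; remQuot-combine)
import Data.Fin.Properties as Fin
open import Data.Fin.Subset as Subset using (Subset; _∈_; ∣_∣; _-_; ⁅_⁆; ⊤)
open import Data.Fin.Subset.Properties as Subset using (_∈?_; ∈⊤; p─⊥≡p; x∈⁅x⁆; x∈⁅y⁆⇒x≡y; x∈p∧x≢y⇒x∈p-y; ⊆-antisym)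
open import Data.List.Base as List using (List; []; _∷_; _++_; length; map; filter; upTo; allFin; foldl; concatMap; cartesianProduct; cartesianProductWith)
import Data.List.Membership.DecPropositional as DecMembership
open import Data.List.Membership.Propositional using (find; lose) renaming (_∈_ to _∈ˡ_)
open import Data.List.Membership.Propositional.Properties using (∈-allFin; ∈-++⁺ˡ; ∈-++⁺ʳ; ∈-++⁻; ∈-map⁺; ∈-concatMap⁺; ∈-cartesianProduct⁺; ∈-cartesianProductWith⁺)
open import Data.List.Properties using (length-++)
open import Data.List.Relation.Binary.Disjoint.Propositional using (Disjoint)
open import Data.List.Relation.Unary.All as All using (All; []; _∷_)
import Data.List.Relation.Unary.All.Properties as All
open import Data.List.Relation.Unary.AllPairs using (AllPairs; []; _∷_)
open import Data.List.Relation.Unary.Any as Any using (here; there; index)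
open import Data.List.Relation.Unary.Any.Properties using (any⁺; any⁻; lookup-index)
open import Data.List.Relation.Unary.Unique.Propositional using (Unique)
open import Data.List.Relation.Unary.Unique.Propositional.Properties using (++⁺; allFin⁺; cartesianProduct⁺)
open import Data.Nat.Base as ℕ hiding (∣_-_∣)
open import Data.Nat.Divisibility using (_∣_; divides; m≤n⇒m!∣n!; ∣-trans; n∣m*n; m∣m*n)
open import Data.Nat.DivMod
open import Data.Nat.GeneralisedArithmetic using (fold; fold-+)
open import Data.Nat.Properties as ℕ hiding (_≟_)
open import Data.Product.Base using (Σ; ∃; ∃-syntax; _×_; _,_; proj₁; proj₂)
open import Data.Product.Function.NonDependent.Propositional using (_×-⇔_)
open import Data.Sum.Base as Sum using (_⊎_; inj₁; inj₂; [_,_]′)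
open import Data.Sum.Function.Propositional using (_⊎-⇔_)
open import Data.Unit.Base using (tt) renaming (⊤ to Unit)
open import Data.Vec.Base as Vec using (Vec; []; _∷_; lookup; head; _[_]≔_; here; there)
open import Data.Vec.Membership.Propositional using () renaming (_∈_ to _∈ᵛ_)
open import Data.Vec.Properties as Vec using ([]=⇒lookup; lookup⇒[]=; lookup-map; lookup-++ˡ; lookup-++ʳ; lookup∘tabulate; lookup∘update; lookup∘update′; map-∘; map-cong; map-lookup-allFin)
import Data.Vec.Relation.Unary.Any as VecAny
import Data.Vec.Relation.Unary.Any.Properties as VecAny
open import Function.Base using (_∘_; id)
open import Function.Bundles using (_⇔_; mk⇔; Equivalence)
open import Function.Construct.Composition using (_⇔-∘_)
open import Function.Construct.Identity using (⇔-id)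
open import Function.Construct.Symmetry using (⇔-sym)
open import Relation.Binary.Construct.Closure.ReflexiveTransitive as Star using (Star; ε; _◅_; _◅◅_)
open import Relation.Binary.Definitions using (tri<; tri≈; tri>)
open import Relation.Binary.PropositionalEquality
open import Relation.Nullary.Decidable using (Dec; yes; no; does; ¬?; _×-dec_; _⊎-dec_; _→-dec_; map′; dec-true; decidable-stable)
open import Relation.Nullary.Negation using (¬_; contradiction)

open Equivalence using (to; from)

-- No formula can select one root in each component, since automorphisms may exchange the
-- candidates. So all roots of the least type are counted, and the count is divided by the number
-- `suc μ` of such roots per component. This is why the components are sorted into kinds `(μ , t)`
-- and not by `t` alone. The multiplicity is read off a modulo quantifier: it is tested underneath
-- the threshold that counts the roots, where another threshold would add an alternation at each
-- level.
--
-- The state `value` is defined by recursion from these counts alone, without mentioning a forest.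
-- Its definability is therefore a recursion over formulas, and choices such as one root per
-- component are made only in the separate proof that some elimination forest attains it. Height at
-- most `d` also bounds the length of root paths, so that a finite alphabet can describe a whole
-- path. All predicates involved are decidable, as excluded middle is not assumed.

comprehension : ∀ {n} {P : Fin n → Set} → (∀ x → Dec (P x)) → Subset n
comprehension P? = Vec.tabulate (does ∘ P?)

∈-comprehension : ∀ {n} {P : Fin n → Set} (P? : ∀ x → Dec (P x)) x →
                  x ∈ comprehension P? ⇔ P x
∈-comprehension {P = P} P? x = mk⇔ ⇒ ⇐
  where
  ⇒ : x ∈ comprehension P? → P x
  ⇒ x∈ with P? x | trans (sym (lookup∘tabulate (does ∘ P?) x)) ([]=⇒lookup x∈)
  ... | yes p | _ = p
  ⇐ : P x → x ∈ comprehension P?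
  ⇐ p = lookup⇒[]= x _ (trans (lookup∘tabulate (does ∘ P?) x) (dec-true (P? x) p))

count : ∀ {n} {P : Fin n → Set} → (∀ x → Dec (P x)) → ℕ
count P? = ∣ comprehension P? ∣

comprehension-cong : ∀ {n} {P Q : Fin n → Set} (P? : ∀ x → Dec (P x)) (Q? : ∀ x → Dec (Q x)) →
                     (∀ x → P x ⇔ Q x) → comprehension P? ≡ comprehension Q?
comprehension-cong P? Q? P⇔Q = ⊆-antisym
  (λ {x} → from (∈-comprehension Q? x) ∘ to (P⇔Q x) ∘ to (∈-comprehension P? x))
  (λ {x} → from (∈-comprehension P? x) ∘ from (P⇔Q x) ∘ to (∈-comprehension Q? x))

-- Alternation bounds

module _ {σ : Signature} where

  -- Both polarities and every preceding quantifier are covered, so the class is closed under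
  -- Boolean combinations and modulo quantifiers in any context; only ∃ and ∀ can leave it.
  Alternates≤ : ∀ {m} → ℕ → FO+MOD σ m → Set
  Alternates≤ N φ = ∀ l b → alternations l (nnf b φ) ≤ N

  -- Existential≤ N is the class ∃*(Alternates≤ N), also closed under ∧ and ∨.
  Existential≤ : ∀ {m} → ℕ → FO+MOD σ m → Set
  Existential≤ N φ = alternations ∃-last (nnf true φ) ≤ N × alternations ∀-last (nnf false φ) ≤ N

  -- The context matters only at the first ∃ or ∀ of each path, where it decides whether one more
  -- alternation is counted.
  alternations-change : ∀ {m} l l′ (φ : NNF σ m) → alternations l φ ≤ suc (alternations l′ φ)
  alternations-change l l′ (rel _ _ _) = z≤n
  alternations-change l l′ (eq _ _ _) = z≤n
  alternations-change l l′ ⊥′ = z≤n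
  alternations-change l l′ (φ ∧′ ψ) = ⊔-mono-≤ (alternations-change l l′ φ) (alternations-change l l′ ψ)
  alternations-change l l′ (φ ∨′ ψ) = ⊔-mono-≤ (alternations-change l l′ φ) (alternations-change l l′ ψ)
  alternations-change none   none   (∃₁ φ) = n≤1+n _
  alternations-change none   ∃-last (∃₁ φ) = n≤1+n _
  alternations-change none   ∀-last (∃₁ φ) = ≤-trans (n≤1+n _) (n≤1+n _)
  alternations-change ∃-last none   (∃₁ φ) = n≤1+n _
  alternations-change ∃-last ∃-last (∃₁ φ) = n≤1+n _
  alternations-change ∃-last ∀-last (∃₁ φ) = ≤-trans (n≤1+n _) (n≤1+n _)
  alternations-change ∀-last none   (∃₁ φ) = ≤-refl
  alternations-change ∀-last ∃-last (∃₁ φ) = ≤-refl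
  alternations-change ∀-last ∀-last (∃₁ φ) = n≤1+n _
  alternations-change none   none   (∀₁ φ) = n≤1+n _
  alternations-change none   ∀-last (∀₁ φ) = n≤1+n _
  alternations-change none   ∃-last (∀₁ φ) = ≤-trans (n≤1+n _) (n≤1+n _)
  alternations-change ∀-last none   (∀₁ φ) = n≤1+n _
  alternations-change ∀-last ∀-last (∀₁ φ) = n≤1+n _
  alternations-change ∀-last ∃-last (∀₁ φ) = ≤-trans (n≤1+n _) (n≤1+n _)
  alternations-change ∃-last none   (∀₁ φ) = ≤-refl
  alternations-change ∃-last ∀-last (∀₁ φ) = ≤-refl
  alternations-change ∃-last ∃-last (∀₁ φ) = n≤1+n _
  alternations-change l l′ (∃mod i p φ) = alternations-change l l′ φ

  Alternates⇒Existential : ∀ {m N} (φ : FO+MOD σ m) → Alternates≤ N φ → Existential≤ N φ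
  Alternates⇒Existential _ h = h ∃-last true , h ∀-last false

  Existential⇒Alternates : ∀ {m N} (φ : FO+MOD σ m) → Existential≤ N φ → Alternates≤ (suc N) φ
  Existential⇒Alternates φ (h , _) l true  = ≤-trans (alternations-change l ∃-last (nnf true φ)) (s≤s h)
  Existential⇒Alternates φ (_ , h) l false = ≤-trans (alternations-change l ∀-last (nnf false φ)) (s≤s h)

  ∀₁-Alternates : ∀ {m N} {φ : FO+MOD σ (suc m)} → Alternates≤ N φ → Alternates≤ (suc N) (∀₁ φ)
  ∀₁-Alternates h none   true  = m≤n⇒m≤1+n (h _ _)
  ∀₁-Alternates h ∃-last true  = s≤s (h _ _)
  ∀₁-Alternates h ∀-last true  = m≤n⇒m≤1+n (h _ _)
  ∀₁-Alternates h none   false = m≤n⇒m≤1+n (h _ _)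
  ∀₁-Alternates h ∃-last false = m≤n⇒m≤1+n (h _ _)
  ∀₁-Alternates h ∀-last false = s≤s (h _ _)

  ∃mod-Alternates : ∀ {m N} i p .{{_ : NonZero p}} {φ : FO+MOD σ (suc m)} →
                    Alternates≤ N φ → Alternates≤ N (∃mod i p φ)
  ∃mod-Alternates i p h l true  = h l true
  ∃mod-Alternates {N = N} i p {φ} h l false = disjuncts (filter (λ j → ¬? (j ℕ.≟ i % p)) (upTo p))
    where
    disjuncts : ∀ js → alternations l (⋁ (map (λ j → ∃mod j p (nnf true φ)) js)) ≤ N
    disjuncts []       = z≤n
    disjuncts (j ∷ js) = ⊔-lub (h l true) (disjuncts js)

-- Families of formulas, uniform in the variables that they are applied to

-- The correctness of formulas is only required on a class of structures.
module Definability (σ : Signature) (Class : Structure σ → Set) where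

  record Model : Set where
    constructor _,_
    field
      structure : Structure σ
      member    : Class structure

  open Model public

  ∣_∣ᴹ : Model → Set
  ∣ M ∣ᴹ = Universe (structure M)

  Relation : ℕ → Set₁
  Relation j = (M : Model) → Vec ∣ M ∣ᴹ j → Set

  -- The variables are an argument of `formula`, for every number `m` of variables in scope.
  -- Substitution is thus application, and a quantifier shifts the arguments by `suc`; no syntax is
  -- ever renamed.
  record DefinableIn (Bound : ∀ {m} → FO+MOD σ m → Set) (j : ℕ) (P : Relation j) : Set where
    field
      formula : ∀ {m} → Vec (Fin m) j → FO+MOD σ m
      bound   : ∀ {m} (xs : Vec (Fin m) j) → Bound (formula xs)
      correct : ∀ M {m} (ρ : Vec ∣ M ∣ᴹ m) xs →
                FO+MOD-Sat (structure M) ρ (formula xs) ⇔ P M (Vec.map (lookup ρ) xs)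

  open DefinableIn public

  Definable ∃-Definable : ℕ → (j : ℕ) → Relation j → Set
  Definable N = DefinableIn (Alternates≤ N)
  ∃-Definable N = DefinableIn (Existential≤ N)

  convert : ∀ {B : ∀ {m} → FO+MOD σ m → Set} {j} {P Q : Relation j} →
            (∀ M as → P M as ⇔ Q M as) → DefinableIn B j P → DefinableIn B j Q
  convert P⇔Q φ .formula = φ .formula
  convert P⇔Q φ .bound = φ .bound
  convert P⇔Q φ .correct M ρ xs = P⇔Q M _ ⇔-∘ φ .correct M ρ xs

  reindex : ∀ {B : ∀ {m} → FO+MOD σ m → Set} {i j} {P : Relation i}
            (f : ∀ {A : Set} → Vec A j → Vec A i) →
            (∀ {A B : Set} (g : A → B) xs → Vec.map g (f xs) ≡ f (Vec.map g xs)) →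
            DefinableIn B i P → DefinableIn B j (λ M as → P M (f as))
  reindex f nat φ .formula xs = φ .formula (f xs)
  reindex f nat φ .bound xs = φ .bound (f xs)
  reindex {P = P} f nat φ .correct M ρ xs =
    subst (λ as → FO+MOD-Sat (structure M) ρ (φ .formula (f xs)) ⇔ P M as) (nat (lookup ρ) xs)
      (φ .correct M ρ (f xs))

  weaken : ∀ {N N′ j} {P : Relation j} → N ≤ N′ → Definable N j P → Definable N′ j P
  weaken N≤N′ φ .formula = φ .formula
  weaken N≤N′ φ .bound xs l b = ≤-trans (φ .bound xs l b) N≤N′
  weaken N≤N′ φ .correct = φ .correct

  existential : ∀ {N j} {P : Relation j} → Definable N j P → ∃-Definable N j P
  existential φ .formula = φ .formula
  existential φ .bound xs = Alternates⇒Existential (φ .formula xs) (φ .bound xs)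
  existential φ .correct = φ .correct

  alternating : ∀ {N j} {P : Relation j} → ∃-Definable N j P → Definable (suc N) j P
  alternating φ .formula = φ .formula
  alternating φ .bound xs = Existential⇒Alternates (φ .formula xs) (φ .bound xs)
  alternating φ .correct = φ .correct

  module _ {N j : ℕ} where

    infixr 6 _∧ᵈ_ _∧ᵉ_
    infixr 5 _∨ᵈ_ _∨ᵉ_

    ¬ᵈ_ : ∀ {P : Relation j} → Definable N j P → Definable N j (λ M as → ¬ P M as)
    (¬ᵈ φ) .formula xs = ¬′ φ .formula xs
    (¬ᵈ φ) .bound xs l true = φ .bound xs l false
    (¬ᵈ φ) .bound xs l false = φ .bound xs l true
    (¬ᵈ φ) .correct M ρ xs = mk⇔ (_∘ from (φ .correct M ρ xs)) (_∘ to (φ .correct M ρ xs))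

    _∧ᵈ_ : ∀ {P Q : Relation j} → Definable N j P → Definable N j Q →
           Definable N j (λ M as → P M as × Q M as)
    (φ ∧ᵈ ψ) .formula xs = φ .formula xs ∧′ ψ .formula xs
    (φ ∧ᵈ ψ) .bound xs l true = ⊔-lub (φ .bound xs l true) (ψ .bound xs l true)
    (φ ∧ᵈ ψ) .bound xs l false = ⊔-lub (φ .bound xs l false) (ψ .bound xs l false)
    (φ ∧ᵈ ψ) .correct M ρ xs = φ .correct M ρ xs ×-⇔ ψ .correct M ρ xs

    _∨ᵈ_ : ∀ {P Q : Relation j} → Definable N j P → Definable N j Q →
           Definable N j (λ M as → P M as ⊎ Q M as)
    (φ ∨ᵈ ψ) .formula xs = φ .formula xs ∨′ ψ .formula xs
    (φ ∨ᵈ ψ) .bound xs l true = ⊔-lub (φ .bound xs l true) (ψ .bound xs l true)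
    (φ ∨ᵈ ψ) .bound xs l false = ⊔-lub (φ .bound xs l false) (ψ .bound xs l false)
    (φ ∨ᵈ ψ) .correct M ρ xs = φ .correct M ρ xs ⊎-⇔ ψ .correct M ρ xs

    _∧ᵉ_ : ∀ {P Q : Relation j} → ∃-Definable N j P → ∃-Definable N j Q →
           ∃-Definable N j (λ M as → P M as × Q M as)
    (φ ∧ᵉ ψ) .formula xs = φ .formula xs ∧′ ψ .formula xs
    (φ ∧ᵉ ψ) .bound xs = ⊔-lub (proj₁ (φ .bound xs)) (proj₁ (ψ .bound xs)) ,
                         ⊔-lub (proj₂ (φ .bound xs)) (proj₂ (ψ .bound xs))
    (φ ∧ᵉ ψ) .correct M ρ xs = φ .correct M ρ xs ×-⇔ ψ .correct M ρ xs

    _∨ᵉ_ : ∀ {P Q : Relation j} → ∃-Definable N j P → ∃-Definable N j Q →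
           ∃-Definable N j (λ M as → P M as ⊎ Q M as)
    (φ ∨ᵉ ψ) .formula xs = φ .formula xs ∨′ ψ .formula xs
    (φ ∨ᵉ ψ) .bound xs = ⊔-lub (proj₁ (φ .bound xs)) (proj₁ (ψ .bound xs)) ,
                         ⊔-lub (proj₂ (φ .bound xs)) (proj₂ (ψ .bound xs))
    (φ ∨ᵉ ψ) .correct M ρ xs = φ .correct M ρ xs ⊎-⇔ ψ .correct M ρ xs

    implᵈ : ∀ {P Q : Relation j} → (∀ M as → Dec (P M as)) → Definable N j P → Definable N j Q →
            Definable N j (λ M as → P M as → Q M as)
    implᵈ {P} {Q} P? φ ψ = convert (λ M as → mk⇔ ⇒ (⇐ M as)) (¬ᵈ φ ∨ᵈ ψ)
      where
      ⇒ : ∀ {M as} → ¬ P M as ⊎ Q M as → P M as → Q M as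
      ⇒ (inj₁ ¬p) p = contradiction p ¬p
      ⇒ (inj₂ q)  _ = q
      ⇐ : ∀ M as → (P M as → Q M as) → ¬ P M as ⊎ Q M as
      ⇐ M as f with P? M as
      ... | yes p = inj₂ (f p)
      ... | no ¬p = inj₁ ¬p

    module _ {P : Relation (suc j)} where

      private
        under : ∀ {B : ∀ {m} → FO+MOD σ m → Set} (φ : DefinableIn B (suc j) P)
                M {m} (ρ : Vec ∣ M ∣ᴹ m) xs a →
                FO+MOD-Sat (structure M) (a ∷ ρ) (φ .formula (zero ∷ Vec.map suc xs)) ⇔
                P M (a ∷ Vec.map (lookup ρ) xs)
        under φ M ρ xs a =
          subst (λ as → FO+MOD-Sat (structure M) (a ∷ ρ) (φ .formula (zero ∷ Vec.map suc xs)) ⇔ P M (a ∷ as))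
            (sym (map-∘ (lookup (a ∷ ρ)) suc xs)) (φ .correct M (a ∷ ρ) (zero ∷ Vec.map suc xs))

      ∃ᵉ : ∃-Definable N (suc j) P → ∃-Definable N j (λ M as → ∃[ a ] P M (a ∷ as))
      ∃ᵉ φ .formula xs = ∃₁ (φ .formula (zero ∷ Vec.map suc xs))
      ∃ᵉ φ .bound xs = φ .bound (zero ∷ Vec.map suc xs)
      ∃ᵉ φ .correct M ρ xs = mk⇔ (λ (a , h) → a , to (under φ M ρ xs a) h)
                                 (λ (a , h) → a , from (under φ M ρ xs a) h)

      ∀ᵈ : Definable N (suc j) P → Definable (suc N) j (λ M as → ∀ a → P M (a ∷ as))
      ∀ᵈ φ .formula xs = ∀₁ (φ .formula (zero ∷ Vec.map suc xs))
      ∀ᵈ φ .bound xs = ∀₁-Alternates (φ .bound (zero ∷ Vec.map suc xs))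
      ∀ᵈ φ .correct M ρ xs = mk⇔ (λ h a → to (under φ M ρ xs a) (h a))
                                 (λ h a → from (under φ M ρ xs a) (h a))

      modᵈ : ∀ i p .{{_ : NonZero p}} → Definable N (suc j) P →
             (P? : ∀ M as a → Dec (P M (a ∷ as))) →
             Definable N j (λ M as → count (P? M as) % p ≡ i % p)
      modᵈ i p φ P? .formula xs = ∃mod i p (φ .formula (zero ∷ Vec.map suc xs))
      modᵈ i p φ P? .bound xs = ∃mod-Alternates i p (φ .bound (zero ∷ Vec.map suc xs))
      modᵈ i p φ P? .correct M ρ xs = mk⇔ ⇒ ⇐
        where
        as = Vec.map (lookup ρ) xs
        ⇒ : FO+MOD-Sat (structure M) ρ (modᵈ i p φ P? .formula xs) → count (P? M as) % p ≡ i % p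
        ⇒ (B , B⇔ , ∣B∣≡) = trans (cong (λ C → ∣ C ∣ % p) (⊆-antisym
          (λ {a} → from (B⇔ a) ∘ from (under φ M ρ xs a) ∘ to (∈-comprehension (P? M as) a))
          (λ {a} → from (∈-comprehension (P? M as) a) ∘ to (under φ M ρ xs a) ∘ to (B⇔ a)))) ∣B∣≡
        ⇐ : count (P? M as) % p ≡ i % p → FO+MOD-Sat (structure M) ρ (modᵈ i p φ P? .formula xs)
        ⇐ ∣P∣≡ = comprehension (P? M as) ,
               (λ a → ⇔-sym (under φ M ρ xs a) ⇔-∘ ∈-comprehension (P? M as) a) , ∣P∣≡

    -- With no variable in scope there is no equation to serve as truth. Every number is 0 modulo 1,
    -- so this quantifier holds for any body, and it costs no alternation.
    trueᵈ : Definable N j (λ _ _ → Unit)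
    trueᵈ .formula xs = ∃mod 0 1 (zero ≐ zero)
    trueᵈ .bound xs l true  = z≤n
    trueᵈ .bound xs l false = z≤n
    trueᵈ .correct M ρ xs = mk⇔ _
      (λ _ → Subset.⊤ , (λ b → mk⇔ (λ _ → refl) (λ _ → Subset.∈⊤)) , n%1≡0 ∣ Subset.⊤ {n = suc (size-1 (structure M))} ∣)

    constᵈ : ∀ {X : Set} → Dec X → Definable N j (λ _ _ → X)
    constᵈ (yes x) = convert (λ _ _ → mk⇔ (λ _ → x) _) trueᵈ
    constᵈ (no ¬x) = convert (λ _ _ → mk⇔ (λ h → contradiction _ h) (λ x _ → ¬x x)) (¬ᵈ trueᵈ)

    ∃ᶠ : ∀ {n} {P : Fin n → Relation j} → (∀ i → Definable N j (P i)) →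
         Definable N j (λ M as → ∃[ i ] P i M as)
    ∃ᶠ {zero}  φ = convert (λ _ _ → mk⇔ (λ h → contradiction _ h) λ ()) (¬ᵈ trueᵈ)
    ∃ᶠ {suc n} φ = convert (λ _ _ → ⊎⇔∃) (φ zero ∨ᵈ ∃ᶠ (φ ∘ suc))

    ∀ᶠ : ∀ {n} {P : Fin n → Relation j} → (∀ i → Definable N j (P i)) →
         Definable N j (λ M as → ∀ i → P i M as)
    ∀ᶠ {zero}  φ = convert (λ _ _ → mk⇔ (λ _ ()) _) trueᵈ
    ∀ᶠ {suc n} φ = convert (λ _ _ → ∀-cons-⇔) (φ zero ∧ᵈ ∀ᶠ (φ ∘ suc))

    eqᵈ : ∀ i i′ → Definable N j (λ M as → lookup as i ≡ lookup as i′)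
    eqᵈ i i′ .formula xs = lookup xs i ≐ lookup xs i′
    eqᵈ i i′ .bound xs l true  = z≤n
    eqᵈ i i′ .bound xs l false = z≤n
    eqᵈ i i′ .correct M ρ xs
      rewrite lookup-map i (lookup ρ) xs | lookup-map i′ (lookup ρ) xs = ⇔-id _

    relᵈ : ∀ R (is : Vec (Fin j) (arity σ R)) →
           Definable N j (λ M as → T (interp (structure M) R (Vec.map (lookup as) is)))
    relᵈ R is .formula xs = rel R (Vec.map (lookup xs) is)
    relᵈ R is .bound xs l true  = z≤n
    relᵈ R is .bound xs l false = z≤n
    relᵈ R is .correct M ρ xs =
      subst (λ bs → T (interp (structure M) R (Vec.map (lookup ρ) (Vec.map (lookup xs) is))) ⇔
                    T (interp (structure M) R bs))
        (trans (sym (map-∘ _ _ is)) (Vec.map-cong (λ i → sym (lookup-map i (lookup ρ) xs)) is))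
        (⇔-id _)

  ∃ᶠᵉ : ∀ {N j n} {P : Fin n → Relation j} → (∀ i → ∃-Definable N j (P i)) →
        ∃-Definable N j (λ M as → ∃[ i ] P i M as)
  ∃ᶠᵉ {n = zero}  φ = convert (λ _ _ → mk⇔ (λ h → contradiction _ h) λ ()) (existential (¬ᵈ trueᵈ))
  ∃ᶠᵉ {n = suc n} φ = convert (λ _ _ → ⊎⇔∃) (φ zero ∨ᵉ ∃ᶠᵉ (φ ∘ suc))

  ∃ᵉ* : ∀ {N j} n {P : Relation (n + j)} → ∃-Definable N (n + j) P →
        ∃-Definable N j (λ M as → ∃[ bs ] P M (bs Vec.++ as))
  ∃ᵉ* zero    φ = convert (λ _ _ → mk⇔ ([] ,_) λ { ([] , h) → h }) φ
  ∃ᵉ* (suc n) φ = convert (λ _ _ → mk⇔ (λ (bs , b , h) → b ∷ bs , h) λ { (b ∷ bs , h) → bs , b , h })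
                    (∃ᵉ* n (∃ᵉ φ))

-- Cardinalities of decidable sets and threshold counting

∣p∣≡1+∣p-x∣ : ∀ {n} {p : Subset n} {x} → x ∈ p → ∣ p ∣ ≡ suc ∣ p - x ∣
∣p∣≡1+∣p-x∣ {p = _ ∷ p} here = cong (suc ∘ ∣_∣) (sym (p─⊥≡p p))
∣p∣≡1+∣p-x∣ {p = true ∷ p} (there x∈p) = cong suc (∣p∣≡1+∣p-x∣ x∈p)
∣p∣≡1+∣p-x∣ {p = false ∷ p} (there x∈p) = ∣p∣≡1+∣p-x∣ x∈p

x∉p-x : ∀ {n} (p : Subset n) x → ¬ x ∈ p - x
x∉p-x (true  ∷ p) zero ()
x∉p-x (false ∷ p) zero ()
x∉p-x (_ ∷ p) (suc x) (there h) = x∉p-x p x h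

x∈p-y⁻ : ∀ {n} {p : Subset n} {x y} → x ∈ p - y → x ∈ p × x ≢ y
x∈p-y⁻ {p = p} {y = y} x∈ = Subset.p─q⊆p p _ x∈ , λ { refl → x∉p-x p y x∈ }

module _ {n} {P : Fin n → Set} (P? : ∀ x → Dec (P x)) where

  private
    _without_ : ∀ x y → Dec (P x × x ≢ y)
    x without y = P? x ×-dec ¬? (x Fin.≟ y)

  count-without : ∀ {x} → P x → count P? ≡ suc (count (_without x))
  count-without {x} p = trans (∣p∣≡1+∣p-x∣ (from (∈-comprehension P? x) p)) (cong (suc ∘ ∣_∣) (⊆-antisym
    (λ {y} h → from (∈-comprehension (_without x) y)
       (to (∈-comprehension P? y) (proj₁ (x∈p-y⁻ h)) , proj₂ (x∈p-y⁻ h)))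
    (λ {y} h → let (p′ , y≢x) = to (∈-comprehension (_without x) y) h in
       Subset.x∈p∧x≢y⇒x∈p-y (from (∈-comprehension P? y) p′) y≢x)))

  count>0⇒∃ : 0 < count P? → ∃ P
  count>0⇒∃ 0<c with Subset.nonempty? (comprehension P?)
  ... | yes (x , x∈) = x , to (∈-comprehension P? x) x∈
  ... | no empty rewrite Subset.Empty-unique empty | Subset.∣⊥∣≡0 n = contradiction 0<c λ ()

  1+c≤count : ∀ c → (∃[ x ] P x × c ≤ count (_without x)) ⇔ suc c ≤ count P?
  1+c≤count c = mk⇔
    (λ (x , p , c≤) → subst (suc c ≤_) (sym (count-without p)) (s≤s c≤))
    (λ c< → let (x , p) = count>0⇒∃ (≤-trans (s≤s z≤n) c<) in
       x , p , s≤s⁻¹ (subst (suc c ≤_) (count-without p) c<))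

-- Residue representatives for functions that are periodic from θ on.
representative : (θ π : ℕ) .{{_ : NonZero π}} → ℕ → ℕ
representative θ π n with n <? θ
... | yes _ = n
... | no  _ = θ * π + n % π

dropSecond : ∀ {A : Set} {j} → Vec A (suc (suc j)) → Vec A (suc j)
dropSecond (x ∷ _ ∷ xs) = x ∷ xs

dropSecond-map : ∀ {A B : Set} {j} (g : A → B) (xs : Vec A (suc (suc j))) →
                 Vec.map g (dropSecond xs) ≡ dropSecond (Vec.map g xs)
dropSecond-map g (x ∷ _ ∷ xs) = refl

module CountingDefinability (σ : Signature) (Class : Structure σ → Set) where

  open Definability σ Class

  module _ {N : ℕ} where

    -- Each witness is quantified in front of the threshold for the remaining ones, so no ∀
    -- separates the ∃ above the copies of `φ`: a single alternation, whatever `c` is.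
    atLeastᵉ : ∀ c {j} {P : Relation (suc j)} → Definable N (suc j) P →
               (P? : ∀ M as a → Dec (P M (a ∷ as))) →
               ∃-Definable N j (λ M as → c ≤ count (P? M as))
    atLeastᵉ zero φ P? = convert (λ _ _ → mk⇔ (λ _ → z≤n) _) (existential trueᵈ)
    atLeastᵉ (suc c) {j} {P} φ P? = convert (λ M as → 1+c≤count (P? M as) c)
      (∃ᵉ (existential φ ∧ᵉ convert {Q = R} (λ { M (b ∷ as) → ⇔-id _ })
        (atLeastᵉ c {P = Q} (reindex dropSecond dropSecond-map φ ∧ᵈ ¬ᵈ eqᵈ zero (suc zero)) Q?)))
      where
      Q : Relation (suc (suc j))
      Q M as = P M (dropSecond as) × lookup as zero ≢ lookup as (suc zero)
      R : Relation (suc j)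
      R M (b ∷ as) = c ≤ count (λ a → P? M as a ×-dec ¬? (a Fin.≟ b))
      Q? : ∀ M as a → Dec (Q M (a ∷ as))
      Q? M (b ∷ as) a = P? M as a ×-dec ¬? (a Fin.≟ b)

    -- `representative` takes finitely many values: exact ones below `θ`, told apart by thresholds,
    -- and residues from `θ` on. The continuation `Q` is already at level `suc N` and stands beside
    -- these tests, not under them, so that counts performed in succession do not accumulate
    -- alternations.
    countᵈ : ∀ θ π .{{_ : NonZero π}} {j} {P : Relation (suc j)} {Q : ℕ → Relation j} →
             Definable N (suc j) P → (P? : ∀ M as a → Dec (P M (a ∷ as))) →
             (∀ c → Definable (suc N) j (Q c)) →
             Definable (suc N) j (λ M as → Q (representative θ π (count (P? M as))) M as)
    countᵈ θ π {j} {P} {Q} φ P? ψ = convert (λ M as → mk⇔ ⇒ ⇐)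
      (∃ᶠ {n = θ} (λ c → (atLeast (toℕ c) ∧ᵈ ¬ᵈ atLeast (suc (toℕ c))) ∧ᵈ ψ (toℕ c)) ∨ᵈ
       (atLeast θ ∧ᵈ ∃ᶠ {n = π} (λ i → weaken (n≤1+n N) (modᵈ (toℕ i) π φ P?) ∧ᵈ ψ (θ * π + toℕ i))))
      where
      atLeast : ∀ c → Definable (suc N) j (λ M as → c ≤ count (P? M as))
      atLeast c = alternating (atLeastᵉ c φ P?)
      Cases : Relation j
      Cases M as = (∃[ c ] (toℕ {θ} c ≤ count (P? M as) × ¬ (suc (toℕ c) ≤ count (P? M as))) × Q (toℕ c) M as) ⊎
                   (θ ≤ count (P? M as) × (∃[ i ] count (P? M as) % π ≡ toℕ {π} i % π × Q (θ * π + toℕ i) M as))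
      ⇒ : ∀ {M as} → Cases M as → Q (representative θ π (count (P? M as))) M as
      ⇒ {M} {as} h with count (P? M as) <? θ | h
      ... | yes n<θ | inj₁ (c , (c≤ , c≮) , q) = subst (λ n → Q n M as) (≤-antisym c≤ (≮⇒≥ c≮)) q
      ... | yes n<θ | inj₂ (θ≤n , _) = contradiction θ≤n (<⇒≱ n<θ)
      ... | no n≮θ | inj₁ (c , (c≤ , c≮) , q) = contradiction (≤-<-trans (≮⇒≥ c≮) (toℕ<n c)) n≮θ
      ... | no n≮θ | inj₂ (_ , i , n%π≡ , q) =
        subst (λ n → Q (θ * π + n) M as) (sym (trans n%π≡ (m<n⇒m%n≡m (toℕ<n i)))) q
      ⇐ : ∀ {M as} → Q (representative θ π (count (P? M as))) M as → Cases M as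
      ⇐ {M} {as} q with count (P? M as) <? θ
      ... | yes n<θ = inj₁ (fromℕ< n<θ , subst (λ c → (c ≤ _ × ¬ (suc c ≤ _)) × Q c M as)
                        (sym (toℕ-fromℕ< n<θ)) ((≤-refl , n≮n _) , q))
      ... | no n≮θ = inj₂ (≮⇒≥ n≮θ , fromℕ< (m%n<n (count (P? M as)) π) ,
                       subst (λ c → count (P? M as) % π ≡ c % π × Q (θ * π + c) M as)
                         (sym (toℕ-fromℕ< (m%n<n (count (P? M as)) π)))
                         (sym (m%n%n≡m%n (count (P? M as)) π) , q))

count≤length : ∀ {n} {P : Fin n → Set} (P? : ∀ x → Dec (P x)) xs →
               (∀ x → P x → x ∈ˡ xs) → count P? ≤ length xs
count≤length P? [] P⊆ with count P? in c
... | zero  = z≤n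
... | suc _ with x , p ← count>0⇒∃ P? (subst (0 <_) (sym c) (s≤s z≤n)) with () ← P⊆ x p
count≤length P? (x ∷ xs) P⊆ with P? x
... | yes p = subst (_≤ suc (length xs)) (sym (count-without P? p))
                (s≤s (count≤length (λ y → P? y ×-dec ¬? (y Fin.≟ x)) xs
                  (λ y (q , y≢x) → [ (λ y≡x → contradiction y≡x y≢x) , id ]′ (split (P⊆ y q)))))
  where
  split : ∀ {y} → y ∈ˡ x ∷ xs → y ≡ x ⊎ y ∈ˡ xs
  split (here y≡x) = inj₁ y≡x
  split (there y∈) = inj₂ y∈
... | no ¬p = m≤n⇒m≤1+n (count≤length P? xs (λ y q → tail y q (P⊆ y q)))
  where
  tail : ∀ y → _ → y ∈ˡ x ∷ xs → y ∈ˡ xs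
  tail y q (here refl) = contradiction q ¬p
  tail y q (there y∈) = y∈

-- Warshall's algorithm: paths whose inner vertices belong to a list.
module _ {n} {E : Fin n → Fin n → Set} (E? : ∀ x y → Dec (E x y)) where

  private
    Via : List (Fin n) → Fin n → Fin n → Set
    Via []       x y = x ≡ y ⊎ E x y
    Via (w ∷ ws) x y = Via ws x y ⊎ Via ws x w × Via ws w y

    via? : ∀ ws x y → Dec (Via ws x y)
    via? []       x y = x Fin.≟ y ⊎-dec E? x y
    via? (w ∷ ws) x y = via? ws x y ⊎-dec via? ws x w ×-dec via? ws w y

    via-refl : ∀ ws x → Via ws x x
    via-refl []       x = inj₁ refl
    via-refl (w ∷ ws) x = inj₁ (via-refl ws x)

    via-edge : ∀ ws {x y} → E x y → Via ws x y
    via-edge []       e = inj₂ e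
    via-edge (w ∷ ws) e = inj₁ (via-edge ws e)

    via-trans : ∀ {ws x y z} → y ∈ˡ ws → Via ws x y → Via ws y z → Via ws x z
    via-trans (here refl) (inj₁ p)       (inj₁ q)       = inj₂ (p , q)
    via-trans (here refl) (inj₁ p)       (inj₂ (_ , q)) = inj₂ (p , q)
    via-trans (here refl) (inj₂ (p , _)) (inj₁ q)       = inj₂ (p , q)
    via-trans (here refl) (inj₂ (p , _)) (inj₂ (_ , q)) = inj₂ (p , q)
    via-trans (there y∈) (inj₁ p)        (inj₁ q)       = inj₁ (via-trans y∈ p q)
    via-trans (there y∈) (inj₁ p)        (inj₂ (q , r)) = inj₂ (via-trans y∈ p q , r)
    via-trans (there y∈) (inj₂ (p , q))  (inj₁ r)       = inj₂ (p , via-trans y∈ q r)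
    via-trans (there y∈) (inj₂ (p , _))  (inj₂ (_ , q)) = inj₂ (p , q)

    star⇒via : ∀ {x y} → Star E x y → Via (allFin n) x y
    star⇒via ε                   = via-refl (allFin n) _
    star⇒via (_◅_ {j = z} e p) = via-trans (∈-allFin z) (via-edge (allFin n) e) (star⇒via p)

    via⇒star : ∀ ws {x y} → Via ws x y → Star E x y
    via⇒star []       (inj₁ refl)    = ε
    via⇒star []       (inj₂ e)       = e ◅ ε
    via⇒star (w ∷ ws) (inj₁ p)       = via⇒star ws p
    via⇒star (w ∷ ws) (inj₂ (p , q)) = via⇒star ws p ◅◅ via⇒star ws q

  abstract
    star? : ∀ x y → Dec (Star E x y)
    star? x y = map′ (via⇒star (allFin n)) star⇒via (via? (allFin n) x y)

-- Graphs of bounded tree-depth: walks, obstructions, roots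

diameter : ℕ → ℕ
diameter zero    = 0
diameter (suc k) = suc (diameter k) + suc (diameter k)

-- Bounds for minimal obstructions to Depth≤ k in graphs of diameter at most b.
obstructionSize : ℕ → ℕ → ℕ
obstructionSize b zero    = 1
obstructionSize b (suc k) = let c = obstructionSize b k in suc (c + suc b + c * (c + suc b))

rootBound : ℕ → ℕ → ℕ
rootBound d zero    = 0
rootBound d (suc k) = rootBound d k + obstructionSize (diameter d) k

module BoundedDepth {n} (G : SimpleGraph n) (adj? : ∀ x y → Dec (SimpleGraph.Adj G x y)) where
  open SimpleGraph G
  open DecMembership (Fin._≟_ {n}) using () renaming (_∈?_ to _∈ˡ?_)

  Edge : Subset n → Fin n → Fin n → Set
  Edge S x y = x ∈ S × y ∈ S × Adj x y

  Reach : Subset n → Fin n → Fin n → Set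
  Reach = Reachable G

  edge-sym : ∀ {S x y} → Edge S x y → Edge S y x
  edge-sym (x∈ , y∈ , e) = y∈ , x∈ , adj-sym e

  reach-sym : ∀ {S x y} → Reach S x y → Reach S y x
  reach-sym = Star.reverse edge-sym

  reach? : ∀ S x y → Dec (Reach S x y)
  reach? S = star? (λ x y → x ∈? S ×-dec y ∈? S ×-dec adj? x y)

  reach-∈ : ∀ {S x y} → Reach S x y → x ∈ S → y ∈ S
  reach-∈ ε                  x∈ = x∈
  reach-∈ ((_ , z∈ , _) ◅ p) _  = reach-∈ p z∈

  reach-mono : ∀ {S S′ x y} → (∀ {v} → v ∈ S → v ∈ S′) → Reach S x y → Reach S′ x y
  reach-mono S⊆ = Star.map (λ (x∈ , y∈ , e) → S⊆ x∈ , S⊆ y∈ , e)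

  reach-≢ : ∀ {S r x y} → Reach (S - r) x y → x ≢ r → y ≢ r
  reach-≢ ε                  x≢r = x≢r
  reach-≢ ((_ , z∈ , _) ◅ p) _   = reach-≢ p (proj₂ (x∈p-y⁻ z∈))

  -- Depth≤ k S x: the component of x in the subgraph induced on S has tree-depth at most k.
  Depth≤ : ℕ → Subset n → Fin n → Set
  Depth≤ zero    S x = ⊥
  Depth≤ (suc k) S x = ∃[ r ] Reach S x r × (∀ y → Reach S r y → y ≢ r → Depth≤ k (S - r) y)

  Root≤ : ℕ → Subset n → Fin n → Set
  Root≤ k S r = ∀ y → Reach S r y → y ≢ r → Depth≤ k (S - r) y

  abstract
    depth≤? : ∀ k S x → Dec (Depth≤ k S x)
    depth≤? zero    S x = no id
    depth≤? (suc k) S x = Fin.any? λ r → reach? S x r ×-dec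
      Fin.all? λ y → reach? S r y →-dec ¬? (y Fin.≟ r) →-dec depth≤? k (S - r) y

    root≤? : ∀ k S r → Dec (Root≤ k S r)
    root≤? k S r = Fin.all? λ y → reach? S r y →-dec ¬? (y Fin.≟ r) →-dec depth≤? k (S - r) y

  depth≤-suc : ∀ {k S x} → Depth≤ k S x → Depth≤ (suc k) S x
  depth≤-suc {suc k} (r , x⇝r , root) = r , x⇝r , λ y r⇝y y≢r → depth≤-suc (root y r⇝y y≢r)

  depth≤-mono : ∀ {k l S x} → k ≤ l → Depth≤ k S x → Depth≤ l S x
  depth≤-mono k≤l h = go (≤⇒≤′ k≤l) h
    where
    go : ∀ {k l S x} → k ≤′ l → Depth≤ k S x → Depth≤ l S x
    go ≤′-refl       h = h
    go (≤′-step k≤l) h = depth≤-suc (go k≤l h)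

  depth≤-reach : ∀ {k S x y} → Reach S x y → Depth≤ k S x → Depth≤ k S y
  depth≤-reach {suc k} x⇝y (r , x⇝r , root) = r , reach-sym x⇝y ◅◅ x⇝r , root

  reach-into : ∀ {S S′ x y} → (∀ z → Reach S′ x z → z ∈ S) → Reach S′ x y → Reach S x y
  reach-into S⊇ ε = ε
  reach-into S⊇ (e@(_ , _ , xy) ◅ p) =
    (S⊇ _ ε , S⊇ _ (e ◅ ε) , xy) ◅ reach-into (λ z → S⊇ z ∘ (e ◅_)) p

  -- If the root `r` survives in the component of `x` in `S′`, it is kept. Otherwise that component
  -- avoids `r`, so it lies in one component of `S - r`, whose depth is smaller by one, and any
  -- vertex, here `x`, may replace the root.
  depth≤-hereditary : ∀ {k S S′ x} → (∀ y → Reach S′ x y → y ∈ S) → Depth≤ k S x → Depth≤ k S′ x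
  depth≤-hereditary {suc k} {S} {S′} {x} S⊇ (r , x⇝r , root) with reach? S′ x r
  ... | yes x⇝′r = r , x⇝′r , λ y r⇝y y≢r → depth≤-hereditary
          (λ u y⇝u → x∈p∧x≢y⇒x∈p-y (S⊇ u (x⇝′r ◅◅ r⇝y ◅◅ reach-mono (proj₁ ∘ x∈p-y⁻) y⇝u))
                                    (reach-≢ y⇝u y≢r))
          (root y (reach-into (λ z → S⊇ z ∘ (x⇝′r ◅◅_)) r⇝y) y≢r)
  ... | no x⇝̸r = x , ε , λ y x⇝y y≢x → depth≤-hereditary
          (λ u y⇝u → let x⇝u = x⇝y ◅◅ reach-mono (proj₁ ∘ x∈p-y⁻) y⇝u in
                     x∈p∧x≢y⇒x∈p-y (S⊇ u x⇝u) (λ { refl → x⇝̸r x⇝u }))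
          (root y (reach-sym x⇝r ◅◅ reach-into S⊇ x⇝y) (λ { refl → x⇝̸r x⇝y }))

  treeDepth⇒depth≤ : ∀ {S k x} → TreeDepth G S k → x ∈ S → Depth≤ k S x
  treeDepth⇒depth≤ {S} {x = x} (single ∣S∣≡1) x∈ =
    x , ε , λ y x⇝y y≢x → contradiction (only y (reach-∈ x⇝y x∈)) y≢x
    where
    ∣S-x∣≡0 : ∣ S - x ∣ ≡ 0
    ∣S-x∣≡0 = suc-injective (trans (sym (∣p∣≡1+∣p-x∣ x∈)) ∣S∣≡1)
    only : ∀ y → y ∈ S → y ≡ x
    only y y∈ with y Fin.≟ x
    ... | yes y≡x = y≡x
    ... | no y≢x with () ← trans (sym ∣S-x∣≡0) (∣p∣≡1+∣p-x∣ (x∈p∧x≢y⇒x∈p-y y∈ y≢x))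
  treeDepth⇒depth≤ (connected _ conn t td _ (r , r∈ , refl)) x∈ =
    r , conn _ r x∈ r∈ , λ y r⇝y y≢r →
      treeDepth⇒depth≤ (td r r∈) (x∈p∧x≢y⇒x∈p-y (reach-∈ r⇝y r∈) y≢r)
  -- Heredity is used from the component `K` up to `S`: it only asks that everything reachable from
  -- `x` in `S` lies in `K`.
  treeDepth⇒depth≤ {S} {x = x} (disconnected _ t td t≤ _) x∈ =
    depth≤-hereditary (λ y → from (∈-comprehension (reach? S x) y))
      (depth≤-mono (t≤ K component) (treeDepth⇒depth≤ (td K component) (from (∈-comprehension (reach? S x) x) ε)))
    where
    K = comprehension (reach? S x)
    component : Component G S K
    component = x , x∈ , ∈-comprehension (reach? S x)

  -- The component of r has depth 1 + κ ≤ k, and r can be the root of an optimal elimination tree.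
  IsRoot : ℕ → Subset n → Fin n → Set
  IsRoot k S r = ∃[ κ ] ¬ Depth≤ (toℕ {k} κ) S r × Root≤ (toℕ κ) S r

  abstract
    isRoot? : ∀ k S r → Dec (IsRoot k S r)
    isRoot? k S r = Fin.any? λ κ → ¬? (depth≤? (toℕ κ) S r) ×-dec root≤? (toℕ κ) S r

  -- Walks of bounded length

  Within : Subset n → ℕ → Fin n → Fin n → Set
  Within S zero    x y = x ≡ y
  Within S (suc m) x y = Within S m x y ⊎ (∃[ z ] Edge S x z × Within S m z y)

  within-mono : ∀ {S S′} m {x y} → (∀ {v} → v ∈ S → v ∈ S′) → Within S m x y → Within S′ m x y
  within-mono zero    S⊆ p        = p
  within-mono (suc m) S⊆ (inj₁ p) = inj₁ (within-mono m S⊆ p)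
  within-mono (suc m) S⊆ (inj₂ (z , (x∈ , z∈ , e) , p)) =
    inj₂ (z , (S⊆ x∈ , S⊆ z∈ , e) , within-mono m S⊆ p)

  within-trans : ∀ {S} l {m x y z} → Within S l x y → Within S m y z → Within S (l + m) x z
  within-trans zero    refl     q = q
  within-trans (suc l) (inj₁ p) q = inj₁ (within-trans l p q)
  within-trans (suc l) (inj₂ (w , e , p)) q = inj₂ (w , e , within-trans l p q)

  within-snoc : ∀ {S} m {x y z} → Within S m x y → Edge S y z → Within S (suc m) x z
  within-snoc {S} m {x} {z = z} p e = subst (λ l → Within S l x z) (+-comm m 1) (within-trans m p (inj₂ (_ , e , refl)))

  within-sym : ∀ {S} m {x y} → Within S m x y → Within S m y x
  within-sym zero    refl               = refl
  within-sym (suc m) (inj₁ p)           = inj₁ (within-sym m p)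
  within-sym (suc m) (inj₂ (z , e , p)) = within-snoc m (within-sym m p) (edge-sym e)

  within⇒reach : ∀ {S} m {x y} → Within S m x y → Reach S x y
  within⇒reach zero    refl               = ε
  within⇒reach (suc m) (inj₁ p)           = within⇒reach m p
  within⇒reach (suc m) (inj₂ (z , e , p)) = e ◅ within⇒reach m p

  before-root : ∀ {S r x} → Reach S x r → x ≢ r → ∃[ z ] Reach (S - r) x z × Edge S z r
  before-root ε x≢x = contradiction refl x≢x
  before-root {r = r} (_◅_ {j = w} e@(x∈ , w∈ , xw) p) x≢r with w Fin.≟ r
  ... | yes refl = _ , ε , e
  ... | no w≢r with z , w⇝z , zr ← before-root p w≢r =
    z , (x∈p∧x≢y⇒x∈p-y x∈ x≢r , x∈p∧x≢y⇒x∈p-y w∈ w≢r , xw) ◅ w⇝z , zr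

  -- Both vertices walk to the root `r`. Before its last edge such a walk can stay in a component of
  -- `S - r`, whose smaller depth bounds it by induction; hence the recursion of `diameter`.
  reach⇒within : ∀ k {S x y} → Depth≤ k S x → Reach S x y → Within S (diameter k) x y
  reach⇒within (suc k) {S} {x} {y} (r , x⇝r , root) x⇝y =
    within-trans (suc (diameter k)) (toRoot x⇝r)
      (within-sym (suc (diameter k)) (toRoot (reach-sym x⇝y ◅◅ x⇝r)))
    where
    toRoot : ∀ {z} → Reach S z r → Within S (suc (diameter k)) z r
    toRoot {z} z⇝r with z Fin.≟ r
    ... | yes refl = inj₁ (stay (diameter k))
      where
      stay : ∀ m → Within S m z z
      stay zero    = refl
      stay (suc m) = inj₁ (stay m)
    ... | no z≢r with w , z⇝w , wr ← before-root z⇝r z≢r =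
      within-snoc (diameter k) (within-mono (diameter k) (proj₁ ∘ x∈p-y⁻)
        (reach⇒within k (root z (reach-sym z⇝r) z≢r) z⇝w)) wr

  -- The list is a certificate of connection: the walk persists in every vertex set that contains
  -- it.
  walk-vertices : ∀ {S} m {x y} → Within S m x y →
    ∃[ vs ] length vs ≤ suc m × x ∈ˡ vs × (∀ {v} → v ∈ˡ vs → Reach S x v) ×
            (∀ S′ → (∀ {v} → v ∈ˡ vs → v ∈ S′) → Reach S′ x y)
  walk-vertices zero {x} refl = x ∷ [] , ≤-refl , here refl , (λ { (here refl) → ε }) , λ _ _ → ε
  walk-vertices (suc m) (inj₁ p) with vs , len , rest ← walk-vertices m p = vs , m≤n⇒m≤1+n len , rest
  walk-vertices (suc m) {x} (inj₂ (z , e@(_ , _ , xz) , p))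
    with vs , len , z∈ , z⇝ , persists ← walk-vertices m p =
    x ∷ vs , s≤s len , here refl , (λ { (here refl) → ε ; (there v∈) → e ◅ z⇝ v∈ }) ,
    λ S′ vs⊆ → (vs⊆ (here refl) , vs⊆ (there z∈) , xz) ◅ persists S′ (vs⊆ ∘ there)

  -- Obstructions to small depth

  -- Depth above `k` is demanded in all `S′` that contain the list, as the obstruction is applied to
  -- sets from which a candidate root has been deleted.
  Obstruction : ℕ → Subset n → ℕ → Fin n → Set
  Obstruction k S c x =
    ∃[ vs ] length vs ≤ c × x ∈ˡ vs × (∀ {v} → v ∈ˡ vs → Reach S x v) ×
            (∀ S′ → (∀ {v} → v ∈ˡ vs → v ∈ S′) → ¬ Depth≤ k S′ x)

  -- v ∉ core, and the path reaches the core without leaving S, so that the vertex v is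
  -- not a root of the component of x in any graph containing the core and the path.
  record Avoiding (k : ℕ) (S : Subset n) (b c : ℕ) (x v : Fin n) : Set where
    field
      target    : Fin n
      core path : List (Fin n)
      core≤     : length core ≤ c
      path≤     : length path ≤ b
      target∈   : target ∈ˡ core
      v∉        : ¬ v ∈ˡ core
      core⇝     : ∀ {u} → u ∈ˡ core → Reach S x u
      path⇝     : ∀ {u} → u ∈ˡ path → Reach S x u
      connects  : ∀ S′ → (∀ {u} → u ∈ˡ path → u ∈ S′) → Reach S′ x target
      blocks    : ∀ S′ → (∀ {u} → u ∈ˡ core → u ∈ S′) → ¬ Depth≤ k S′ target

    refutes : ∀ {S′ r} → (∀ {u} → u ∈ˡ core ++ path → u ∈ S′) → ¬ r ∈ˡ core → Reach S′ x r → ¬ Root≤ k S′ r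
    refutes {S′} {r} ⊆S′ r∉ x⇝r root = blocks (S′ - r)
      (λ u∈ → x∈p∧x≢y⇒x∈p-y (⊆S′ (∈-++⁺ˡ u∈)) λ { refl → r∉ u∈ })
      (root target (reach-sym x⇝r ◅◅ connects S′ (⊆S′ ∘ ∈-++⁺ʳ core)) λ { refl → r∉ target∈ })

  open Avoiding

  collect : ∀ {P : Fin n → Set} {c} (vs : List (Fin n)) (f : ∀ {v} → v ∈ˡ vs → List (Fin n)) →
            (∀ {v} (v∈ : v ∈ˡ vs) → length (f v∈) ≤ c) → (∀ {v} (v∈ : v ∈ˡ vs) {u} → u ∈ˡ f v∈ → P u) →
            ∃[ us ] length us ≤ length vs * c × (∀ {u} → u ∈ˡ us → P u) ×
                    (∀ {v} (v∈ : v ∈ˡ vs) {u} → u ∈ˡ f v∈ → u ∈ˡ us)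
  collect []       f f≤ fP = [] , z≤n , (λ ()) , λ ()
  collect {c = c} (v ∷ vs) f f≤ fP with us , len , usP , f⊆ ← collect vs (f ∘ there) (f≤ ∘ there) (λ v∈ → fP (there v∈)) =
    f (here refl) ++ us ,
    subst (_≤ c + length vs * c) (sym (length-++ (f (here refl)))) (+-mono-≤ (f≤ (here refl)) len) ,
    (λ u∈ → [ fP (here refl) , usP ]′ (∈-++⁻ (f (here refl)) u∈)) ,
    λ { (here refl) u∈ → ∈-++⁺ˡ u∈ ; (there v∈) u∈ → ∈-++⁺ʳ _ (f⊆ v∈ u∈) }

  module _ {k b c : ℕ} {S : Subset n} {x : Fin n} (avoiding : ∀ v → Reach S x v → Avoiding k S (suc b) c x v) where

    private
      Piece = Avoiding k S (suc b) c x

      vertices : ∀ {v} → Piece v → List (Fin n)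
      vertices A = core A ++ path A

      vertices≤ : ∀ {v} (A : Piece v) → length (vertices A) ≤ c + suc b
      vertices≤ A = subst (_≤ c + suc b) (sym (length-++ (core A))) (+-mono-≤ (core≤ A) (path≤ A))

      vertices⇝ : ∀ {v} (A : Piece v) {u} → u ∈ˡ vertices A → Reach S x u
      vertices⇝ A u∈ = [ core⇝ A , path⇝ A ]′ (∈-++⁻ (core A) u∈)

    private
      piece : (A : Piece x) → ∀ {v} → v ∈ˡ core A → Piece v
      piece A {v} v∈ = avoiding v (core⇝ A v∈)

    -- The piece for `x` refutes every root outside its core. A root inside this core, one of at
    -- most `c` candidates, is refuted by the piece that avoids it. Each piece has at most
    -- `c + suc b` vertices, and `x` itself is added, which gives the recursion of
    -- `obstructionSize`.
    obstruction-suc : Obstruction (suc k) S (suc (c + suc b + c * (c + suc b))) x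
    obstruction-suc = go (avoiding x ε)
      where
      go : Piece x → Obstruction (suc k) S (suc (c + suc b + c * (c + suc b))) x
      go A with us , us≤ , us⇝ , ⊆us ← collect {P = Reach S x} (core A) (λ v∈ → vertices (piece A v∈))
                                          (λ v∈ → vertices≤ (piece A v∈)) (λ v∈ → vertices⇝ (piece A v∈)) =
        x ∷ vertices A ++ us ,
        s≤s (subst (_≤ _) (sym (length-++ (vertices A)))
          (+-mono-≤ (vertices≤ A) (≤-trans us≤ (*-monoˡ-≤ _ (core≤ A))))) ,
        here refl ,
        (λ { (here refl) → ε ; (there v∈) → [ vertices⇝ A , us⇝ ]′ (∈-++⁻ (vertices A) v∈) }) ,
        blocked
        where
        blocked : ∀ S′ → (∀ {v} → v ∈ˡ x ∷ vertices A ++ us → v ∈ S′) → ¬ Depth≤ (suc k) S′ x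
        blocked S′ ⊆S′ (r , x⇝r , root) with r ∈ˡ? core A
        ... | no r∉ = refutes A (λ u∈ → ⊆S′ (there (∈-++⁺ˡ u∈))) r∉ x⇝r root
        ... | yes r∈ = let B = avoiding r (core⇝ A r∈) in
          refutes B (λ u∈ → ⊆S′ (there (∈-++⁺ʳ (vertices A) (⊆us r∈ u∈)))) (v∉ B) x⇝r root

  module _ (d : ℕ) where

    private b = diameter d

    -- As `x` has depth above `suc k`, no `v` in its component is a root: some `y` keeps depth above
    -- `k` once `v` is deleted. The obstruction for `y` in `S - v` avoids `v` and is the core of the
    -- piece; a short walk from `x` to `y` is its path.
    obstruction : ∀ k {S x} → x ∈ S → Depth≤ d S x → ¬ Depth≤ k S x → Obstruction k S (obstructionSize b k) x
    obstruction zero {x = x} x∈ _ _ = x ∷ [] , ≤-refl , here refl , (λ { (here refl) → ε }) , λ _ _ ()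
    obstruction (suc k) {S} {x} x∈ Dx ¬Dx = obstruction-suc avoiding
      where
      avoiding : ∀ v → Reach S x v → Avoiding k S (suc b) (obstructionSize b k) x v
      avoiding v x⇝v with Fin.any? (λ y → reach? S v y ×-dec ¬? (y Fin.≟ v) ×-dec ¬? (depth≤? k (S - v) y))
      ... | no ∄y = contradiction (v , x⇝v , λ y v⇝y y≢v →
              decidable-stable (depth≤? k (S - v) y) λ ¬D → ∄y (y , v⇝y , y≢v , ¬D)) ¬Dx
      ... | yes (y , v⇝y , y≢v , ¬Dy) =
        let x⇝y = x⇝v ◅◅ v⇝y
            y∈ = reach-∈ x⇝y x∈
            C , C≤ , y∈C , y⇝C , blocksC = obstruction k (x∈p∧x≢y⇒x∈p-y y∈ y≢v)
              (depth≤-hereditary (λ u y⇝u → reach-∈ (reach-mono (proj₁ ∘ x∈p-y⁻) y⇝u) y∈)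
                (depth≤-reach x⇝y Dx)) ¬Dy
            -- The walk lives in `S` and may pass through `v`. It only connects the candidate root
            -- to `y` before the root is deleted, so avoiding `v` is a matter of the core alone.
            P , P≤ , _ , x⇝P , connectsP = walk-vertices b (reach⇒within d Dx x⇝y)
        in record
          { target = y ; core = C ; path = P ; core≤ = C≤ ; path≤ = P≤ ; target∈ = y∈C
          ; v∉ = λ v∈C → reach-≢ (y⇝C v∈C) y≢v refl
          ; core⇝ = λ u∈ → x⇝y ◅◅ reach-mono (proj₁ ∘ x∈p-y⁻) (y⇝C u∈)
          ; path⇝ = x⇝P ; connects = connectsP ; blocks = blocksC }

    -- A root of a component of depth `1 + κ` meets every obstruction to depth `κ`: otherwise its
    -- removal would leave the obstruction intact in a component of depth at most `κ`. The
    -- obstructions for the various `κ < k` are appended, whence the sum in `rootBound`.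
    roots : ∀ k {S x} → x ∈ S → Depth≤ d S x →
      ∃[ vs ] length vs ≤ rootBound d k × (∀ r → Reach S x r → ∀ κ → κ < k → ¬ Depth≤ κ S r → Root≤ κ S r → r ∈ˡ vs)
    roots zero x∈ Dx = [] , z≤n , λ _ _ _ ()
    roots (suc k) {S} {x} x∈ Dx with vs , vs≤ , vs⊇ ← roots k x∈ Dx with depth≤? k S x
    ... | yes D = vs , ≤-trans vs≤ (m≤m+n _ _) , λ r x⇝r κ κ< ¬D root → [ (λ κ<k → vs⊇ r x⇝r κ κ<k ¬D root) ,
            (λ { refl → contradiction (depth≤-reach x⇝r D) ¬D }) ]′ (m≤n⇒m<n∨m≡n (s≤s⁻¹ κ<))
    ... | no ¬Dx with us , us≤ , x∈us , us⇝ , blocked ← obstruction k x∈ Dx ¬Dx =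
      vs ++ us , subst (_≤ _) (sym (length-++ vs)) (+-mono-≤ vs≤ us≤) ,
      λ r x⇝r κ κ< ¬D root → [ (λ κ<k → ∈-++⁺ˡ (vs⊇ r x⇝r κ κ<k ¬D root)) ,
        (λ { refl → ∈-++⁺ʳ vs (decidable-stable (r ∈ˡ? us) λ r∉ →
          blocked (S - r) (λ v∈ → x∈p∧x≢y⇒x∈p-y (reach-∈ (us⇝ v∈) x∈) λ { refl → r∉ v∈ })
            (root x (reach-sym x⇝r) λ { refl → r∉ x∈us })) }) ]′ (m≤n⇒m<n∨m≡n (s≤s⁻¹ κ<))

    count-roots≤ : ∀ k {S x} → x ∈ S → Depth≤ d S x → {P : Fin n → Set} (P? : ∀ r → Dec (P r)) →
                   (∀ r → P r → Reach S x r × IsRoot k S r) → count P? ≤ rootBound d k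
    count-roots≤ k x∈ Dx P? P⇒root with vs , vs≤ , vs⊇ ← roots k x∈ Dx =
      ≤-trans (count≤length P? vs λ r p → let (x⇝r , κ , ¬D , root) = P⇒root r p in
        vs⊇ r x⇝r (toℕ κ) (Fin.toℕ<n κ) ¬D root) vs≤

-- Definability of adjacency, reachability and tree-depth

anyVec? : ∀ {n} a {P : Vec (Fin n) a → Set} → (∀ xs → Dec (P xs)) → Dec (∃ P)
anyVec? zero    P? = map′ ([] ,_) (λ { ([] , p) → p }) (P? [])
anyVec? (suc a) P? = map′ (λ (x , xs , p) → x ∷ xs , p) (λ { (x ∷ xs , p) → x , xs , p })
                       (Fin.any? λ x → anyVec? a (P? ∘ (x ∷_)))

abstract
  adjacent? : ∀ {σ} (𝔄 : Structure σ) x y → Dec (SimpleGraph.Adj (gaifman 𝔄) x y)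
  adjacent? {σ} 𝔄 x y = ¬? (x Fin.≟ y) ×-dec Fin.any? λ R → anyVec? (arity σ R) λ xs →
    T? (interp 𝔄 R xs) ×-dec VecAny.any? (x Fin.≟_) xs ×-dec VecAny.any? (y Fin.≟_) xs

∈ᵛ⇔lookup : ∀ {A : Set} {m} {x : A} {xs : Vec A m} → x ∈ᵛ xs ⇔ (∃[ i ] x ≡ lookup xs i)
∈ᵛ⇔lookup = mk⇔ (λ x∈ → VecAny.index x∈ , VecAny.lookup-index x∈) (λ (i , p) → position i p)
  where
  position : ∀ {A : Set} {m} {x : A} {xs : Vec A m} i → x ≡ lookup xs i → x ∈ᵛ xs
  position {xs = _ ∷ _} zero    p = VecAny.here p
  position {xs = _ ∷ _} (suc i) p = VecAny.there (position i p)

module _ {n : ℕ} where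

  removed : ∀ {j} → Vec (Fin n) j → Subset n
  removed []       = ⊤
  removed (r ∷ rs) = removed rs - r

  ∈-removed : ∀ {j} {rs : Vec (Fin n) j} {x} → (∀ i → x ≢ lookup rs i) ⇔ x ∈ removed rs
  ∈-removed {rs = []}     = mk⇔ (λ _ → ∈⊤) (λ _ ())
  ∈-removed {rs = r ∷ rs} = mk⇔
    (λ x≢ → x∈p∧x≢y⇒x∈p-y (to (∈-removed {rs = rs}) (x≢ ∘ suc)) (x≢ zero))
    (λ x∈ → λ { zero → proj₂ (x∈p-y⁻ x∈) ; (suc i) → from (∈-removed {rs = rs}) (proj₁ (x∈p-y⁻ x∈)) i })

module Gaifman {σ : Signature} (𝔄 : Structure σ) = BoundedDepth (gaifman 𝔄) (adjacent? 𝔄)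

DepthAtMost : ∀ {σ} → ℕ → Structure σ → Set
DepthAtMost d 𝔄 = ∀ x → Gaifman.Depth≤ 𝔄 d ⊤ x

-- A bound on the alternations needed to define Depth≤ k.
rank : ℕ → ℕ
rank zero    = 1
rank (suc k) = suc (suc (rank k))

1≤rank : ∀ k → 1 ≤ rank k
1≤rank zero    = ≤-refl
1≤rank (suc k) = s≤s z≤n

module GraphDefinability (σ : Signature) (d : ℕ) where

  open Definability σ (DepthAtMost d) public
  module 𝔾 (M : Model) = Gaifman (structure M)

  Adjᴿ : Relation 2
  Adjᴿ M (x ∷ y ∷ []) = SimpleGraph.Adj (gaifman (structure M)) x y

  adjᵉ : ∃-Definable 0 2 Adjᴿ
  adjᵉ = convert (λ { M (x ∷ y ∷ []) → mk⇔
           (λ (x≢y , R , bs , h , x∈ , y∈) →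
             x≢y , R , bs , subst (T ∘ interp (structure M) R) (variables bs _) h ,
             from ∈ᵛ⇔lookup (proj₁ x∈ , entry bs x∈) , from ∈ᵛ⇔lookup (proj₁ y∈ , entry bs y∈))
           (λ (x≢y , R , bs , h , x∈ , y∈) →
             x≢y , R , bs , subst (T ∘ interp (structure M) R) (sym (variables bs _)) h ,
             entry⁻ bs x∈ , entry⁻ bs y∈) })
         (existential (¬ᵈ eqᵈ zero (suc zero)) ∧ᵉ
          ∃ᶠᵉ λ R → let a = arity σ R in ∃ᵉ* a (existential
            (relᵈ R (Vec.map (_↑ˡ 2) (Vec.allFin a)) ∧ᵈ
             ∃ᶠ (λ i → eqᵈ (a ↑ʳ zero) (i ↑ˡ 2)) ∧ᵈ ∃ᶠ (λ i → eqᵈ (a ↑ʳ suc zero) (i ↑ˡ 2)))))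
    where
    variables : ∀ {A : Set} {a} (bs : Vec A a) (as : Vec A 2) →
                Vec.map (lookup (bs Vec.++ as)) (Vec.map (_↑ˡ 2) (Vec.allFin a)) ≡ bs
    variables bs as = trans (sym (map-∘ _ _ _))
      (trans (map-cong (lookup-++ˡ bs as) (Vec.allFin _)) (map-lookup-allFin bs))
    entry : ∀ {A : Set} {a} (bs : Vec A a) {as : Vec A 2} {i} →
            (e : ∃[ k ] lookup (bs Vec.++ as) (a ↑ʳ i) ≡ lookup (bs Vec.++ as) (k ↑ˡ 2)) →
            lookup as i ≡ lookup bs (proj₁ e)
    entry bs {as} {i} (k , p) = trans (sym (lookup-++ʳ bs as i)) (trans p (lookup-++ˡ bs as k))
    entry⁻ : ∀ {A : Set} {a} (bs : Vec A a) {as : Vec A 2} {i} → lookup as i ∈ᵛ bs →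
             ∃[ k ] lookup (bs Vec.++ as) (a ↑ʳ i) ≡ lookup (bs Vec.++ as) (k ↑ˡ 2)
    entry⁻ bs {as} {i} x∈ = let (k , p) = to ∈ᵛ⇔lookup x∈ in
      k , trans (lookup-++ʳ bs as i) (trans p (sym (lookup-++ˡ bs as k)))

  module _ {j : ℕ} where

    Presentᴿ : Relation (suc j)
    Presentᴿ M (x ∷ rs) = x ∈ removed rs

    presentᵈ : Definable 0 (suc j) Presentᴿ
    presentᵈ = convert (λ { M (x ∷ rs) → ∈-removed {rs = rs} }) (∀ᶠ λ i → ¬ᵈ eqᵈ zero (suc i))

    Withinᴿ : ℕ → Relation (suc (suc j))
    Withinᴿ m M (x ∷ y ∷ rs) = 𝔾.Within M (removed rs) m x y

    withinᵉ : ∀ m → ∃-Definable 0 (suc (suc j)) (Withinᴿ m)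
    withinᵉ zero    = convert (λ { M (x ∷ y ∷ rs) → ⇔-id _ }) (existential (eqᵈ zero (suc zero)))
    withinᵉ (suc m) = convert (λ { M (x ∷ y ∷ rs) → mk⇔
        (Sum.map₂ λ (z , ((x∈ , z∈) , xz) , p) → z , (x∈ , z∈ , xz) , p)
        (Sum.map₂ λ (z , (x∈ , z∈ , xz) , p) → z , ((x∈ , z∈) , xz) , p) })
      (withinᵉ m ∨ᵉ ∃ᵉ {P = Q}
        (convert (λ { M (z ∷ x ∷ y ∷ rs) → ⇔-id _ })
        ((existential (reindex (λ { (z ∷ x ∷ y ∷ rs) → x ∷ rs }) (λ { g (_ ∷ _ ∷ _ ∷ _) → refl }) presentᵈ ∧ᵈ
                       reindex (λ { (z ∷ x ∷ y ∷ rs) → z ∷ rs }) (λ { g (_ ∷ _ ∷ _ ∷ _) → refl }) presentᵈ) ∧ᵉ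
         reindex (λ { (z ∷ x ∷ y ∷ rs) → x ∷ z ∷ [] }) (λ { g (_ ∷ _ ∷ _ ∷ _) → refl }) adjᵉ) ∧ᵉ
         reindex (λ { (z ∷ x ∷ y ∷ rs) → z ∷ y ∷ rs }) (λ { g (_ ∷ _ ∷ _ ∷ _) → refl }) (withinᵉ m))))
      where
      Q : Relation (suc (suc (suc j)))
      Q M (z ∷ x ∷ y ∷ rs) = ((x ∈ removed rs × z ∈ removed rs) × Adjᴿ M (x ∷ z ∷ [])) × Withinᴿ m M (z ∷ y ∷ rs)

    Reachᴿ : Relation (suc (suc j))
    Reachᴿ M (x ∷ y ∷ rs) = 𝔾.Reach M (removed rs) x y

    reach?ᴿ : ∀ M as → Dec (Reachᴿ M as)
    reach?ᴿ M (x ∷ y ∷ rs) = 𝔾.reach? M (removed rs) x y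

    depth≤d : ∀ M (rs : Vec ∣ M ∣ᴹ j) x → 𝔾.Depth≤ M d (removed rs) x
    depth≤d M rs x = 𝔾.depth≤-hereditary M (λ _ _ → ∈⊤) (M .member x)

    -- Bounded depth, which survives the deletion of `rs`, turns reachability into a walk of length
    -- at most `diameter d`. Such a walk is expressed with ∃ alone, so level 1 suffices in any
    -- context.
    reachᵈ : Definable 1 (suc (suc j)) Reachᴿ
    reachᵈ = convert (λ { M (x ∷ y ∷ rs) → mk⇔ (𝔾.within⇒reach M (diameter d))
                                              (𝔾.reach⇒within M d (depth≤d M rs x)) })
               (alternating (withinᵉ (diameter d)))

  module _ {j : ℕ} where

    Depthᴿ Rootᴿ : ℕ → Relation (suc j)
    Depthᴿ k M (x ∷ rs) = 𝔾.Depth≤ M k (removed rs) x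
    Rootᴿ  k M (r ∷ rs) = 𝔾.Root≤ M k (removed rs) r

  depthᵈ : ∀ k {j} → Definable (rank k) (suc j) (Depthᴿ k)
  rootᵈ : ∀ k {j} → Definable (suc (rank k)) (suc j) (Rootᴿ k)

  depthᵈ zero = convert (λ { M (x ∷ rs) → ⇔-id _ }) (constᵈ (no id))
  depthᵈ (suc k) {j} = convert (λ { M (x ∷ rs) → ⇔-id _ }) (alternating (∃ᵉ {P = Q} (existential
      (convert (λ { M (r ∷ x ∷ rs) → ⇔-id _ })
        (reindex (λ { (r ∷ x ∷ rs) → x ∷ r ∷ rs }) (λ { g (_ ∷ _ ∷ _) → refl }) (weaken (s≤s z≤n) reachᵈ) ∧ᵈ
         reindex (λ { (r ∷ x ∷ rs) → r ∷ rs }) (λ { g (_ ∷ _ ∷ _) → refl }) (rootᵈ k))))))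
    where
    Q : Relation (suc (suc j))
    Q M (r ∷ x ∷ rs) = Reachᴿ M (x ∷ r ∷ rs) × Rootᴿ k M (r ∷ rs)

  rootᵈ k {j} = convert (λ { M (r ∷ rs) → ⇔-id _ }) (∀ᵈ {P = Q}
      (convert (λ { M (y ∷ r ∷ rs) → ⇔-id _ })
        (implᵈ (λ { M (y ∷ r ∷ rs) → reach?ᴿ M (r ∷ y ∷ rs) })
          (reindex (λ { (y ∷ r ∷ rs) → r ∷ y ∷ rs }) (λ { g (_ ∷ _ ∷ _) → refl }) (weaken (1≤rank k) reachᵈ))
          (implᵈ (λ M as → ¬? (lookup as zero Fin.≟ lookup as (suc zero))) (¬ᵈ eqᵈ zero (suc zero)) (depthᵈ k)))))
    where
    Q : Relation (suc (suc j))
    Q M (y ∷ r ∷ rs) = Reachᴿ M (r ∷ y ∷ rs) → y ≢ r → Depthᴿ k M (y ∷ r ∷ rs)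

-- Finite types

-- A retract of `Fin size` instead of a bijection: it passes directly to products and tables, and
-- injectivity of `encode` yields decidable equality and pigeonhole arguments.
record Finite (A : Set) : Set where
  field
    size          : ℕ
    encode        : A → Fin size
    decode        : Fin size → A
    decode-encode : ∀ a → decode (encode a) ≡ a

  encode-injective : ∀ {a b} → encode a ≡ encode b → a ≡ b
  encode-injective {a} {b} e = trans (sym (decode-encode a)) (trans (cong decode e) (decode-encode b))

  infix 4 _≟_
  _≟_ : (a b : A) → Dec (a ≡ b)
  a ≟ b = map′ encode-injective (cong encode) (encode a Fin.≟ encode b)

open Finite

retract : ∀ {A B : Set} (f : A → B) (g : B → A) → (∀ a → g (f a) ≡ a) → Finite B → Finite A
retract f g gf B .size = B .size
retract f g gf B .encode = B .encode ∘ f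
retract f g gf B .decode = g ∘ B .decode
retract f g gf B .decode-encode a = trans (cong g (B .decode-encode (f a))) (gf a)

Fin-finite : ∀ {n} → Finite (Fin n)
Fin-finite = record { encode = id ; decode = id ; decode-encode = λ _ → refl }

Bool-finite : Finite Bool
Bool-finite = retract (λ { false → zero ; true → suc zero }) (λ { zero → false ; (suc zero) → true })
  (λ { false → refl ; true → refl }) (Fin-finite {2})

×-finite : ∀ {A B : Set} → Finite A → Finite B → Finite (A × B)
×-finite A B .size = A .size * B .size
×-finite A B .encode (a , b) = combine (A .encode a) (B .encode b)
×-finite A B .decode i = let (a , b) = remQuot {A .size} (B .size) i in A .decode a , B .decode b
×-finite A B .decode-encode (a , b) = trans
  (cong (λ (i , j) → A .decode i , B .decode j) (remQuot-combine (A .encode a) (B .encode b)))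
  (cong₂ _,_ (A .decode-encode a) (B .decode-encode b))

Vec-finite : ∀ {A : Set} → Finite A → ∀ n → Finite (Vec A n)
Vec-finite A zero    = retract (λ _ → zero) (λ _ → []) (λ { [] → refl }) (Fin-finite {1})
Vec-finite A (suc n) = retract (λ { (x ∷ xs) → x , xs }) (λ (x , xs) → x ∷ xs) (λ { (_ ∷ _) → refl })
  (×-finite A (Vec-finite A n))

-- Functions on Vec Bool j, as a finite type
Table : ℕ → Set → Set
Table zero    A = A
Table (suc j) A = Table j A × Table j A

table : ∀ {j} {A : Set} → (Vec Bool j → A) → Table j A
table {zero}  f = f []
table {suc j} f = table (f ∘ (false ∷_)) , table (f ∘ (true ∷_))

entry : ∀ {j} {A : Set} → Table j A → Vec Bool j → A
entry t       []           = t
entry (t , u) (false ∷ bs) = entry t bs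
entry (t , u) (true  ∷ bs) = entry u bs

entry-table : ∀ {j} {A : Set} (f : Vec Bool j → A) bs → entry (table f) bs ≡ f bs
entry-table f []           = refl
entry-table f (false ∷ bs) = entry-table (f ∘ (false ∷_)) bs
entry-table f (true  ∷ bs) = entry-table (f ∘ (true ∷_)) bs

Table-finite : ∀ {A : Set} → Finite A → ∀ j → Finite (Table j A)
Table-finite A zero    = A
Table-finite A (suc j) = ×-finite (Table-finite A j) (Table-finite A j)

T-not : ∀ {b} → T (not b) ⇔ (¬ T b)
T-not {true}  = mk⇔ (λ ()) (λ h → h _)
T-not {false} = mk⇔ (λ _ ()) _

T-does : ∀ {X : Set} (X? : Dec X) → T (does X?) ⇔ X
T-does (yes x) = mk⇔ (λ _ → x) _
T-does (no ¬x) = mk⇔ (λ ()) ¬x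

∃Bool? : ∀ {P : Bool → Set} → (∀ b → Dec (P b)) → Dec (∃ P)
∃Bool? P? = map′ [ (true ,_) , (false ,_) ]′ (λ { (true , p) → inj₁ p ; (false , p) → inj₂ p })
              (P? true ⊎-dec P? false)

∈⇔T : ∀ {n} {S : Subset n} {x} → x ∈ S ⇔ T (lookup S x)
∈⇔T {S = S} {x} = mk⇔ (λ x∈ → subst T (sym ([]=⇒lookup x∈)) _) (λ h → lookup⇒[]= x S (T⇒≡ h))
  where
  T⇒≡ : ∀ {b} → T b → b ≡ true
  T⇒≡ {true} _ = refl

unique-++⁻ : ∀ {A : Set} (xs : List A) {ys} → Unique (xs ++ ys) → Unique xs × Unique ys × Disjoint xs ys
unique-++⁻ [] u = [] , u , λ ()
unique-++⁻ (x ∷ xs) (x∉ ∷ u) with u₁ , u₂ , disj ← unique-++⁻ xs u =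
  All.++⁻ˡ xs x∉ ∷ u₁ , u₂ ,
  λ { (here refl , y∈) → All.lookup (All.++⁻ʳ xs x∉) y∈ refl ; (there x∈ , y∈) → disj (x∈ , y∈) }

-- Ordered forests, in first-child next-sibling form
data Forest (A : Set) : Set where
  []   : Forest A
  node : (u : A) (children rest : Forest A) → Forest A

elements : ∀ {A} → Forest A → List A
elements []           = []
elements (node u c f) = u ∷ elements c ++ elements f

-- NodeAt F p q: q is the path from a node of F to the root, followed by p.
data NodeAt {A : Set} : Forest A → ∀ {j} → Vec A j → ∀ {i} → Vec A (suc i) → Set where
  top   : ∀ {u c f j} {p : Vec A j} → NodeAt (node u c f) p (u ∷ p)
  below : ∀ {u c f j} {p : Vec A j} {i} {q : Vec A (suc i)} → NodeAt c (u ∷ p) q → NodeAt (node u c f) p q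
  next  : ∀ {u c f j} {p : Vec A j} {i} {q : Vec A (suc i)} → NodeAt f p q → NodeAt (node u c f) p q

nodeAt-elements : ∀ {A} {F : Forest A} {u} → u ∈ˡ elements F → ∀ {j} (p : Vec A j) →
                  ∃[ i ] Σ (Vec A i) λ q → NodeAt F p (u ∷ q)
nodeAt-elements {F = node u c f} (here refl) p = _ , p , top
nodeAt-elements {F = node u c f} (there u∈) p with ∈-++⁻ (elements c) u∈
... | inj₁ u∈c with _ , q , at ← nodeAt-elements u∈c (u ∷ p) = _ , q , below at
... | inj₂ u∈f with _ , q , at ← nodeAt-elements u∈f p = _ , q , next at

data Before {A : Set} : List A → A → A → Set where
  here  : ∀ {u v xs} → v ∈ˡ xs → Before (u ∷ xs) u v
  there : ∀ {u v x xs} → Before xs u v → Before (x ∷ xs) u v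

module _ {A : Set} where

  before-∈ : ∀ {xs} {u v : A} → Before xs u v → u ∈ˡ xs × v ∈ˡ xs
  before-∈ (here v∈) = here refl , there v∈
  before-∈ (there b) with u∈ , v∈ ← before-∈ b = there u∈ , there v∈

  before-trans : ∀ {xs} {u v w : A} → Unique xs → Before xs u v → Before xs v w → Before xs u w
  before-trans _        (here v∈) (here w∈)  = here w∈
  before-trans _        (here v∈) (there b)  = here (proj₂ (before-∈ b))
  before-trans (x∉ ∷ _) (there b) (here w∈)  = contradiction refl (All.lookup x∉ (proj₂ (before-∈ b)))
  before-trans (_ ∷ u)  (there b) (there b′) = there (before-trans u b b′)

  before-irrefl : ∀ {xs} {u : A} → Unique xs → ¬ Before xs u u
  before-irrefl (x∉ ∷ _) (here u∈) = All.lookup x∉ u∈ refl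
  before-irrefl (_ ∷ u)  (there b) = before-irrefl u b

  before-total : ∀ {xs} {u v : A} → u ∈ˡ xs → v ∈ˡ xs → u ≡ v ⊎ Before xs u v ⊎ Before xs v u
  before-total (here refl) (here refl) = inj₁ refl
  before-total (here refl) (there v∈)  = inj₂ (inj₁ (here v∈))
  before-total (there u∈)  (here refl) = inj₂ (inj₂ (here u∈))
  before-total (there u∈)  (there v∈)  = Sum.map₂ (Sum.map there there) (before-total u∈ v∈)

  before? : (∀ (x y : A) → Dec (x ≡ y)) → ∀ xs u v → Dec (Before xs u v)
  before? _≟_ [] u v = no λ ()
  before? _≟_ (x ∷ xs) u v = map′
    (λ { (inj₁ (refl , v∈)) → here v∈ ; (inj₂ b) → there b })
    (λ { (here v∈) → inj₁ (refl , v∈) ; (there b) → inj₂ b })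
    (x ≟ u ×-dec Any.any? (v ≟_) xs ⊎-dec before? _≟_ xs u v)

  precedes : (A → Bool) → (A → Bool) → List A → Bool
  precedes P Q []       = false
  precedes P Q (x ∷ xs) = (P x ∧ any Q xs) ∨ precedes P Q xs

  any-++ : ∀ (P : A → Bool) xs ys → any P (xs ++ ys) ≡ any P xs ∨ any P ys
  any-++ P []       ys = refl
  any-++ P (x ∷ xs) ys = trans (cong (P x ∨_) (any-++ P xs ys)) (sym (Bool.∨-assoc (P x) _ _))

  -- A pair is found in `xs`, in `ys`, or across them. Hence the three Booleans kept by `precedesᴿ`
  -- compose along the preorder listing.
  precedes-++ : ∀ P Q xs ys →
    precedes P Q (xs ++ ys) ≡ precedes P Q xs ∨ (precedes P Q ys ∨ (any P xs ∧ any Q ys))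
  precedes-++ P Q []       ys = sym (Bool.∨-identityʳ _)
  precedes-++ P Q (x ∷ xs) ys = trans
    (cong₂ (λ q r → (P x ∧ q) ∨ r) (any-++ Q xs ys) (precedes-++ P Q xs ys))
    (solve 6 (λ a b c e f g → a :* (b :+ c) :+ (e :+ (f :+ g :* c)) := (a :* b :+ e) :+ (f :+ (a :+ g) :* c))
       refl (P x) (any Q xs) (any Q ys) (precedes P Q xs) (precedes P Q ys) (any P xs))
    where open ∨-∧-Solver

  T-precedes : ∀ {P Q} {xs} → T (precedes P Q xs) ⇔ (∃[ u ] ∃[ v ] Before xs u v × T (P u) × T (Q v))
  T-precedes {P} {Q} = mk⇔ (⇒ _) λ (_ , _ , b , Pu , Qv) → ⇐ b Pu Qv
    where
    ⇒ : ∀ xs → T (precedes P Q xs) → ∃[ u ] ∃[ v ] Before xs u v × T (P u) × T (Q v)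
    ⇒ (x ∷ xs) h with to (T-∨ {P x ∧ any Q xs}) h
    ... | inj₁ h′ with Px , Qxs ← to (T-∧ {P x}) h′ with v , v∈ , Qv ← find (any⁻ Q xs Qxs) =
      x , v , here v∈ , Px , Qv
    ... | inj₂ h′ with u , v , b , r ← ⇒ xs h′ = u , v , there b , r
    ⇐ : ∀ {xs u v} → Before xs u v → T (P u) → T (Q v) → T (precedes P Q xs)
    ⇐ {x ∷ xs} (here v∈) Pu Qv = from (T-∨ {P x ∧ any Q xs}) (inj₁ (from T-∧ (Pu , any⁺ Q (lose v∈ Qv))))
    ⇐ {x ∷ xs} (there b) Pu Qv = from (T-∨ {P x ∧ any Q xs}) (inj₂ (⇐ b Pu Qv))

-- Recognizers

module Recognition (σ : Signature) where

  Atom : ℕ → Set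
  Atom j = Σ (Symbol σ) λ R → Vec (Fin j) (arity σ R)

  allVecs : ∀ j a → List (Vec (Fin j) a)
  allVecs j zero    = [] ∷ []
  allVecs j (suc a) = cartesianProductWith _∷_ (allFin j) (allVecs j a)

  ∈-allVecs : ∀ {j a} (xs : Vec (Fin j) a) → xs ∈ˡ allVecs j a
  ∈-allVecs []       = here refl
  ∈-allVecs (x ∷ xs) = ∈-cartesianProductWith⁺ _∷_ (∈-allFin x) (∈-allVecs xs)

  atoms : ∀ j → List (Atom j)
  atoms j = concatMap (λ R → List.map (R ,_) (allVecs j (arity σ R))) (allFin (symbols σ))

  ∈-atoms : ∀ {j} (α : Atom j) → α ∈ˡ atoms j
  ∈-atoms (R , xs) = ∈-concatMap⁺ _ (lose (∈-allFin R) (∈-map⁺ (R ,_) (∈-allVecs xs)))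

  Diagram : ℕ → Set
  Diagram j = Vec Bool (length (atoms j))

  query : ∀ {j} → Diagram j → Atom j → Bool
  query Δ α = lookup Δ (index (∈-atoms α))

  -- States depend on the length `j` of the path above the forest because the letters do: a node is
  -- read with the diagram of its root path and the marks of `n` sets on that path. `step` then
  -- takes the state of the children and that of the later siblings, in this order.
  record Recognizer (n : ℕ) : Set₁ where
    field
      State  : ℕ → Set
      finite : ∀ j → Finite (State j)
      empty  : ∀ j → State j
      step   : ∀ {j} → Diagram (suc j) → Vec (Vec Bool (suc j)) n → State (suc j) → State j → State j
      accept : State 0 → Bool

  open Recognizer

  module _ {n : ℕ} where

    combineᴿ : (Bool → Bool → Bool) → Recognizer n → Recognizer n → Recognizer n
    combineᴿ _⊕_ ℛ 𝒮 .State j = State ℛ j × State 𝒮 j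
    combineᴿ _⊕_ ℛ 𝒮 .finite j = ×-finite (finite ℛ j) (finite 𝒮 j)
    combineᴿ _⊕_ ℛ 𝒮 .empty j = empty ℛ j , empty 𝒮 j
    combineᴿ _⊕_ ℛ 𝒮 .step Δ m (c , c′) (f , f′) = step ℛ Δ m c f , step 𝒮 Δ m c′ f′
    combineᴿ _⊕_ ℛ 𝒮 .accept (s , t) = accept ℛ s ⊕ accept 𝒮 t

    complement : Recognizer n → Recognizer n
    complement ℛ .State = State ℛ
    complement ℛ .finite = finite ℛ
    complement ℛ .empty = empty ℛ
    complement ℛ .step = step ℛ
    complement ℛ .accept = not ∘ accept ℛ

    somewhere : (∀ {j} → Diagram (suc j) → Vec (Vec Bool (suc j)) n → Bool) → Recognizer n
    somewhere check .State _ = Bool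
    somewhere check .finite _ = Bool-finite
    somewhere check .empty _ = false
    somewhere check .step Δ m c f = check Δ m ∨ (c ∨ f)
    somewhere check .accept = id

    meetCheck : Fin n → Fin n → ∀ {j} → Diagram (suc j) → Vec (Vec Bool (suc j)) n → Bool
    meetCheck a b _ m = head (lookup m a) ∧ head (lookup m b)

    meet : Fin n → Fin n → Recognizer n
    meet a b = somewhere (meetCheck a b)

    precedesᴿ : Fin n → Fin n → Recognizer n
    precedesᴿ a b .State _ = Bool × Bool × Bool
    precedesᴿ a b .finite _ = ×-finite Bool-finite (×-finite Bool-finite Bool-finite)
    precedesᴿ a b .empty _ = false , false , false
    precedesᴿ a b .step Δ m (αc , βc , γc) (αf , βf , γf) =
      let α = head (lookup m a) ; β = head (lookup m b) in
      α ∨ (αc ∨ αf) , β ∨ (βc ∨ βf) , (α ∧ (βc ∨ βf)) ∨ (γc ∨ (γf ∨ (αc ∧ βf)))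
    precedesᴿ a b .accept (_ , _ , γ) = γ

    -- `meet a a` finds a member of the set, and `precedesᴿ a a` two distinct ones.
    singleton : Fin n → Recognizer n
    singleton a = combineᴿ (λ nonempty repeated → nonempty ∧ not repeated) (meet a a) (precedesᴿ a a)

    -- In an elimination forest the entries of a tuple lie on one root path, so all of them are
    -- visible from a single node; `s` guesses their positions on its path.
    tupleCheck : (R : Symbol σ) → Vec (Fin n) (arity σ R) → ∀ {j} → Diagram (suc j) → Vec (Vec Bool (suc j)) n → Bool
    tupleCheck R as Δ m = does (anyVec? (arity σ R) λ s →
      T? (query Δ (R , s)) ×-dec Fin.all? λ i → T? (lookup (lookup m (lookup as i)) (lookup s i)))

    tuple : (R : Symbol σ) → Vec (Fin n) (arity σ R) → Recognizer n
    tuple R as = somewhere (tupleCheck R as)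

  -- A state of project ℛ lists, for each choice of the projected set on the path above a
  -- forest, the states that ℛ can reach on the forest.
  module _ {n : ℕ} (ℛ : Recognizer (suc n)) where

    Successor : ∀ {j} → Diagram (suc j) → Vec (Vec Bool (suc j)) n →
                Table (suc j) (Subset (size (finite ℛ (suc j)))) → Table j (Subset (size (finite ℛ j))) →
                Vec Bool j → Fin (size (finite ℛ j)) → Set
    Successor {j} Δ m c f bs i = ∃[ b ] ∃[ s ] ∃[ t ] s ∈ entry c (b ∷ bs) × t ∈ entry f bs ×
      i ≡ encode (finite ℛ j) (step ℛ Δ ((b ∷ bs) ∷ m) (decode (finite ℛ (suc j)) s) (decode (finite ℛ j) t))

    successor? : ∀ {j} Δ m c f (bs : Vec Bool j) i → Dec (Successor Δ m c f bs i)
    successor? Δ m c f bs i = ∃Bool? λ b → Fin.any? λ s → Fin.any? λ t →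
      s ∈? entry c (b ∷ bs) ×-dec t ∈? entry f bs ×-dec i Fin.≟ _

    project : Recognizer n
    project .State j = Table j (Subset (size (finite ℛ j)))
    project .finite j = Table-finite (Vec-finite Bool-finite _) j
    project .empty j = table λ _ → ⁅ encode (finite ℛ j) (empty ℛ j) ⁆
    project .step Δ m c f = table λ bs → comprehension (successor? Δ m c f bs)
    project .accept S = does (Fin.any? λ i → i ∈? S ×-dec T? (accept ℛ (decode (finite ℛ 0) i)))

  -- An element variable becomes a set variable that ranges over singletons.
  compile : ∀ {m k n} → Vec (Fin n) m → Vec (Fin n) k → MSO (σ ∪≤) m k → Recognizer n
  compile ex eX (rel zero (x ∷ y ∷ [])) =
    combineᴿ _∨_ (meet (lookup ex x) (lookup ex y)) (precedesᴿ (lookup ex x) (lookup ex y))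
  compile ex eX (rel (suc R) xs) = tuple R (Vec.map (lookup ex) xs)
  compile ex eX (x ≐ y)    = meet (lookup ex x) (lookup ex y)
  compile ex eX (x ∈′ X)   = meet (lookup ex x) (lookup eX X)
  compile ex eX (¬′ φ)     = complement (compile ex eX φ)
  compile ex eX (φ ∧′ ψ)   = combineᴿ _∧_ (compile ex eX φ) (compile ex eX ψ)
  compile ex eX (φ ∨′ ψ)   = combineᴿ _∨_ (compile ex eX φ) (compile ex eX ψ)
  compile ex eX (∃₁ φ)     = project (combineᴿ _∧_ (singleton zero)
                               (compile (zero ∷ Vec.map suc ex) (Vec.map suc eX) φ))
  compile ex eX (∀₁ φ)     = complement (project (combineᴿ (λ s h → s ∧ not h) (singleton zero)
                               (compile (zero ∷ Vec.map suc ex) (Vec.map suc eX) φ)))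
  compile ex eX (∃₂ φ)     = project (compile (Vec.map suc ex) (zero ∷ Vec.map suc eX) φ)
  compile ex eX (∀₂ φ)     = complement (project (complement
                               (compile (Vec.map suc ex) (zero ∷ Vec.map suc eX) φ)))

-- Runs on forests over a structure, and correctness of the compilation

module Runs {σ : Signature} (𝔄 : Structure σ) where

  open Recognition σ
  open Recognizer

  private
    U : Set
    U = Universe 𝔄
    N : ℕ
    N = suc (size-1 𝔄)

  holds : ∀ {j} → Vec U j → Atom j → Bool
  holds p (R , s) = interp 𝔄 R (Vec.map (lookup p) s)

  diagram : ∀ {j} → Vec U j → Diagram j
  diagram {j} p = Vec.map (holds p) (Vec.fromList (atoms j))

  query-diagram : ∀ {j} (p : Vec U j) α → query (diagram p) α ≡ holds p α
  query-diagram {j} p α = trans (lookup-map i (holds p) (Vec.fromList (atoms j)))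
    (cong (holds p) (trans (lookup-fromList (atoms j) i) (sym (lookup-index (∈-atoms α)))))
    where
    i = index (∈-atoms α)
    lookup-fromList : ∀ {A : Set} (xs : List A) i → lookup (Vec.fromList xs) i ≡ List.lookup xs i
    lookup-fromList (x ∷ xs) zero    = refl
    lookup-fromList (x ∷ xs) (suc i) = lookup-fromList xs i

  marks : ∀ {n j} → Vec (Subset N) n → Vec U j → Vec (Vec Bool j) n
  marks M p = Vec.map (λ S → Vec.map (lookup S) p) M

  lookup-marks : ∀ {n j} (M : Vec (Subset N) n) (p : Vec U j) a i →
                 lookup (lookup (marks M p) a) i ≡ lookup (lookup M a) (lookup p i)
  lookup-marks M p a i = trans (cong (λ bs → lookup bs i) (lookup-map a _ M)) (lookup-map i _ p)

  head-marks : ∀ {n j} (M : Vec (Subset N) n) u (p : Vec U j) a →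
               head (lookup (marks M (u ∷ p)) a) ≡ lookup (lookup M a) u
  head-marks M u p a = cong head (lookup-map a _ M)

  run : ∀ {n} (ℛ : Recognizer n) → Vec (Subset N) n → ∀ {j} → Vec U j → Forest U → State ℛ j
  run ℛ M p []           = empty ℛ _
  run ℛ M p (node u c f) = step ℛ (diagram (u ∷ p)) (marks M (u ∷ p)) (run ℛ M (u ∷ p) c) (run ℛ M p f)

  accepts : ∀ {n} → Recognizer n → Vec (Subset N) n → Forest U → Bool
  accepts ℛ M F = accept ℛ (run ℛ M [] F)

  module _ {n : ℕ} (M : Vec (Subset N) n) where

    run-combine : ∀ _⊕_ ℛ 𝒮 {j} (p : Vec U j) F →
                  run (combineᴿ _⊕_ ℛ 𝒮) M p F ≡ (run ℛ M p F , run 𝒮 M p F)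
    run-combine _⊕_ ℛ 𝒮 p []           = refl
    run-combine _⊕_ ℛ 𝒮 p (node u c f)
      rewrite run-combine _⊕_ ℛ 𝒮 (u ∷ p) c | run-combine _⊕_ ℛ 𝒮 p f = refl

    run-complement : ∀ ℛ {j} (p : Vec U j) F → run (complement ℛ) M p F ≡ run ℛ M p F
    run-complement ℛ p []           = refl
    run-complement ℛ p (node u c f) rewrite run-complement ℛ (u ∷ p) c | run-complement ℛ p f = refl

    accepts-combine : ∀ _⊕_ ℛ 𝒮 F → accepts (combineᴿ _⊕_ ℛ 𝒮) M F ≡ (accepts ℛ M F ⊕ accepts 𝒮 M F)
    accepts-combine _⊕_ ℛ 𝒮 F rewrite run-combine _⊕_ ℛ 𝒮 [] F = refl

    accepts-complement : ∀ ℛ F → T (accepts (complement ℛ) M F) ⇔ (¬ T (accepts ℛ M F))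
    accepts-complement ℛ F rewrite run-complement ℛ [] F = T-not

    accepts-∧ : ∀ ℛ 𝒮 F → T (accepts (combineᴿ _∧_ ℛ 𝒮) M F) ⇔ (T (accepts ℛ M F) × T (accepts 𝒮 M F))
    accepts-∧ ℛ 𝒮 F rewrite accepts-combine _∧_ ℛ 𝒮 F = T-∧

    accepts-∨ : ∀ ℛ 𝒮 F → T (accepts (combineᴿ _∨_ ℛ 𝒮) M F) ⇔ (T (accepts ℛ M F) ⊎ T (accepts 𝒮 M F))
    accepts-∨ ℛ 𝒮 F rewrite accepts-combine _∨_ ℛ 𝒮 F = T-∨

    accepts-∧¬ : ∀ ℛ 𝒮 F → T (accepts (combineᴿ (λ s h → s ∧ not h) ℛ 𝒮) M F) ⇔
                           (T (accepts ℛ M F) × (¬ T (accepts 𝒮 M F)))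
    accepts-∧¬ ℛ 𝒮 F rewrite accepts-combine (λ s h → s ∧ not h) ℛ 𝒮 F = (⇔-id _ ×-⇔ T-not) ⇔-∘ T-∧

    module _ (check : ∀ {j} → Diagram (suc j) → Vec (Vec Bool (suc j)) n → Bool) where

      Checked : ∀ {i} → Vec U (suc i) → Set
      Checked q = T (check (diagram q) (marks M q))

      run-somewhere : ∀ {j} (p : Vec U j) F → T (run (somewhere check) M p F) ⇔
                      (∃[ i ] Σ (Vec U (suc i)) λ q → NodeAt F p q × Checked q)
      run-somewhere p F = mk⇔ (⇒ p F) (λ (_ , _ , at , h) → ⇐ at h)
        where
        ⇒ : ∀ {j} (p : Vec U j) F → T (run (somewhere check) M p F) →
            ∃[ i ] Σ (Vec U (suc i)) λ q → NodeAt F p q × Checked q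
        ⇒ p (node u c f) h with to (T-∨ {check (diagram (u ∷ p)) (marks M (u ∷ p))}) h
        ... | inj₁ h′ = _ , _ , top , h′
        ... | inj₂ h′ with to (T-∨ {run (somewhere check) M (u ∷ p) c}) h′
        ...   | inj₁ hc with i , q , at , hq ← ⇒ (u ∷ p) c hc = i , q , below at , hq
        ...   | inj₂ hf with i , q , at , hq ← ⇒ p f hf = i , q , next at , hq
        ⇐ : ∀ {F j} {p : Vec U j} {i} {q : Vec U (suc i)} → NodeAt F p q → Checked q →
            T (run (somewhere check) M p F)
        ⇐ top h = from T-∨ (inj₁ h)
        ⇐ {node u c f} {p = p} (below at) h =
          from (T-∨ {check (diagram (u ∷ p)) (marks M (u ∷ p))}) (inj₂ (from T-∨ (inj₁ (⇐ at h))))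
        ⇐ {node u c f} {p = p} (next at) h =
          from (T-∨ {check (diagram (u ∷ p)) (marks M (u ∷ p))}) (inj₂
            (from (T-∨ {run (somewhere check) M (u ∷ p) c}) (inj₂ (⇐ at h))))

    run-precedes : ∀ a b {j} (p : Vec U j) F → let A = lookup (lookup M a) ; B = lookup (lookup M b) in
      run (precedesᴿ a b) M p F ≡ (any A (elements F) , any B (elements F) , precedes A B (elements F))
    run-precedes a b p [] = refl
    run-precedes a b p (node u c f)
      rewrite run-precedes a b (u ∷ p) c | run-precedes a b p f
            | head-marks M u p a | head-marks M u p b
            | any-++ (lookup (lookup M a)) (elements c) (elements f)
            | any-++ (lookup (lookup M b)) (elements c) (elements f)
            | precedes-++ (lookup (lookup M a)) (lookup (lookup M b)) (elements c) (elements f) = refl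

    accepts-precedes : ∀ a b F → T (accepts (precedesᴿ a b) M F) ⇔
      (∃[ u ] ∃[ v ] Before (elements F) u v × u ∈ lookup M a × v ∈ lookup M b)
    accepts-precedes a b F rewrite run-precedes a b [] F = mk⇔
      (λ h → let (u , v , u<v , hu , hv) = to T-precedes h in u , v , u<v , from ∈⇔T hu , from ∈⇔T hv)
      (λ (u , v , u<v , hu , hv) → from T-precedes (u , v , u<v , to ∈⇔T hu , to ∈⇔T hv))

  module _ {n : ℕ} (ℛ : Recognizer (suc n)) (M : Vec (Subset N) n) where

    private
      𝒫 = project ℛ
      code : ∀ {j} → State ℛ j → Fin (size (finite ℛ j))
      code {j} = encode (finite ℛ j)

    bits-cong : ∀ {j} (A B : Subset N) (p : Vec U j) → (∀ i → lookup A (lookup p i) ≡ lookup B (lookup p i)) →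
                Vec.map (lookup A) p ≡ Vec.map (lookup B) p
    bits-cong A B []      eqs = refl
    bits-cong A B (x ∷ p) eqs = cong₂ _∷_ (eqs zero) (bits-cong A B p (eqs ∘ suc))

    run-cong : ∀ {j} (A B : Subset N) (p : Vec U j) F →
               (∀ i → lookup A (lookup p i) ≡ lookup B (lookup p i)) →
               (∀ {x} → x ∈ˡ elements F → lookup A x ≡ lookup B x) →
               run ℛ (A ∷ M) p F ≡ run ℛ (B ∷ M) p F
    run-cong A B p [] onPath onForest = refl
    run-cong A B p (node u c f) onPath onForest
      rewrite bits-cong A B (u ∷ p) (λ { zero → onForest (here refl) ; (suc i) → onPath i })
            | run-cong A B (u ∷ p) c (λ { zero → onForest (here refl) ; (suc i) → onPath i })
                (onForest ∘ there ∘ ∈-++⁺ˡ)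
            | run-cong A B p f onPath (onForest ∘ there ∘ ∈-++⁺ʳ (elements c)) = refl

    run∈project : ∀ A {j} (p : Vec U j) F → code (run ℛ (A ∷ M) p F) ∈ entry (run 𝒫 M p F) (Vec.map (lookup A) p)
    run∈project A p [] = subst (code (empty ℛ _) ∈_) (sym (entry-table _ (Vec.map (lookup A) p))) (x∈⁅x⁆ _)
    run∈project A p (node u c f) =
      subst (code (run ℛ (A ∷ M) p (node u c f)) ∈_) (sym (entry-table _ (Vec.map (lookup A) p)))
        (from (∈-comprehension (successor? ℛ _ _ _ _ (Vec.map (lookup A) p)) _)
          (lookup A u , _ , _ , run∈project A (u ∷ p) c , run∈project A p f ,
           cong code (cong₂ (step ℛ (diagram (u ∷ p)) (marks (A ∷ M) (u ∷ p)))
             (sym (decode-encode (finite ℛ _) _)) (sym (decode-encode (finite ℛ _) _)))))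

    -- The set is assembled in stages: `A`, corrected at `u` to `A₁`, changed on the children to
    -- `B`, then on the siblings to `C`. Distinctness of the elements keeps these regions disjoint,
    -- and a run depends on a set only through the path and the forest, so the earlier runs survive
    -- the later changes.
    project⇒run : ∀ {j} (p : Vec U j) F → Unique (elements F) → (∀ i → ¬ lookup p i ∈ˡ elements F) →
                  ∀ A i → i ∈ entry (run 𝒫 M p F) (Vec.map (lookup A) p) →
                  ∃[ B ] (∀ {x} → ¬ x ∈ˡ elements F → lookup B x ≡ lookup A x) ×
                         code (run ℛ (B ∷ M) p F) ≡ i
    project⇒run p [] _ _ A i i∈ = A , (λ _ → refl) ,
      sym (x∈⁅y⁆⇒x≡y _ (subst (i ∈_) (entry-table _ (Vec.map (lookup A) p)) i∈))
    project⇒run p (node u c f) (u∉ ∷ uniq) p∉ A i i∈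
      with b , s , t , s∈ , t∈ , i≡ ← to (∈-comprehension (successor? ℛ _ _ _ _ (Vec.map (lookup A) p)) i)
             (subst (i ∈_) (entry-table _ (Vec.map (lookup A) p)) i∈)
         | uniq-c , uniq-f , disj ← unique-++⁻ (elements c) uniq
      with A₁ ← A [ u ]≔ b in A₁≡
      with A₁u ← trans (cong (λ X → lookup X u) (sym A₁≡)) (lookup∘update u A b)
         | A₁x ← (λ x (x≢u : x ≢ u) → trans (cong (λ X → lookup X x) (sym A₁≡)) (lookup∘update′ x≢u A b))
      with A₁p ← bits-cong A₁ A p (λ i → A₁x _ λ { refl → p∉ i (here refl) })
      with B , B≡ , runB ← project⇒run (u ∷ p) c uniq-c
             (λ { zero → λ u∈c → All.lookup u∉ (∈-++⁺ˡ u∈c) refl ; (suc i) → p∉ i ∘ there ∘ ∈-++⁺ˡ })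
             A₁ s (subst (λ bs → s ∈ entry (run 𝒫 M (u ∷ p) c) bs) (sym (cong₂ _∷_ A₁u A₁p)) s∈)
      with Bp ← bits-cong B A p (λ i → trans (B≡ {lookup p i} (p∉ i ∘ there ∘ ∈-++⁺ˡ)) (A₁x _ λ { refl → p∉ i (here refl) }))
      with C , C≡ , runC ← project⇒run p f uniq-f (λ i → p∉ i ∘ there ∘ ∈-++⁺ʳ (elements c))
             B t (subst (λ bs → t ∈ entry (run 𝒫 M p f) bs) (sym Bp) t∈) =
      C , agrees , trans (cong code (cong₂ (λ bs (s , t) → step ℛ (diagram (u ∷ p)) (bs ∷ marks M (u ∷ p)) s t) Cup
            (cong₂ _,_ (trans (run-cong C B (u ∷ p) c onPath (λ x∈ → C≡ (λ x∈f → disj (x∈ , x∈f)))) (decoded runB)) (decoded runC))))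
          (sym i≡)
      where
      decoded : ∀ {j} {s : State ℛ j} {i} → code s ≡ i → s ≡ decode (finite ℛ j) i
      decoded refl = sym (decode-encode (finite ℛ _) _)
      u∉f : ¬ u ∈ˡ elements f
      u∉f u∈f = All.lookup u∉ (∈-++⁺ʳ (elements c) u∈f) refl
      u∉c : ¬ u ∈ˡ elements c
      u∉c u∈c = All.lookup u∉ (∈-++⁺ˡ u∈c) refl
      onPath : ∀ i → lookup C (lookup (u ∷ p) i) ≡ lookup B (lookup (u ∷ p) i)
      onPath zero    = C≡ u∉f
      onPath (suc i) = C≡ (p∉ i ∘ there ∘ ∈-++⁺ʳ (elements c))
      Cup : Vec.map (lookup C) (u ∷ p) ≡ b ∷ Vec.map (lookup A) p
      Cup = trans (bits-cong C B (u ∷ p) onPath) (cong₂ _∷_ (trans (B≡ u∉c) A₁u) Bp)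
      agrees : ∀ {x} → ¬ x ∈ˡ elements (node u c f) → lookup C x ≡ lookup A x
      agrees x∉ = trans (C≡ (x∉ ∘ there ∘ ∈-++⁺ʳ (elements c))) (trans (B≡ (x∉ ∘ there ∘ ∈-++⁺ˡ))
        (A₁x _ λ x≡u → x∉ (here x≡u)))

    accepts-project : ∀ F → Unique (elements F) →
                      T (accepts 𝒫 M F) ⇔ (∃[ A ] T (accepts ℛ (A ∷ M) F))
    accepts-project F uniq = mk⇔
      (λ h → let (i , i∈ , acc) = to (T-does (Fin.any? λ i → i ∈? run 𝒫 M [] F ×-dec _)) h
                 (A , _ , code≡i) = project⇒run [] F uniq (λ ()) ⊤ i i∈ in
             A , subst (T ∘ accept ℛ) (trans (cong (decode (finite ℛ 0)) (sym code≡i)) (decode-encode (finite ℛ 0) _)) acc)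
      (λ (A , acc) → from (T-does (Fin.any? λ i → i ∈? run 𝒫 M [] F ×-dec _))
        (code (run ℛ (A ∷ M) [] F) , run∈project A [] F ,
         subst (T ∘ accept ℛ) (sym (decode-encode (finite ℛ 0) _)) acc))

-- The elimination condition is stated in `chain` for whole tuples and not for edges, which is the
-- form that `tuple` reads.
record EliminationForest {σ : Signature} (𝔄 : Structure σ) : Set where
  field
    forest   : Forest (Universe 𝔄)
    unique   : Unique (elements forest)
    complete : ∀ x → x ∈ˡ elements forest
    chain    : ∀ R xs → T (interp 𝔄 R xs) →
               ∃[ i ] Σ (Vec (Universe 𝔄) (suc i)) λ q → NodeAt forest [] q ×
               (∀ a → ∃[ k ] lookup xs a ≡ lookup q k)

module Correctness {σ : Signature} {𝔄 : Structure σ} (E : EliminationForest 𝔄) where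

  open Recognition σ
  open Runs 𝔄
  open EliminationForest E

  _≼?_ : ∀ x y → Dec (x ≡ y ⊎ Before (elements forest) x y)
  x ≼? y = x Fin.≟ y ⊎-dec before? Fin._≟_ (elements forest) x y

  order : LinearOrder (Universe 𝔄)
  order .LinearOrder._≼_ x y = does (x ≼? y)
  order .LinearOrder.isTotalOrder = record
    { isPartialOrder = record
      { isPreorder = record
        { isEquivalence = isEquivalence
        ; reflexive = λ {x} {y} x≡y → from (T-does (x ≼? y)) (inj₁ x≡y)
        ; trans = λ {x} {y} {z} x≼y y≼z → from (T-does (x ≼? z))
            (transitive (to (T-does (x ≼? y)) x≼y) (to (T-does (y ≼? z)) y≼z)) }
      ; antisym = λ {x} {y} x≼y y≼x →
          antisymmetric (to (T-does (x ≼? y)) x≼y) (to (T-does (y ≼? x)) y≼x) }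
    ; total = λ x y → Sum.map (from (T-does (x ≼? y))) (from (T-does (y ≼? x))) (total x y) }
    where
    transitive : ∀ {x y z} → x ≡ y ⊎ Before (elements forest) x y → y ≡ z ⊎ Before (elements forest) y z →
                 x ≡ z ⊎ Before (elements forest) x z
    transitive (inj₁ refl) y≼z         = y≼z
    transitive (inj₂ x<y)  (inj₁ refl) = inj₂ x<y
    transitive (inj₂ x<y)  (inj₂ y<z)  = inj₂ (before-trans unique x<y y<z)
    antisymmetric : ∀ {x y} → x ≡ y ⊎ Before (elements forest) x y → y ≡ x ⊎ Before (elements forest) y x → x ≡ y
    antisymmetric (inj₁ x≡y) _          = x≡y
    antisymmetric (inj₂ x<y) (inj₁ y≡x) = sym y≡x
    antisymmetric (inj₂ x<y) (inj₂ y<x) = contradiction (before-trans unique x<y y<x) (before-irrefl unique)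
    total : ∀ x y → (x ≡ y ⊎ Before (elements forest) x y) ⊎ (y ≡ x ⊎ Before (elements forest) y x)
    total x y with before-total (complete x) (complete y)
    ... | inj₁ x≡y        = inj₁ (inj₁ x≡y)
    ... | inj₂ (inj₁ x<y) = inj₁ (inj₂ x<y)
    ... | inj₂ (inj₂ y<x) = inj₂ (inj₂ y<x)

  private
    N : ℕ
    N = suc (size-1 𝔄)

  module _ {n : ℕ} (M : Vec (Subset N) n) where

    accepts-meet : ∀ a b → T (accepts (meet a b) M forest) ⇔ (∃[ x ] x ∈ lookup M a × x ∈ lookup M b)
    accepts-meet a b = mk⇔ ⇒ ⇐ ⇔-∘ run-somewhere M (meetCheck a b) [] forest
      where
      At : Set
      At = ∃[ i ] Σ (Vec (Universe 𝔄) (suc i)) λ q → NodeAt forest [] q ×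
           T (head (lookup (marks M q) a) ∧ head (lookup (marks M q) b))
      ⇒ : At → ∃[ x ] x ∈ lookup M a × x ∈ lookup M b
      ⇒ (_ , x ∷ q , _ , h) with ha , hb ← to (T-∧ {head (lookup (marks M (x ∷ q)) a)}) h =
        x , from ∈⇔T (subst T (head-marks M x q a) ha) , from ∈⇔T (subst T (head-marks M x q b) hb)
      ⇐ : (∃[ x ] x ∈ lookup M a × x ∈ lookup M b) → At
      ⇐ (x , xa , xb) with i , q , at ← nodeAt-elements (complete x) [] =
        i , x ∷ q , at , from T-∧ (subst T (sym (head-marks M x q a)) (to ∈⇔T xa) ,
                                   subst T (sym (head-marks M x q b)) (to ∈⇔T xb))

    accepts-singleton : ∀ a → T (accepts (singleton a) M forest) ⇔ (∃[ x ] lookup M a ≡ ⁅ x ⁆)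
    accepts-singleton a = mk⇔ ⇒ ⇐ ⇔-∘
      ((accepts-meet a a ×-⇔ mk⇔ (_∘ from (accepts-precedes M a a forest)) (_∘ to (accepts-precedes M a a forest)))
       ⇔-∘ accepts-∧¬ M (meet a a) (precedesᴿ a a) forest)
      where
      S = lookup M a
      NonemptyUnrepeated : Set
      NonemptyUnrepeated = (∃[ x ] x ∈ S × x ∈ S) × (¬ (∃[ u ] ∃[ v ] Before (elements forest) u v × u ∈ S × v ∈ S))
      ⇒ : NonemptyUnrepeated → ∃[ x ] S ≡ ⁅ x ⁆
      ⇒ ((x , x∈ , _) , ¬rep) = x , ⊆-antisym only (λ y∈ → subst (_∈ S) (sym (x∈⁅y⁆⇒x≡y _ y∈)) x∈)
        where
        only : ∀ {y} → y ∈ S → y ∈ ⁅ x ⁆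
        only {y} y∈ with before-total (complete x) (complete y)
        ... | inj₁ refl       = x∈⁅x⁆ x
        ... | inj₂ (inj₁ x<y) = contradiction (x , y , x<y , x∈ , y∈) ¬rep
        ... | inj₂ (inj₂ y<x) = contradiction (y , x , y<x , y∈ , x∈) ¬rep
      ⇐ : (∃[ x ] S ≡ ⁅ x ⁆) → NonemptyUnrepeated
      ⇐ (x , S≡) = (x , x∈ , x∈) , λ (u , v , u<v , u∈ , v∈) →
        before-irrefl unique (subst₂ (Before (elements forest)) (only u∈) (only v∈) u<v)
        where
        x∈ : x ∈ S
        x∈ = subst (x ∈_) (sym S≡) (x∈⁅x⁆ x)
        only : ∀ {y} → y ∈ S → y ≡ x
        only y∈ = x∈⁅y⁆⇒x≡y x (subst (_ ∈_) S≡ y∈)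

    accepts-tuple : ∀ R as xs → (∀ i → lookup M (lookup as i) ≡ ⁅ lookup xs i ⁆) →
                    T (accepts (tuple R as) M forest) ⇔ T (interp 𝔄 R xs)
    accepts-tuple R as xs M≡ = mk⇔ ⇒ ⇐ ⇔-∘ run-somewhere M (tupleCheck R as) [] forest
      where
      Marked : ∀ {i} → Vec (Universe 𝔄) (suc i) → Vec (Fin (suc i)) (arity σ R) → Set
      Marked q s = T (query (diagram q) (R , s)) ×
                   (∀ i → T (lookup (lookup (marks M q) (lookup as i)) (lookup s i)))
      marked? : ∀ {i} (q : Vec (Universe 𝔄) (suc i)) s → Dec (Marked q s)
      marked? q s = T? _ ×-dec Fin.all? λ i → T? _
      At : Set
      At = ∃[ i ] Σ (Vec (Universe 𝔄) (suc i)) λ q → NodeAt forest [] q × T (does (anyVec? (arity σ R) (marked? q)))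
      mark : ∀ {i} (q : Vec (Universe 𝔄) (suc i)) k a →
             T (lookup (lookup (marks M q) (lookup as a)) k) ⇔ lookup q k ≡ lookup xs a
      mark q k a rewrite lookup-marks M q (lookup as a) k | M≡ a = mk⇔
        (λ h → x∈⁅y⁆⇒x≡y _ (from ∈⇔T h)) (λ q≡ → to ∈⇔T (subst (_∈ ⁅ lookup xs a ⁆) (sym q≡) (x∈⁅x⁆ _)))
      tuple≡ : ∀ {i a} (q : Vec (Universe 𝔄) (suc i)) (s : Vec (Fin (suc i)) a) (xs : Vec (Universe 𝔄) a) →
               (∀ a → lookup q (lookup s a) ≡ lookup xs a) → Vec.map (lookup q) s ≡ xs
      tuple≡ q []      []       eqs = refl
      tuple≡ q (k ∷ s) (x ∷ xs) eqs = cong₂ _∷_ (eqs zero) (tuple≡ q s xs (eqs ∘ suc))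
      ⇒ : At → T (interp 𝔄 R xs)
      ⇒ (_ , q , _ , h) with s , hR , hs ← to (T-does (anyVec? (arity σ R) (marked? q))) h =
        subst T (trans (query-diagram q (R , s))
                  (cong (interp 𝔄 R) (tuple≡ q s xs λ a → to (mark q (lookup s a) a) (hs a)))) hR
      ⇐ : T (interp 𝔄 R xs) → At
      ⇐ hR with i , q , at , xs∈q ← chain R xs hR = i , q , at , from (T-does (anyVec? (arity σ R) (marked? q)))
        (s , subst T (sym (trans (query-diagram q (R , s)) (cong (interp 𝔄 R) (tuple≡ q s xs qs≡)))) hR ,
         λ a → from (mark q (lookup s a) a) (qs≡ a))
        where
        s = Vec.tabulate (proj₁ ∘ xs∈q)
        qs≡ : ∀ a → lookup q (lookup s a) ≡ lookup xs a
        qs≡ a = trans (cong (lookup q) (Vec.lookup∘tabulate (proj₁ ∘ xs∈q) a)) (sym (proj₂ (xs∈q a)))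

  map-suc : ∀ {n m} (A : Subset N) (M : Vec (Subset N) n) (xs : Vec (Fin n) m) →
            Vec.map (lookup (A ∷ M)) (Vec.map suc xs) ≡ Vec.map (lookup M) xs
  map-suc A M xs = sym (map-∘ (lookup (A ∷ M)) suc xs)

  -- The marks have to interpret element variables by singletons. Quantification over elements
  -- preserves this because `singleton` guards the projected set.
  compile-correct : ∀ {m k n} (φ : MSO (σ ∪≤) m k) (ex : Vec (Fin n) m) (eX : Vec (Fin n) k) M ρ Θ →
    Vec.map (lookup M) ex ≡ Vec.map ⁅_⁆ ρ → Vec.map (lookup M) eX ≡ Θ →
    T (accepts (compile ex eX φ) M forest) ⇔ MSO-Sat (expand 𝔄 order) ρ Θ φ

  compile-∃₁ : ∀ {m k n} (φ : MSO (σ ∪≤) (suc m) k) (ex : Vec (Fin n) m) (eX : Vec (Fin n) k) M ρ Θ →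
    Vec.map (lookup M) ex ≡ Vec.map ⁅_⁆ ρ → Vec.map (lookup M) eX ≡ Θ → ∀ a →
    T (accepts (compile (zero ∷ Vec.map suc ex) (Vec.map suc eX) φ) (⁅ a ⁆ ∷ M) forest) ⇔
    MSO-Sat (expand 𝔄 order) (a ∷ ρ) Θ φ
  compile-∃₁ φ ex eX M ρ Θ hx hX a = compile-correct φ _ _ _ _ _
    (cong (⁅ a ⁆ ∷_) (trans (map-suc ⁅ a ⁆ M ex) hx)) (trans (map-suc ⁅ a ⁆ M eX) hX)

  compile-∃₂ : ∀ {m k n} (φ : MSO (σ ∪≤) m (suc k)) (ex : Vec (Fin n) m) (eX : Vec (Fin n) k) M ρ Θ →
    Vec.map (lookup M) ex ≡ Vec.map ⁅_⁆ ρ → Vec.map (lookup M) eX ≡ Θ → ∀ A →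
    T (accepts (compile (Vec.map suc ex) (zero ∷ Vec.map suc eX) φ) (A ∷ M) forest) ⇔
    MSO-Sat (expand 𝔄 order) ρ (A ∷ Θ) φ
  compile-∃₂ φ ex eX M ρ Θ hx hX A = compile-correct φ _ _ _ _ _
    (trans (map-suc A M ex) hx) (cong (A ∷_) (trans (map-suc A M eX) hX))

  element : ∀ {m n} {M : Vec (Subset N) n} {ex : Vec (Fin n) m} {ρ : Vec (Universe 𝔄) m} →
            Vec.map (lookup M) ex ≡ Vec.map ⁅_⁆ ρ → ∀ x → lookup M (lookup ex x) ≡ ⁅ lookup ρ x ⁆
  element {M = M} {ex} {ρ} hx x = trans (sym (lookup-map x (lookup M) ex))
    (trans (cong (λ v → lookup v x) hx) (lookup-map x ⁅_⁆ ρ))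

  meet-elements : ∀ {x y : Universe 𝔄} {S T} → S ≡ ⁅ x ⁆ → T ≡ ⁅ y ⁆ → (∃[ z ] z ∈ S × z ∈ T) ⇔ x ≡ y
  meet-elements refl refl = mk⇔
    (λ (z , z∈x , z∈y) → trans (sym (x∈⁅y⁆⇒x≡y _ z∈x)) (x∈⁅y⁆⇒x≡y _ z∈y)) λ { refl → _ , x∈⁅x⁆ _ , x∈⁅x⁆ _ }

  compile-correct (rel zero (x ∷ y ∷ [])) ex eX M ρ Θ hx hX =
    ⇔-sym (T-does (lookup ρ x ≼? lookup ρ y)) ⇔-∘
    (((meet-elements (element {M = M} {ex} hx x) (element {M = M} {ex} hx y) ⇔-∘ accepts-meet M _ _) ⊎-⇔
     (mk⇔
      (λ (u , v , u<v , u∈ , v∈) → subst₂ (Before (elements forest))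
        (x∈⁅y⁆⇒x≡y _ (subst (u ∈_) (element {M = M} {ex} hx x) u∈))
        (x∈⁅y⁆⇒x≡y _ (subst (v ∈_) (element {M = M} {ex} hx y) v∈)) u<v)
      (λ x<y → _ , _ , x<y , subst (_ ∈_) (sym (element {M = M} {ex} hx x)) (x∈⁅x⁆ _) ,
                             subst (_ ∈_) (sym (element {M = M} {ex} hx y)) (x∈⁅x⁆ _))
      ⇔-∘ accepts-precedes M _ _ forest)) ⇔-∘ accepts-∨ M (meet (lookup ex x) (lookup ex y)) (precedesᴿ (lookup ex x) (lookup ex y)) forest)
  compile-correct (rel (suc R) xs) ex eX M ρ Θ hx hX =
    accepts-tuple M R (Vec.map (lookup ex) xs) (Vec.map (lookup ρ) xs) λ i →
      trans (cong (lookup M) (lookup-map i (lookup ex) xs)) (trans (element {M = M} {ex} hx (lookup xs i))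
        (cong ⁅_⁆ (sym (lookup-map i (lookup ρ) xs))))
  compile-correct (x ≐ y) ex eX M ρ Θ hx hX =
    meet-elements (element {M = M} {ex} hx x) (element {M = M} {ex} hx y) ⇔-∘ accepts-meet M _ _
  compile-correct (x ∈′ X) ex eX M ρ Θ hx refl = mk⇔
    (λ (z , z∈x , z∈X) → subst₂ _∈_ (x∈⁅y⁆⇒x≡y _ (subst (z ∈_) (element {M = M} {ex} hx x) z∈x))
                                     (sym (lookup-map X (lookup M) eX)) z∈X)
    (λ x∈X → _ , subst (_ ∈_) (sym (element {M = M} {ex} hx x)) (x∈⁅x⁆ _) ,
                 subst (_ ∈_) (lookup-map X (lookup M) eX) x∈X)
    ⇔-∘ accepts-meet M _ _
  compile-correct (¬′ φ) ex eX M ρ Θ hx hX =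
    let IH = compile-correct φ ex eX M ρ Θ hx hX in
    mk⇔ (_∘ from IH) (_∘ to IH) ⇔-∘ accepts-complement M (compile ex eX φ) forest
  compile-correct (φ ∧′ ψ) ex eX M ρ Θ hx hX =
    (compile-correct φ ex eX M ρ Θ hx hX ×-⇔ compile-correct ψ ex eX M ρ Θ hx hX) ⇔-∘ accepts-∧ M (compile ex eX φ) (compile ex eX ψ) forest
  compile-correct (φ ∨′ ψ) ex eX M ρ Θ hx hX =
    (compile-correct φ ex eX M ρ Θ hx hX ⊎-⇔ compile-correct ψ ex eX M ρ Θ hx hX) ⇔-∘ accepts-∨ M (compile ex eX φ) (compile ex eX ψ) forest
  compile-correct (∃₁ φ) ex eX M ρ Θ hx hX = mk⇔
    (λ (A , acc) → let (sing , accφ) = to (accepts-∧ (A ∷ M) (singleton zero) ψ forest) acc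
                       (a , A≡) = to (accepts-singleton (A ∷ M) zero) sing in
      a , to (compile-∃₁ φ ex eX M ρ Θ hx hX a) (subst (λ A → T (accepts ψ (A ∷ M) forest)) A≡ accφ))
    (λ (a , sat) → ⁅ a ⁆ , from (accepts-∧ (⁅ a ⁆ ∷ M) (singleton zero) ψ forest)
      (from (accepts-singleton (⁅ a ⁆ ∷ M) zero) (a , refl) , from (compile-∃₁ φ ex eX M ρ Θ hx hX a) sat))
    ⇔-∘ accepts-project (combineᴿ _∧_ (singleton zero) ψ) M forest unique
    where ψ = compile (zero ∷ Vec.map suc ex) (Vec.map suc eX) φ
  compile-correct (∀₁ φ) ex eX M ρ Θ hx hX = mk⇔
    -- Acceptance is a Boolean, so the double negation that comes from treating ∀ as the dual of ∃
    -- is removed constructively.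
    (λ ¬∃ a → to (compile-∃₁ φ ex eX M ρ Θ hx hX a) (decidable-stable (T? _) λ ¬acc →
      ¬∃ (⁅ a ⁆ , from (accepts-∧¬ (⁅ a ⁆ ∷ M) (singleton zero) ψ forest)
        (from (accepts-singleton (⁅ a ⁆ ∷ M) zero) (a , refl) , ¬acc))))
    (λ sat (A , acc) → let (sing , ¬accφ) = to (accepts-∧¬ (A ∷ M) (singleton zero) ψ forest) acc
                           (a , A≡) = to (accepts-singleton (A ∷ M) zero) sing in
      ¬accφ (subst (λ A → T (accepts ψ (A ∷ M) forest)) (sym A≡) (from (compile-∃₁ φ ex eX M ρ Θ hx hX a) (sat a))))
    ⇔-∘ (mk⇔ (_∘ from P) (_∘ to P) ⇔-∘ accepts-complement M (project (combineᴿ (λ s h → s ∧ not h) (singleton zero) ψ)) forest)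
    where
    ψ = compile (zero ∷ Vec.map suc ex) (Vec.map suc eX) φ
    P = accepts-project (combineᴿ (λ s h → s ∧ not h) (singleton zero) ψ) M forest unique
  compile-correct (∃₂ φ) ex eX M ρ Θ hx hX = mk⇔
    (λ (A , acc) → A , to (compile-∃₂ φ ex eX M ρ Θ hx hX A) acc)
    (λ (A , sat) → A , from (compile-∃₂ φ ex eX M ρ Θ hx hX A) sat)
    ⇔-∘ accepts-project (compile (Vec.map suc ex) (zero ∷ Vec.map suc eX) φ) M forest unique
  compile-correct (∀₂ φ) ex eX M ρ Θ hx hX = mk⇔
    (λ ¬∃ A → to (compile-∃₂ φ ex eX M ρ Θ hx hX A) (decidable-stable (T? _) λ ¬acc →
      ¬∃ (A , from (accepts-complement (A ∷ M) ψ forest) ¬acc)))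
    (λ sat (A , acc) → to (accepts-complement (A ∷ M) ψ forest) acc (from (compile-∃₂ φ ex eX M ρ Θ hx hX A) (sat A)))
    ⇔-∘ (mk⇔ (_∘ from P) (_∘ to P) ⇔-∘ accepts-complement M (project (complement ψ)) forest)
    where
    ψ = compile (Vec.map suc ex) (zero ∷ Vec.map suc eX) φ
    P = accepts-project (complement ψ) M forest unique

rank-mono : ∀ {k l} → k ≤ l → rank k ≤ rank l
rank-mono {zero} {l} z≤n       = 1≤rank l
rank-mono (s≤s k≤l) = s≤s (s≤s (rank-mono k≤l))

-- The canonical value

module Canonical (σ : Signature) (d : ℕ) (ℛ : Recognition.Recognizer σ 0) where

  open Recognition σ
  open Recognizer ℛ
  open GraphDefinability σ d
  open CountingDefinability σ (DepthAtMost d)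
  module ℜ (M : Model) = Runs (structure M)

  -- All that `step` reads of a tree when there are no marks; trees of the same type can replace
  -- each other among siblings.
  TreeType : ℕ → Set
  TreeType j = Diagram (suc j) × State (suc j)

  TreeType-finite : ∀ j → Finite (TreeType j)
  TreeType-finite j = ×-finite (Vec-finite Bool-finite _) (finite (suc j))

  #types #states : ℕ → ℕ
  #types j = size (TreeType-finite j)
  #states j = size (finite j)

  treeType : ∀ {j} → Fin (#types j) → TreeType j
  treeType {j} = decode (TreeType-finite j)

  addTree : ∀ {j} → Fin (#types j) → State j → State j
  addTree t s = let (Δ , c) = treeType t in step Δ [] c s

  -- (μ , t) is the kind of the components with exactly 1 + μ roots of type t, and no root of a
  -- smaller type.
  Kind : ℕ → ℕ → Set
  Kind b j = Fin b × Fin (#types j)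

  kinds : ∀ b j → List (Kind b j)
  kinds b j = cartesianProduct (allFin b) (allFin (#types j))

  -- Iterating `addTree t` on the states is periodic at the latest from iterate `#states j` on, with
  -- a period dividing the factorial. Both numbers are multiplied by `suc μ`, since roots are
  -- counted and each component of the kind has `suc μ` of them.
  threshold period : ℕ → ℕ → ℕ
  threshold μ j = suc μ * #states j
  period    μ j = #states j ! * suc μ

  period≢0 : ∀ μ j → NonZero (period μ j)
  period≢0 μ j = m*n≢0 (#states j !) (suc μ) {{#states j !≢0}}

  -- Adds the components of kind (μ , t), when their roots of type t are c in number.
  advance : ∀ {b j} → Kind b j → State j → ℕ → State j
  advance {j = j} (μ , t) s c =
    let c′ = representative (threshold (toℕ μ) j) (period (toℕ μ) j) {{period≢0 (toℕ μ) j}} c in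
    fold s (addTree t) (c′ / suc (toℕ μ))

  module _ (M : Model) where

    open 𝔾 M
    private U = ∣ M ∣ᴹ

    -- The part of the structure that a forest below the path `rs` has to cover; the nearest
    -- ancestor is the head of the path.
    Scope : ∀ {j} → Vec U j → U → Set
    Scope []       z = Unit
    Scope (r ∷ rs) z = Reach (removed rs) r z × z ≢ r

    scope? : ∀ {j} (rs : Vec U j) z → Dec (Scope rs z)
    scope? []       z = yes tt
    scope? (r ∷ rs) z = reach? (removed rs) r z ×-dec ¬? (z Fin.≟ r)

    module _ (k : ℕ) {j} (children : Vec U (suc j) → State (suc j)) (rs : Vec U j) where

      HasType : Fin (#types j) → U → Set
      HasType t z = ℜ.diagram M (z ∷ rs) ≡ proj₁ (treeType t) × children (z ∷ rs) ≡ proj₂ (treeType t)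

      TypedRoot : Fin (#types j) → U → Set
      TypedRoot t z = IsRoot k (removed rs) z × HasType t z

      Peer : Fin (#types j) → U → U → Set
      Peer t z z′ = Reach (removed rs) z z′ × TypedRoot t z′

      abstract
        typedRoot? : ∀ t z → Dec (TypedRoot t z)
        typedRoot? t z = isRoot? k (removed rs) z ×-dec
          _≟_ (Vec-finite Bool-finite _) (ℜ.diagram M (z ∷ rs)) (proj₁ (treeType t)) ×-dec
          _≟_ (finite (suc j)) (children (z ∷ rs)) (proj₂ (treeType t))

      peer? : ∀ t z z′ → Dec (Peer t z z′)
      peer? t z z′ = reach? (removed rs) z z′ ×-dec typedRoot? t z′

      -- For `z` in scope the count is at most `rootBound d k`, so its residue modulo one more than
      -- this bound determines it.
      HasPeers : ℕ → Fin (#types j) → U → Set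
      HasPeers μ t z = count (peer? t z) % suc (rootBound d k) ≡ μ % suc (rootBound d k)

      hasPeers? : ∀ μ t z → Dec (HasPeers μ t z)
      hasPeers? μ t z = _ ℕ.≟ _

      RootOfKind : Kind (rootBound d k) j → U → Set
      RootOfKind (μ , t) z = Scope rs z × TypedRoot t z × HasPeers (suc (toℕ μ)) t z ×
                             (∀ t′ → t′ Fin.< t → HasPeers 0 t′ z)

      abstract
        rootOfKind? : ∀ e z → Dec (RootOfKind e z)
        rootOfKind? (μ , t) z = scope? rs z ×-dec typedRoot? t z ×-dec hasPeers? (suc (toℕ μ)) t z ×-dec
          Fin.all? λ t′ → t′ Fin.<? t →-dec hasPeers? 0 t′ z

      addKind : State j → Kind (rootBound d k) j → State j
      addKind s e = advance e s (count (rootOfKind? e))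

    -- The state of ℛ on a canonical elimination forest of height at most k of Scope rs.
    value : ∀ (k : ℕ) {j} → Vec U j → State j
    value zero    {j} rs = empty j
    value (suc k) {j} rs = foldl (addKind (suc k) (value k) rs) (empty j) (kinds (rootBound d (suc k)) j)

  private
    swap : ∀ {A : Set} {j} → Vec A (suc (suc j)) → Vec A (suc (suc j))
    swap (x ∷ y ∷ xs) = y ∷ x ∷ xs

    swap-map : ∀ {A B : Set} {j} (g : A → B) (xs : Vec A (suc (suc j))) → Vec.map g (swap xs) ≡ swap (Vec.map g xs)
    swap-map g (x ∷ y ∷ xs) = refl

  Scopeᴿ : ∀ {j} → Relation (suc j)
  Scopeᴿ M (z ∷ rs) = Scope M rs z

  scopeᵈ : ∀ {j} → Definable 1 (suc j) Scopeᴿ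
  scopeᵈ {zero}  = convert (λ { M (z ∷ []) → ⇔-id _ }) trueᵈ
  scopeᵈ {suc j} = convert (λ { M (z ∷ r ∷ rs) → ⇔-id _ }) (reindex swap swap-map reachᵈ ∧ᵈ ¬ᵈ eqᵈ zero (suc zero))

  IsRootᴿ : ℕ → ∀ {j} → Relation (suc j)
  IsRootᴿ k M (r ∷ rs) = 𝔾.IsRoot M k (removed rs) r

  -- Only `κ ≤ k` occur, so the clause against depth `κ` stays within `rank k`, and the one
  -- additional alternation is that of `rootᵈ`.
  isRootᵈ : ∀ k {j} → Definable (suc (rank k)) (suc j) (IsRootᴿ (suc k))
  isRootᵈ k = convert (λ { M (r ∷ rs) → ⇔-id _ }) (∃ᶠ λ κ →
    let κ≤k = rank-mono (ℕ.s≤s⁻¹ (Fin.toℕ<n κ)) in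
    ¬ᵈ weaken (≤-trans κ≤k (n≤1+n _)) (depthᵈ (toℕ κ)) ∧ᵈ weaken (s≤s κ≤k) (rootᵈ (toℕ κ)))

  diagramᵈ : ∀ {j} (Δ : Diagram j) → Definable 0 j (λ M p → ℜ.diagram M p ≡ Δ)
  diagramᵈ {j} Δ = matches (Vec.fromList (atoms j)) Δ
    where
    matches : ∀ {a} (αs : Vec (Atom j) a) (Δ : Vec Bool a) →
              Definable 0 j (λ M p → Vec.map (ℜ.holds M p) αs ≡ Δ)
    matches []             []          = convert (λ _ _ → mk⇔ (λ _ → refl) _) trueᵈ
    matches ((R , s) ∷ αs) (true  ∷ Δ) = convert
      (λ M p → mk⇔ (λ (h , hs) → cong₂ _∷_ (to T-≡ h) hs) (λ Δ≡ → from T-≡ (cong head Δ≡) , cong Vec.tail Δ≡))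
      (relᵈ R s ∧ᵈ matches αs Δ)
    matches ((R , s) ∷ αs) (false ∷ Δ) = convert
      (λ M p → mk⇔ (λ (h , hs) → cong₂ _∷_ (to T-not-≡ (from T-not h)) hs)
                    (λ Δ≡ → to T-not (from T-not-≡ (cong head Δ≡)) , cong Vec.tail Δ≡))
      (¬ᵈ relᵈ R s ∧ᵈ matches αs Δ)

  module _ (k : ℕ) {j} (valueᵈ : ∀ τ → Definable (rank k) (suc j) (λ M rs → value M k rs ≡ τ)) where

    TypedRootᴿ : Fin (#types j) → Relation (suc j)
    TypedRootᴿ t M (z ∷ rs) = TypedRoot M (suc k) (value M k) rs t z

    typedRootᵈ : ∀ t → Definable (suc (rank k)) (suc j) (TypedRootᴿ t)
    typedRootᵈ t = convert (λ { M (z ∷ rs) → ⇔-id _ }) (isRootᵈ k ∧ᵈ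
      weaken z≤n (diagramᵈ (proj₁ (treeType t))) ∧ᵈ weaken (n≤1+n _) (valueᵈ (proj₂ (treeType t))))

    Peerᴿ : Fin (#types j) → Relation (suc (suc j))
    Peerᴿ t M (z′ ∷ z ∷ rs) = Peer M (suc k) (value M k) rs t z z′

    peer?ᴿ : ∀ t M as a → Dec (Peerᴿ t M (a ∷ as))
    peer?ᴿ t M (z ∷ rs) z′ = peer? M (suc k) (value M k) rs t z z′

    peerᵈ : ∀ t → Definable (suc (rank k)) (suc (suc j)) (Peerᴿ t)
    peerᵈ t = convert (λ { M (z′ ∷ z ∷ rs) → ⇔-id _ })
      (weaken (s≤s z≤n) (reindex swap swap-map reachᵈ) ∧ᵈ reindex dropSecond dropSecond-map (typedRootᵈ t))

    HasPeersᴿ : ℕ → Fin (#types j) → Relation (suc j)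
    HasPeersᴿ μ t M (z ∷ rs) = HasPeers M (suc k) (value M k) rs μ t z

    hasPeersᵈ : ∀ μ t → Definable (suc (rank k)) (suc j) (HasPeersᴿ μ t)
    hasPeersᵈ μ t = convert (λ { M (z ∷ rs) → ⇔-id _ })
      (modᵈ μ (suc (rootBound d (suc k))) (peerᵈ t) (peer?ᴿ t))

    RootOfKindᴿ : Kind (rootBound d (suc k)) j → Relation (suc j)
    RootOfKindᴿ e M (z ∷ rs) = RootOfKind M (suc k) (value M k) rs e z

    rootOfKindᵈ : ∀ e → Definable (suc (rank k)) (suc j) (RootOfKindᴿ e)
    rootOfKindᵈ (μ , t) = convert (λ { M (z ∷ rs) → ⇔-id _ })
      (weaken (s≤s z≤n) scopeᵈ ∧ᵈ typedRootᵈ t ∧ᵈ hasPeersᵈ (suc (toℕ μ)) t ∧ᵈ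
       ∀ᶠ λ t′ → implᵈ (λ _ _ → t′ Fin.<? t) (constᵈ (t′ Fin.<? t)) (hasPeersᵈ 0 t′))

    -- The running state is known outside the formula: each count branches into its finitely many
    -- representatives, and every branch continues with its own state. Thus all kinds are counted at
    -- the same level.
    addKindsᵈ : ∀ es s τ → Definable (rank (suc k)) j (λ M rs → foldl (addKind M (suc k) (value M k) rs) s es ≡ τ)
    addKindsᵈ []       s τ = constᵈ (_≟_ (finite j) s τ)
    addKindsᵈ ((μ , t) ∷ es) s τ =
      countᵈ (threshold (toℕ μ) j) (period (toℕ μ) j) {{period≢0 (toℕ μ) j}}
        {Q = λ c M rs → foldl (addKind M (suc k) (value M k) rs) (fold s (addTree t) (c / suc (toℕ μ))) es ≡ τ}
        (rootOfKindᵈ (μ , t)) (λ M rs → rootOfKind? M (suc k) (value M k) rs (μ , t))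
        (λ c → addKindsᵈ es (fold s (addTree t) (c / suc (toℕ μ))) τ)

  valueᵈ : ∀ k {j} τ → Definable (rank k) j (λ M rs → value M k rs ≡ τ)
  valueᵈ zero    {j} τ = constᵈ (_≟_ (finite j) (empty j) τ)
  valueᵈ (suc k) {j} τ = addKindsᵈ k (valueᵈ k) (kinds (rootBound d (suc k)) j) (empty j) τ

-- Counting classes of equal size, and iteration on finite sets

least : ∀ {n} {P : Fin n → Set} → (∀ i → Dec (P i)) → ∃ P → ∃[ i ] P i × (∀ j → j Fin.< i → ¬ P j)
least {suc n} P? (i , p) with P? zero | i | p
... | yes p₀ | _ | _ = zero , p₀ , λ _ ()
... | no ¬p₀ | zero  | p = contradiction p ¬p₀
... | no ¬p₀ | suc i | p with j , q , min ← least (P? ∘ suc) (i , p) =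
  suc j , q , λ { zero _ → ¬p₀ ; (suc j′) (s≤s j′<j) → min j′ j′<j }

count-split : ∀ {n} {P Q : Fin n → Set} (P? : ∀ x → Dec (P x)) (Q? : ∀ x → Dec (Q x)) →
              count P? ≡ count (λ x → P? x ×-dec Q? x) + count (λ x → P? x ×-dec ¬? (Q? x))
count-split {zero}  P? Q? = refl
count-split {suc n} P? Q? with does (P? zero) | does (Q? zero) | count-split (P? ∘ suc) (Q? ∘ suc)
... | false | _     | eqn = eqn
... | true  | true  | eqn = cong suc eqn
... | true  | false | eqn = trans (cong suc eqn) (sym (+-suc _ _))

count-cong : ∀ {n} {P Q : Fin n → Set} (P? : ∀ x → Dec (P x)) (Q? : ∀ x → Dec (Q x)) →
             (∀ x → P x ⇔ Q x) → count P? ≡ count Q?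
count-cong P? Q? P⇔Q = cong ∣_∣ (comprehension-cong P? Q? P⇔Q)

module _ {n} {R : Fin n → Fin n → Set} (R? : ∀ x y → Dec (R x y))
         (R-refl : ∀ {x} → R x x) (R-sym : ∀ {x y} → R x y → R y x)
         (R-trans : ∀ {x y z} → R x y → R y z → R x z) (s : ℕ) where

  private
    count≡0 : ∀ {P : Fin n → Set} (P? : ∀ x → Dec (P x)) → count P? ≡ 0 → ∀ x → ¬ P x
    count≡0 P? c≡0 x p with () ← trans (sym c≡0) (count-without P? p)

    -- Choose an element, drop its class, and repeat: each round removes exactly `s` elements. The
    -- fuel suffices because a class contains the chosen element, which makes `s` positive.
    representatives-fuel : ∀ m {P : Fin n → Set} (P? : ∀ x → Dec (P x)) → count P? ≤ m →
      (∀ z → P z → count (λ x → P? x ×-dec R? z x) ≡ s) →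
      ∃[ zs ] All P zs × AllPairs (λ x y → ¬ R x y) zs ×
              (∀ x → P x → ∃[ z ] z ∈ˡ zs × R z x) × count P? ≡ length zs * s
    representatives-fuel m P? c≤m size with count P? in c
    ... | zero = [] , [] , [] , (λ x p → contradiction p (count≡0 P? c x)) , refl
    representatives-fuel (suc m) {P} P? c≤m size | suc c′
      with z , Pz ← count>0⇒∃ P? (subst (0 <_) (sym c) (s≤s z≤n)) =
      z ∷ zs , Pz ∷ All.map proj₁ Pzs , All.map proj₂ Pzs ∷ disjoint , total , sym (trans (sym total-count) c)
      where
      Q? : ∀ x → Dec (P x × ¬ R z x)
      Q? x = P? x ×-dec ¬? (R? z x)
      split : count P? ≡ s + count Q?
      split = trans (count-split P? (R? z)) (cong (_+ count Q?) (size z Pz))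
      0<s : 0 < s
      0<s = subst (0 <_) (trans (sym (count-without (λ x → P? x ×-dec R? z x) (Pz , R-refl))) (size z Pz)) (s≤s z≤n)
      fewer : count Q? ≤ m
      fewer = s≤s⁻¹ (≤-trans (≤-trans (+-monoˡ-≤ (count Q?) 0<s) (≤-reflexive (trans (sym split) c))) c≤m)
      rest = representatives-fuel m Q? fewer λ x (Px , ¬zx) → trans
        (count-cong (λ y → Q? y ×-dec R? x y) (λ y → P? y ×-dec R? x y) λ y → mk⇔
          (λ ((Py , _) , xy) → Py , xy) (λ (Py , xy) → (Py , λ zy → ¬zx (R-trans zy (R-sym xy))) , xy))
        (size x Px)
      zs = proj₁ rest
      Pzs = proj₁ (proj₂ rest)
      disjoint = proj₁ (proj₂ (proj₂ rest))
      total : ∀ x → P x → ∃[ y ] y ∈ˡ z ∷ zs × R y x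
      total x Px with R? z x
      ... | yes zx = z , here refl , zx
      ... | no ¬zx with y , y∈ , yx ← proj₁ (proj₂ (proj₂ (proj₂ rest))) x (Px , ¬zx) = y , there y∈ , yx
      total-count : count P? ≡ s + length zs * s
      total-count = trans split (cong (s +_) (proj₂ (proj₂ (proj₂ (proj₂ rest)))))

  -- Applied to the roots of a kind, this yields one root per component and shows that dividing the
  -- number of roots by `s` gives the number of components.
  representatives : ∀ {P : Fin n → Set} (P? : ∀ x → Dec (P x)) →
    (∀ z → P z → count (λ x → P? x ×-dec R? z x) ≡ s) →
    ∃[ zs ] All P zs × AllPairs (λ x y → ¬ R x y) zs ×
            (∀ x → P x → ∃[ z ] z ∈ˡ zs × R z x) × count P? ≡ length zs * s
  representatives P? = representatives-fuel (count P?) P? ≤-refl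

module _ {A : Set} (A-finite : Finite A) (g : A → A) (s : A) where

  private
    N : ℕ
    N = size A-finite

    -- Two of the first `N + 1` iterates coincide by pigeonhole. Their distance is a period from the
    -- earlier of them on, hence from `N` on.
    cycle : ∃[ q ] NonZero q × q ≤ N × (∀ m → N ≤ m → fold s g (q + m) ≡ fold s g m)
    cycle with i , j , i<j , same ← Fin.pigeonhole (n<1+n N) (λ i → encode A-finite (fold s g (toℕ i))) =
      toℕ j ∸ toℕ i , >-nonZero (m<n⇒0<n∸m i<j) , ≤-trans (m∸n≤m (toℕ j) (toℕ i)) j≤N ,
      λ m N≤m → let k = m ∸ toℕ i
                    m≡ = m∸n+n≡m (≤-trans (<⇒≤ (<-≤-trans i<j j≤N)) N≤m) in
        begin
          fold s g (q + m)              ≡⟨ cong (fold s g ∘ (q +_)) m≡ ⟨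
          fold s g (q + (k + toℕ i))    ≡⟨ cong (fold s g) (+-comm-assoc q k (toℕ i)) ⟩
          fold s g (k + (q + toℕ i))    ≡⟨ cong (λ l → fold s g (k + l)) (m∸n+n≡m (<⇒≤ i<j)) ⟩
          fold s g (k + toℕ j)          ≡⟨ fold-+ s g k ⟩
          fold (fold s g (toℕ j)) g k   ≡⟨ cong (λ a → fold a g k) (encode-injective A-finite same) ⟨
          fold (fold s g (toℕ i)) g k   ≡⟨ fold-+ s g k ⟨
          fold s g (k + toℕ i)          ≡⟨ cong (fold s g) m≡ ⟩
          fold s g m                    ∎
      where
      open ≡-Reasoning
      q = toℕ j ∸ toℕ i
      j≤N : toℕ j ≤ N
      j≤N = s≤s⁻¹ (Fin.toℕ<n j)
      +-comm-assoc : ∀ a b c → a + (b + c) ≡ b + (a + c)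
      +-comm-assoc a b c = trans (sym (+-assoc a b c)) (trans (cong (_+ c) (+-comm a b)) (+-assoc b a c))

    divisor : ∀ q → q ≤ N → .{{NonZero q}} → q ∣ N !
    divisor (suc q) q≤N = ∣-trans (m∣m*n (q !)) (m≤n⇒m!∣n! q≤N)

    -- The period that is found depends on `g` and `s`, but a formula has to fix one beforehand;
    -- `N !` is a multiple of every number from 1 to `N`.
    fold-multiple : ∀ c m → N ≤ m → fold s g (c * N ! + m) ≡ fold s g m
    fold-multiple c m N≤m with q , q≢0 , q≤N , shift ← cycle
      with divides k N!≡kq ← divisor q q≤N {{q≢0}} =
      trans (cong (λ x → fold s g (x + m)) (trans (cong (c *_) N!≡kq) (sym (*-assoc c k q)))) (go (c * k))
      where
      go : ∀ x → fold s g (x * q + m) ≡ fold s g m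
      go zero    = refl
      go (suc x) = trans (cong (fold s g) (+-assoc q (x * q) m))
                         (trans (shift (x * q + m) (≤-trans N≤m (m≤n+m m (x * q)))) (go x))

  -- Raising `l` by the multiple of `N !` contained in `m`, and `m` by that contained in `l`, leads
  -- to the same index when the residues agree.
  fold-periodic : ∀ l m .{{_ : NonZero (N !)}} → N ≤ l → N ≤ m → l % N ! ≡ m % N ! → fold s g l ≡ fold s g m
  fold-periodic l m N≤l N≤m l≡m = begin
    fold s g l                          ≡⟨ fold-multiple (m / N !) l N≤l ⟨
    fold s g (m / N ! * N ! + l)        ≡⟨ cong (fold s g) common ⟩
    fold s g (l / N ! * N ! + m)        ≡⟨ fold-multiple (l / N !) m N≤m ⟩
    fold s g m                          ∎
    where
    open ≡-Reasoning
    a b : ℕ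
    a = l / N ! * N !
    b = m / N ! * N !
    common : b + l ≡ a + m
    common = begin
      b + l                 ≡⟨ cong (b +_) (m≡m%n+[m/n]*n l (N !)) ⟩
      b + (l % N ! + a)     ≡⟨ cong (λ r → b + (r + a)) l≡m ⟩
      b + (m % N ! + a)     ≡⟨ +-assoc b (m % N !) a ⟨
      (b + m % N !) + a     ≡⟨ +-comm (b + m % N !) a ⟩
      a + (b + m % N !)     ≡⟨ cong (a +_) (+-comm b (m % N !)) ⟩
      a + (m % N ! + b)     ≡⟨ cong (a +_) (m≡m%n+[m/n]*n m (N !)) ⟨
      a + m                 ∎

  -- The dividend modulo `N ! * suc μ` determines the quotient by `suc μ` modulo `N !`. From the
  -- threshold on, both quotients are at least `N`, where the iterates are periodic.
  fold-representative : ∀ μ c {{_ : NonZero (N ! * suc μ)}} →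
    fold s g (representative (suc μ * N) (N ! * suc μ) c / suc μ) ≡ fold s g (c / suc μ)
  fold-representative μ c with c <? suc μ * N
  ... | yes _ = refl
  ... | no c≮θ = fold-periodic (r / suc μ) (c / suc μ) N≤r/μ N≤c/μ
      (trans (cong (_% N !) r/μ≡) (trans ([m+kn]%n≡m%n′ (c / suc μ % N !) (suc μ * N)) (m%n%n≡m%n (c / suc μ) (N !))))
    where
    instance
      _ : NonZero (N !)
      _ = N !≢0
    r : ℕ
    r = suc μ * N * (N ! * suc μ) + c % (N ! * suc μ)
    r/μ≡ : r / suc μ ≡ suc μ * N * N ! + c / suc μ % N !
    r/μ≡ = trans (+-distrib-/-∣ˡ (c % (N ! * suc μ)) (∣-trans (n∣m*n (N !)) (n∣m*n (suc μ * N))))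
      (cong₂ _+_ (trans (cong (_/ suc μ) (sym (*-assoc (suc μ * N) (N !) (suc μ)))) (m*n/n≡m (suc μ * N * N !) (suc μ)))
                 (m%[n*o]/o≡m/o%n c (N !) (suc μ)))
    [m+kn]%n≡m%n′ : ∀ m k → (k * N ! + m) % N ! ≡ m % N !
    [m+kn]%n≡m%n′ m k = trans (cong (_% N !) (+-comm (k * N !) m)) ([m+kn]%n≡m%n m k (N !))
    N≤c/μ : N ≤ c / suc μ
    N≤c/μ = subst (_≤ c / suc μ) (trans (cong (_/ suc μ) (*-comm (suc μ) N)) (m*n/n≡m N (suc μ)))
              (/-monoˡ-≤ (suc μ) (≮⇒≥ c≮θ))
    N≤r/μ : N ≤ r / suc μ
    N≤r/μ = subst (N ≤_) (sym r/μ≡) (≤-trans (≤-trans (m≤m+n N (μ * N)) (m≤m*n (suc μ * N) (N !))) (m≤m+n _ _))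

-- A forest that attains the canonical value

present-or-removed : ∀ {n j} (rs : Vec (Fin n) j) x → (∃[ m ] x ≡ lookup rs m) ⊎ x ∈ removed rs
present-or-removed rs x with Fin.any? (λ m → x Fin.≟ lookup rs m)
... | yes x∈rs = inj₁ x∈rs
... | no x∉rs = inj₂ (to (∈-removed {rs = rs}) λ m x≡ → x∉rs (m , x≡))

module CanonicalForest (σ : Signature) (d : ℕ) (ℛ : Recognition.Recognizer σ 0)
  (M : Definability.Model σ (DepthAtMost d)) where

  open Recognition σ
  open Recognizer ℛ
  open GraphDefinability σ d
  open Canonical σ d ℛ
  open 𝔾 M
  open Runs (structure M)
  open SimpleGraph (gaifman (structure M)) using (Adj)

  private
    U : Set
    U = ∣ M ∣ᴹ

  -- Equality is allowed because a tuple may repeat an entry.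
  Clique : ∀ {a} → Vec U a → Set
  Clique xs = ∀ i i′ → lookup xs i ≡ lookup xs i′ ⊎ Adj (lookup xs i) (lookup xs i′)

  -- F is an elimination forest for the part P of the structure, below the path rs.
  record Eliminates {j} (rs : Vec U j) (P : U → Set) (F : Forest U) : Set where
    field
      unique : Unique (elements F)
      covers : ∀ x → x ∈ˡ elements F ⇔ P x
      chains : ∀ {a} (xs : Vec U a) → Clique xs → ∀ z → P z →
               (∀ i → (∃[ m ] lookup xs i ≡ lookup rs m) ⊎ Reach (removed rs) z (lookup xs i)) →
               ∃[ i ] Σ (Vec U (suc i)) λ q → NodeAt F rs q × (∀ i → ∃[ m ] lookup xs i ≡ lookup q m)

  open Eliminates

  eliminates-cong : ∀ {j} {rs : Vec U j} {P Q F} → (∀ x → P x ⇔ Q x) → Eliminates rs P F → Eliminates rs Q F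
  eliminates-cong P⇔Q E .unique = unique E
  eliminates-cong P⇔Q E .covers x = P⇔Q x ⇔-∘ covers E x
  eliminates-cong P⇔Q E .chains xs clique z Qz = chains E xs clique z (from (P⇔Q z) Qz)

  eliminates-[] : ∀ {j} {rs : Vec U j} → Eliminates rs (λ _ → ⊥) []
  eliminates-[] .unique = []
  eliminates-[] .covers x = mk⇔ (λ ()) λ ()
  eliminates-[] .chains xs clique z ()

  -- For a clique in the component of `z`: if all entries are on the path `z ∷ rs`, the node `z`
  -- itself shows them. Otherwise some entry is off this path, and every other entry off the path is
  -- equal or adjacent to it, so these entries share one component below `z` and `chains` of `c`
  -- applies.
  eliminates-node : ∀ {j} {rs : Vec U j} {P z c f} → Eliminates (z ∷ rs) (Scope M (z ∷ rs)) c → Eliminates rs P f →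
                    (∀ x → P x → ¬ Reach (removed rs) z x) →
                    Eliminates rs (λ x → Reach (removed rs) z x ⊎ P x) (node z c f)
  eliminates-node {rs = rs} {P} {z} {c} {f} C E disjoint = record { unique = uniq ; covers = cov ; chains = chn }
    where
    uniq : Unique (z ∷ elements c ++ elements f)
    uniq = All.tabulate (λ {x} x∈ z≡x → [ (λ x∈c → proj₂ (to (covers C x) x∈c) (sym z≡x)) ,
                          (λ x∈f → disjoint x (to (covers E x) x∈f) (subst (Reach _ z) z≡x ε)) ]′ (∈-++⁻ (elements c) x∈)) ∷
           ++⁺ (unique C) (unique E) λ {x} (x∈c , x∈f) → disjoint x (to (covers E x) x∈f) (proj₁ (to (covers C x) x∈c))
    cov : ∀ x → x ∈ˡ z ∷ elements c ++ elements f ⇔ (Reach (removed rs) z x ⊎ P x)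
    cov x = mk⇔
      (λ { (here refl) → inj₁ ε
         ; (there x∈) → Sum.map (proj₁ ∘ to (covers C x)) (to (covers E x)) (∈-++⁻ (elements c) x∈) })
      [ ⇐ , (λ Px → there (∈-++⁺ʳ (elements c) (from (covers E x) Px))) ]′
      where
      ⇐ : Reach (removed rs) z x → x ∈ˡ z ∷ elements c ++ elements f
      ⇐ z⇝x with x Fin.≟ z
      ... | yes x≡z = here x≡z
      ... | no x≢z = there (∈-++⁺ˡ (from (covers C x) (z⇝x , x≢z)))
    near-member : ∀ {a} (xs : Vec U a) → Clique xs → ∀ i → lookup xs i ∈ removed (z ∷ rs) → ∀ i′ →
                  (∃[ m ] lookup xs i′ ≡ lookup (z ∷ rs) m) ⊎ Reach (removed (z ∷ rs)) (lookup xs i) (lookup xs i′)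
    near-member xs clique i xᵢ∈ i′ with present-or-removed (z ∷ rs) (lookup xs i′)
    ... | inj₁ on = inj₁ on
    ... | inj₂ x′∈ with clique i i′
    ...   | inj₁ x≡x′ = inj₂ (subst (Reach _ _) x≡x′ ε)
    ...   | inj₂ adj  = inj₂ ((xᵢ∈ , x′∈ , adj) ◅ ε)
    chn : ∀ {a} (xs : Vec U a) → Clique xs → ∀ w → Reach (removed rs) z w ⊎ P w →
          (∀ i → (∃[ m ] lookup xs i ≡ lookup rs m) ⊎ Reach (removed rs) w (lookup xs i)) →
          ∃[ i ] Σ (Vec U (suc i)) λ q → NodeAt (node z c f) rs q × (∀ i → ∃[ m ] lookup xs i ≡ lookup q m)
    chn xs clique w (inj₂ Pw) near with i , q , at , on ← chains E xs clique w Pw near = i , q , next at , on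
    chn xs clique w (inj₁ z⇝w) near with Fin.any? (λ i → lookup xs i ∈? removed (z ∷ rs))
    ... | no none∈ = _ , z ∷ rs , top , λ i →
      [ id , (λ present → contradiction (i , present) none∈) ]′ (present-or-removed (z ∷ rs) (lookup xs i))
    ... | yes (i , xᵢ∈) with near i
    ...   | inj₁ (m , x≡) = contradiction x≡ (from (∈-removed {rs = rs}) (proj₁ (x∈p-y⁻ xᵢ∈)) m)
    ...   | inj₂ w⇝x with k , q , at , on ← chains C xs clique (lookup xs i) (z⇝w ◅◅ w⇝x , proj₂ (x∈p-y⁻ xᵢ∈))
                                               (near-member xs clique i xᵢ∈) = k , q , below at , on

  scope-reach : ∀ {j} (rs : Vec U j) {z z′} → Scope M rs z → Reach (removed rs) z z′ → Scope M rs z′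
  scope-reach []       _             _    = tt
  scope-reach (r ∷ rs) (r⇝z , z≢r) z⇝z′ = r⇝z ◅◅ reach-mono (proj₁ ∘ x∈p-y⁻) z⇝z′ , reach-≢ z⇝z′ z≢r

  scope-present : ∀ {j} (rs : Vec U j) {z} → Scope M rs z → z ∈ removed rs
  scope-present []       _           = ∈⊤
  scope-present (r ∷ rs) (r⇝z , z≢r) = x∈p∧x≢y⇒x∈p-y (source (reach-sym r⇝z) z≢r) z≢r
    where
    source : ∀ {S x y} → Reach S x y → x ≢ y → x ∈ S
    source ε                x≢y = contradiction refl x≢y
    source ((x∈ , _) ◅ _) _   = x∈

  least-depth : ∀ k {S x} → Depth≤ k S x → ∃[ κ ] κ ℕ.< k × ¬ Depth≤ κ S x × Depth≤ (suc κ) S x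
  least-depth (suc k) {S} {x} D with depth≤? k S x
  ... | no ¬D = k , ≤-refl , ¬D , D
  ... | yes D′ with κ , κ<k , rest ← least-depth k D′ = κ , ℕ.m≤n⇒m≤1+n κ<k , rest

  module _ (k : ℕ) {j} (rs : Vec U j) where

    private
      S : Subset _
      S = removed rs
      b : ℕ
      b = rootBound d (suc k)
      kind : Kind b j → U → Set
      kind = RootOfKind M (suc k) (value M k) rs
      peers : Fin (#types j) → U → ℕ
      peers t z = count (peer? M (suc k) (value M k) rs t z)

    peers≤ : ∀ t {z} → Scope M rs z → peers t z ≤ b
    peers≤ t {z} sz = count-roots≤ d (suc k) (scope-present rs sz) (depth≤d M rs z)
      (peer? M (suc k) (value M k) rs t z) λ r (z⇝r , root , _) → z⇝r , root

    hasPeers⇒≡ : ∀ {μ t z} → μ ≤ b → Scope M rs z → HasPeers M (suc k) (value M k) rs μ t z → peers t z ≡ μ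
    hasPeers⇒≡ {t = t} μ≤b sz h = trans (sym (m<n⇒m%n≡m (s≤s (peers≤ t sz)))) (trans h (m<n⇒m%n≡m (s≤s μ≤b)))

    peers-reach : ∀ t {z z′} → Reach S z z′ → peers t z ≡ peers t z′
    peers-reach t z⇝z′ = count-cong (peer? M (suc k) (value M k) rs t _) (peer? M (suc k) (value M k) rs t _) λ x → mk⇔
      (λ (z⇝x , typed) → reach-sym z⇝z′ ◅◅ z⇝x , typed) (λ (z′⇝x , typed) → z⇝z′ ◅◅ z′⇝x , typed)

    hasPeers-reach : ∀ {μ t z z′} → Reach S z z′ → HasPeers M (suc k) (value M k) rs μ t z →
                     HasPeers M (suc k) (value M k) rs μ t z′
    hasPeers-reach {t = t} z⇝z′ h = trans (cong (_% suc b) (sym (peers-reach t z⇝z′))) h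

    -- An optimal root of the component has some type, so not all peer counts vanish. The least type
    -- with a nonzero count is `t`, and this count, bounded by `peers≤`, is `suc μ`.
    kind-exists : ∀ {x} → Scope M rs x → Depth≤ (suc k) S x → ∃[ e ] ∃[ z ] kind e z × Reach S z x
    kind-exists {x} sx D
      with κ , κ<k , ¬Dκ , (r , x⇝r , root) ← least-depth (suc k) D
      with t₀ ← encode (TreeType-finite j) (diagram (r ∷ rs) , value M k (r ∷ rs)) in t₀≡
      with type ← trans (sym (decode-encode (TreeType-finite j) _)) (cong (treeType {j}) t₀≡)
      with t , 0<t , minimal ← least (λ t → 0 ℕ.<? peers t x) (t₀ , subst (0 ℕ.<_)
             (sym (count-without (peer? M (suc k) (value M k) rs t₀ x)
               (x⇝r , (fromℕ< κ<k , subst (λ κ → ¬ Depth≤ κ S r × Root≤ κ S r) (sym (Fin.toℕ-fromℕ< κ<k))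
                 ((λ D → ¬Dκ (depth≤-reach (reach-sym x⇝r) D)) , root)) , cong proj₁ type , cong proj₂ type))) (s≤s z≤n))
      with z , x⇝z , typed ← count>0⇒∃ (peer? M (suc k) (value M k) rs t x) 0<t
      with peers t x in c | peers≤ t sx
    ... | suc μ | μ<b = (fromℕ< μ<b , t) , z ,
      (scope-reach rs sx x⇝z , typed ,
       hasPeers-reach {suc (toℕ (fromℕ< μ<b))} {t} x⇝z
         (cong (_% suc b) (trans c (cong suc (sym (Fin.toℕ-fromℕ< μ<b))))) ,
       λ t′ t′<t → hasPeers-reach {0} {t′} x⇝z (cong (_% suc b) (ℕ.n≤0⇒n≡0 (ℕ.≮⇒≥ (minimal t′ t′<t))))) ,
      reach-sym x⇝z

    -- Peer counts are constant on a component, and they determine the kind: its type is the first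
    -- one with a nonzero count, its multiplicity comes from that count.
    kind-unique : ∀ {e e′ z z′} → kind e z → kind e′ z′ → Reach S z z′ → e ≡ e′
    kind-unique {μ , t} {μ′ , t′} {z} {z′} (sz , _ , n , min) (sz′ , _ , n′ , min′) z⇝z′ with Fin.<-cmp t t′
    ... | tri< t<t′ _ _ with () ← trans (sym (hasPeers⇒≡ (Fin.toℕ<n μ) sz n)) (trans (peers-reach t z⇝z′)
                                    (hasPeers⇒≡ z≤n sz′ (min′ t t<t′)))
    ... | tri> _ _ t′<t with () ← trans (sym (hasPeers⇒≡ (Fin.toℕ<n μ′) sz′ n′)) (trans (sym (peers-reach t′ z⇝z′))
                                    (hasPeers⇒≡ z≤n sz (min t′ t′<t)))
    ... | tri≈ _ refl _ = cong (_, t) (Fin.toℕ-injective (suc-injective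
            (trans (sym (hasPeers⇒≡ (Fin.toℕ<n μ) sz n)) (trans (peers-reach t z⇝z′) (hasPeers⇒≡ (Fin.toℕ<n μ′) sz′ n′)))))

    -- Scope and peer counts do not vary within a component, so there the roots of the kind are
    -- exactly the peers of `z`. Their number is what `advance` divides by.
    kind-size : ∀ e z → kind e z →
      count (λ x → rootOfKind? M (suc k) (value M k) rs e x ×-dec reach? S z x) ≡ suc (toℕ (proj₁ e))
    kind-size e@(μ , t) z (sz , typed , n , min) = trans
      (count-cong (λ x → rootOfKind? M (suc k) (value M k) rs e x ×-dec reach? S z x)
                  (peer? M (suc k) (value M k) rs t z) λ x → mk⇔
        (λ ((_ , typed , _) , z⇝x) → z⇝x , typed)
        (λ (z⇝x , typed) → (scope-reach rs sz z⇝x , typed , hasPeers-reach {suc (toℕ μ)} {t} z⇝x n ,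
                            λ t′ t′<t → hasPeers-reach {0} {t′} z⇝x (min t′ t′<t)) , z⇝x))
      (hasPeers⇒≡ (Fin.toℕ<n μ) sz n)

    module _ (childForest : ∀ z → (∀ y → Scope M (z ∷ rs) y → Depth≤ k (removed (z ∷ rs)) y) →
                            ∃[ F ] Eliminates (z ∷ rs) (Scope M (z ∷ rs)) F × run ℛ [] (z ∷ rs) F ≡ value M k (z ∷ rs))
      where

      Built : (U → Set) → State j → Set
      Built P s = ∃[ F ] Eliminates rs P F × run ℛ [] rs F ≡ s

      -- The components need not be isomorphic, but each `z` has type `t`, so with the children from
      -- `childForest` its tree acts on the state as `addTree t` does.
      addTrees : ∀ e {P s} zs → All (kind e) zs → AllPairs (λ x y → ¬ Reach S x y) zs →
                 (∀ x z → z ∈ˡ zs → P x → ¬ Reach S z x) → Built P s →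
                 Built (λ x → (∃[ z ] z ∈ˡ zs × Reach S z x) ⊎ P x) (fold s (addTree (proj₂ e)) (length zs))
      addTrees e []       _ _ _ (F , E , run≡) =
        F , eliminates-cong (λ x → mk⇔ inj₂ λ { (inj₁ (_ , () , _)) ; (inj₂ Px) → Px }) E , run≡
      addTrees e@(_ , t) {P} {s} (z ∷ zs) ((_ , ((κ , _ , root) , type) , _) ∷ kinds) (apart ∷ aparts) disjoint B =
        finish (addTrees e zs kinds aparts (λ x z z∈ → disjoint x z (there z∈)) B)
               (childForest z λ y (z⇝y , y≢z) → depth≤-mono (ℕ.s≤s⁻¹ (Fin.toℕ<n κ)) (root y z⇝y y≢z))
        where
        finish : Built (λ x → (∃[ z ] z ∈ˡ zs × Reach S z x) ⊎ P x) (fold s (addTree t) (length zs)) →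
                 ∃[ F ] Eliminates (z ∷ rs) (Scope M (z ∷ rs)) F × run ℛ [] (z ∷ rs) F ≡ value M k (z ∷ rs) →
                 Built (λ x → (∃[ w ] w ∈ˡ z ∷ zs × Reach S w x) ⊎ P x) (fold s (addTree t) (suc (length zs)))
        finish (f , E , run-f) (c , C , run-c) = node z c f ,
          eliminates-cong (λ x → mk⇔
              [ (λ z⇝x → inj₁ (z , here refl , z⇝x)) , Sum.map₁ (λ (w , w∈ , w⇝x) → w , there w∈ , w⇝x) ]′
              (λ { (inj₁ (_ , here refl , z⇝x)) → inj₁ z⇝x
                 ; (inj₁ (w , there w∈ , w⇝x)) → inj₂ (inj₁ (w , w∈ , w⇝x))
                 ; (inj₂ Px) → inj₂ (inj₂ Px) }))
            (eliminates-node C E λ x → λ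
              { (inj₁ (w , w∈ , w⇝x)) z⇝x → All.lookup apart w∈ (z⇝x ◅◅ reach-sym w⇝x)
              ; (inj₂ Px) → disjoint x z (here refl) Px }) ,
          trans (cong (λ Δ → step Δ [] (run ℛ [] (z ∷ rs) c) (run ℛ [] rs f)) (proj₁ type))
                (cong₂ (step (proj₁ (treeType t)) []) (trans run-c (proj₂ type)) run-f)

      -- One root chosen in each component leaves `c / suc μ` trees, and by `fold-representative`
      -- the passage from `c` to its representative does not alter the state.
      addKind-built : ∀ e {P} s → (∀ x z → kind e z → P x → ¬ Reach S z x) → Built P s →
                      Built (λ x → (∃[ z ] kind e z × Reach S z x) ⊎ P x) (addKind M (suc k) (value M k) rs s e)
      addKind-built e@(μ , t) {P} s disjoint B = finish (representatives (reach? S) ε reach-sym _◅◅_ (suc (toℕ μ))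
                                                           (rootOfKind? M (suc k) (value M k) rs e) (kind-size e))
        where
        c : ℕ
        c = count (rootOfKind? M (suc k) (value M k) rs e)
        finish : ∃[ zs ] All (kind e) zs × AllPairs (λ x y → ¬ Reach S x y) zs ×
                         (∀ x → kind e x → ∃[ z ] z ∈ˡ zs × Reach S z x) × c ≡ length zs * suc (toℕ μ) →
                 Built (λ x → (∃[ z ] kind e z × Reach S z x) ⊎ P x) (addKind M (suc k) (value M k) rs s e)
        finish (zs , kinds , aparts , total , c≡) =
          let (F , E , run-F) = addTrees e zs kinds aparts (λ x z z∈ → disjoint x z (All.lookup kinds z∈)) B in
          F ,
          eliminates-cong (λ x → mk⇔
            (Sum.map₁ λ (z , z∈ , z⇝x) → z , All.lookup kinds z∈ , z⇝x)
            (Sum.map₁ λ (z , kz , z⇝x) → let (w , w∈ , w⇝z) = total z kz in w , w∈ , w⇝z ◅◅ z⇝x)) E ,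
          trans run-F (trans
            (cong (fold s (addTree t)) (sym (trans (cong (_/ suc (toℕ μ)) c≡) (m*n/n≡m (length zs) (suc (toℕ μ))))))
            (sym (fold-representative (finite j) (addTree t) s (toℕ μ) c {{period≢0 (toℕ μ) j}})))

      addKinds : ∀ es → Unique es → ∀ {P s} → (∀ {e} x z → e ∈ˡ es → kind e z → P x → ¬ Reach S z x) → Built P s →
                 Built (λ x → (∃[ e ] e ∈ˡ es × (∃[ z ] kind e z × Reach S z x)) ⊎ P x)
                       (foldl (addKind M (suc k) (value M k) rs) s es)
      addKinds []       _          disjoint (F , E , run≡) =
        F , eliminates-cong (λ x → mk⇔ inj₂ λ { (inj₁ (_ , () , _)) ; (inj₂ Px) → Px }) E , run≡
      addKinds (e ∷ es) (e∉ ∷ uniq) {P} {s} disjoint B =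
        finish (addKinds es uniq disjoint′ (addKind-built e s (λ x z → disjoint x z (here refl)) B))
        where
        disjoint′ : ∀ {e′} x z → e′ ∈ˡ es → kind e′ z → (∃[ z ] kind e z × Reach S z x) ⊎ P x → ¬ Reach S z x
        disjoint′ x z e′∈ kz (inj₁ (w , kw , w⇝x)) z⇝x =
          All.lookup e∉ e′∈ (kind-unique kw kz (w⇝x ◅◅ reach-sym z⇝x))
        disjoint′ x z e′∈ kz (inj₂ Px) = disjoint x z (there e′∈) kz Px
        finish : ∀ {s} → Built (λ x → (∃[ e′ ] e′ ∈ˡ es × (∃[ z ] kind e′ z × Reach S z x)) ⊎
                                      (∃[ z ] kind e z × Reach S z x) ⊎ P x) s →
                 Built (λ x → (∃[ e′ ] e′ ∈ˡ e ∷ es × (∃[ z ] kind e′ z × Reach S z x)) ⊎ P x) s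
        finish (F , E , run≡) = F , eliminates-cong (λ x → mk⇔
              [ (λ (e′ , e′∈ , rest) → inj₁ (e′ , there e′∈ , rest)) , Sum.map₁ (λ rest → e , here refl , rest) ]′
              (λ { (inj₁ (_ , here refl , rest)) → inj₂ (inj₁ rest)
                 ; (inj₁ (e′ , there e′∈ , rest)) → inj₁ (e′ , e′∈ , rest)
                 ; (inj₂ Px) → inj₂ (inj₂ Px) })) E , run≡

  canonicalForest : ∀ k {j} (rs : Vec U j) → (∀ z → Scope M rs z → Depth≤ k (removed rs) z) →
                    ∃[ F ] Eliminates rs (Scope M rs) F × run ℛ [] rs F ≡ value M k rs
  -- Nothing has depth at most 0, so the scope is empty.
  canonicalForest zero rs D = [] , eliminates-cong (λ x → mk⇔ (λ ()) (D x)) eliminates-[] , refl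
  canonicalForest (suc k) {j} rs D = finish (addKinds k rs (λ z → canonicalForest k (z ∷ rs)) (kinds (rootBound d (suc k)) j)
      (cartesianProduct⁺ (allFin⁺ _) (allFin⁺ _)) (λ _ _ _ _ ()) ([] , eliminates-[] , refl))
    where
    scope⇔ : ∀ x → ((∃[ e ] e ∈ˡ kinds (rootBound d (suc k)) j ×
                     (∃[ z ] RootOfKind M (suc k) (value M k) rs e z × Reach (removed rs) z x)) ⊎ ⊥) ⇔ Scope M rs x
    scope⇔ x = mk⇔
      (λ { (inj₁ (_ , _ , z , (sz , _) , z⇝x)) → scope-reach rs sz z⇝x })
      (λ sx → let ((μ , t) , rest) = kind-exists k rs sx (D x sx) in
         inj₁ ((μ , t) , ∈-cartesianProduct⁺ (∈-allFin μ) (∈-allFin t) , rest))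
    finish : ∃[ F ] Eliminates rs _ F × run ℛ [] rs F ≡ value M (suc k) rs →
             ∃[ F ] Eliminates rs (Scope M rs) F × run ℛ [] rs F ≡ value M (suc k) rs
    finish (F , E , run≡) = F , eliminates-cong scope⇔ E , run≡

  eliminationForest : Σ (EliminationForest (structure M)) λ E →
                      run ℛ [] [] (EliminationForest.forest E) ≡ value M d []
  eliminationForest with F , E , run≡ ← canonicalForest d [] (λ z _ → member M z) =
    record { forest = F ; unique = unique E ; complete = λ x → from (covers E x) tt ; chain = chain } , run≡
    where
    clique : ∀ R xs → T (interp (structure M) R xs) → Clique xs
    clique R xs h i i′ with lookup xs i Fin.≟ lookup xs i′
    ... | yes x≡x′ = inj₁ x≡x′
    ... | no x≢x′  = inj₂ (x≢x′ , R , xs , h , from ∈ᵛ⇔lookup (i , refl) , from ∈ᵛ⇔lookup (i′ , refl))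
    near : ∀ {a} (xs : Vec U a) → Clique xs → ∃[ z ] ∀ i → Reach (removed {n = suc (size-1 (structure M))} []) z (lookup xs i)
    -- A tuple of arity 0 names no vertex; as the universe is nonempty, an arbitrary one is
    -- supplied.
    near []       _      = zero , λ ()
    near (x ∷ xs) clique = x , λ i → [ (λ x≡ → subst (Reach _ x) x≡ ε) , (λ adj → (∈⊤ , ∈⊤ , adj) ◅ ε) ]′ (clique zero i)
    chain : ∀ R xs → T (interp (structure M) R xs) →
            ∃[ i ] Σ (Vec U (suc i)) λ q → NodeAt F [] q × (∀ a → ∃[ m ] lookup xs a ≡ lookup q m)
    chain R xs h with z , z⇝ ← near xs (clique R xs h) = chains E xs (clique R xs h) z tt (inj₂ ∘ z⇝)

-- Assembly of the sentence

∈Fin⇒DepthAtMost : ∀ {σ d} {𝔄 : Structure σ} → 𝔄 ∈Fin d → DepthAtMost d 𝔄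
∈Fin⇒DepthAtMost {𝔄 = 𝔄} (k , td , k≤d) x = depth≤-mono k≤d (treeDepth⇒depth≤ td ∈⊤)
  where open Gaifman 𝔄

-- `rank d` is `2 * d + 1`, which stays within `3 * d` as soon as `d` is positive.
rank≤ : ∀ k → rank (suc k) ≤ 3 * suc k
rank≤ zero    = ≤-refl
rank≤ (suc k) = ≤-trans (s≤s (s≤s (rank≤ k))) (≤-trans (n≤1+n _) (≤-reflexive (sym (*-suc 3 (suc k)))))

module _ (σ : Signature) (d : ℕ) (φ : MSO-Sentence (σ ∪≤)) where

  open Recognition σ
  open GraphDefinability σ d

  private
    ℛ : Recognizer 0
    ℛ = compile [] [] φ

  open Recognizer ℛ
  open Canonical σ d ℛ

  acceptedᵈ : Definable (rank d) 0 (λ M rs → T (accept (value M d rs)))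
  acceptedᵈ = convert
    (λ M rs → mk⇔ (λ { (i , acc , value≡) → subst (λ s → T (accept s)) (sym value≡) acc })
                  (λ acc → let value≡ = sym (decode-encode (finite 0) (value M d rs)) in
                     encode (finite 0) (value M d rs) , subst (λ s → T (accept s)) value≡ acc , value≡))
    (∃ᶠ λ i → constᵈ (T? (accept (decode (finite 0) i))) ∧ᵈ valueᵈ d (decode (finite 0) i))

  accepted⇔ : OrderInvariant {σ} φ → ∀ M → structure M ⊨≤ φ ⇔ T (accept (value M d []))
  accepted⇔ invariant M with E , run≡ ← CanonicalForest.eliminationForest σ d ℛ M =
    mk⇔ (λ (≼ , sat) → to accepts⇔ (to (invariant (structure M) ≼ order) sat))
        (λ acc → order , from accepts⇔ acc)
    where
    open Correctness E
    accepts⇔ : expand (structure M) order ⊨MSO φ ⇔ T (accept (value M d []))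
    accepts⇔ = subst (λ s → expand (structure M) order ⊨MSO φ ⇔ T (accept s)) run≡
                 (⇔-sym (compile-correct φ [] [] [] [] [] refl refl))

theorem14 : (d : ℕ) → 1 ≤ d →
    (σ : Signature) →
    (φ : MSO-Sentence (σ ∪≤)) → OrderInvariant {σ} φ →
    Σ (FO+MOD-Sentence σ) λ ψ →
    qad ψ ≤ 3 * d ×
    ((𝔄 : Structure σ) → 𝔄 ∈Fin d → (𝔄 ⊨≤ φ) ⇔ (𝔄 ⊨ ψ))
theorem14 d@(suc k) _ σ φ invariant =
  ψ .formula [] , ≤-trans (ψ .bound [] none true) (rank≤ k) ,
  λ 𝔄 𝔄∈ → let M = 𝔄 , ∈Fin⇒DepthAtMost 𝔄∈ in
    ⇔-sym (ψ .correct M [] []) ⇔-∘ accepted⇔ σ d φ invariant M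
  where
  open GraphDefinability σ d
  ψ = acceptedᵈ σ d φ
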